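{- There exist a set $D$ with $|D| = 3$ and a relation $R \subseteq D^4$ such that, as $n \to \infty$, $$\mathrm{CL}(R, n) \ge \Omega(n^3) \qquad\text{and}\qquad \mathrm{NRD}(R,n) \le \frac{n^3}{2^{\Omega(\log^*(n))}}.$$ That is, there exist constants $c_1, c_2 > 0$ and $n_0$ such that for all integers $n \ge n_0$, $\mathrm{CL}(R,n) \ge c_1 n^3$ and $\mathrm{NRD}(R,n) \le n^3 / 2^{c_2 \log^*(n)}$.
   Context: Given a relation $R \subseteq D^r$ over a finite domain $D$, an instance of $\mathrm{CSP}(R)$ is a pair $(V, C)$ with $V$ a finite set of variables (typically $V = [n] = \{1,\dots,n\}$) and $C \subseteq V^r$ a set of constraints. For an assignment $\varphi : V \to D$ and $S = (v_1,\dots,v_r) \in C$, write $\varphi(S) := (\varphi(v_1),\dots,\varphi(v_r))$; the constraint $S$ is satisfied by $\varphi$ if $\varphi(S) \in R$. An instance on variables $[n]$ with constraints $S_1,\dots,S_m$ is non-redundant if for each $i \in [m]$ there is an assignment $\varphi_i : [n] \to D$ with $\varphi_i(S_i) \notin R$ and $\varphi_i(S_j) \in R$ for all $j \in [m]$ with $j \neq i$. $\mathrm{NRD}(R,n)$ is the maximum $m$ such that there is a non-redundant instance of $\mathrm{CSP}(R)$ with $n$ variables and $m$ constraints. An instance on variables $[n]$ with an ordered list of constraints $S_1,\dots,S_m$ is a valid witness to chain length if for each $i \in [m]$ there is an assignment $\varphi_i : [n] \to D$ with $\varphi_i(S_i) \notin R$ and $\varphi_i(S_j) \in R$ for all $j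 < i$. $\mathrm{CL}(R,n)$ is the maximum $m$ such that there is an instance of $\mathrm{CSP}(R)$ with $n$ variables and $m$ constraints that is a valid witness to chain length. $\log^*(n)$ is the iterated logarithm: the number of times $\log_2$ must be applied to $n$ before the result is at most $1$. -}

module Defs where

open import Data.Bool using (Bool; T)
open import Data.Bool.Properties using (T?)
open import Data.Fin as Fin using (Fin)
import Data.Fin.Properties as Fin
open import Data.Integer using (∣_∣)
open import Data.Nat
open import Data.Nat.GeneralisedArithmetic using (iterate)
open import Data.Nat.Induction using (<-wellFounded)
open import Data.Nat.Logarithm using (⌈log₂_⌉; ⌈log₂⌉-mono-≤; ⌈log₂2^n⌉≡n)
open import Data.Nat.Properties
open import Data.Product using (∃; _×_; _,_; proj₁; proj₂)
open import Data.Rational using (ℚ; ↥_; ↧ₙ_)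
open import Data.Vec using (Vec; []; _∷_; lookup; map; tabulate)
open import Data.Vec.Properties using (map-cong; lookup∘tabulate; tabulate∘lookup; tabulate-cong)
open import Function using (_∘_; _↔_; Inverse)
open import Induction.WellFounded using (Acc; acc)
open import Level using (0ℓ)
open import Relation.Binary.PropositionalEquality
open import Relation.Nullary using (¬_; Dec; yes; no; ¬?; contradiction; map′; _×-dec_; _→-dec_)
open import Relation.Unary using (Pred; Decidable)

private
  variable
    A B D : Set
    d m n r : ℕ

IsMaximum : Pred ℕ 0ℓ → Pred ℕ 0ℓ
IsMaximum P m = P m × (∀ {k} → P k → k ≤ m)

IsMinimum : Pred ℕ 0ℓ → Pred ℕ 0ℓ
IsMinimum P m = P m × (∀ {k} → P k → m ≤ k)

------------------------------------------------------------------------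
-- Constraint satisfaction problems

Relation : Set → ℕ → Set
Relation D r = Vec D r → Bool

Constraint : ℕ → ℕ → Set
Constraint n r = Vec (Fin n) r

-- The constraints are listed as S₁, …, Sₘ.  Distinctness is not imposed
-- here, but is forced by either of the two conditions below (see
-- ChainWitness-distinct), so that m is the size of the constraint set.
Instance : (n r m : ℕ) → Set
Instance n r m = Vec (Constraint n r) m

_⊨[_]_ : (Fin n → D) → Relation D r → Constraint n r → Set
φ ⊨[ R ] S = T (R (map φ S))

NonRedundant : Relation D r → Instance n r m → Set
NonRedundant R S = ∀ i → ∃ λ φ →
  ¬ (φ ⊨[ R ] lookup S i) × (∀ j → j ≢ i → φ ⊨[ R ] lookup S j)

ChainWitness : Relation D r → Instance n r m → Set
ChainWitness R S = ∀ i → ∃ λ φ →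
  ¬ (φ ⊨[ R ] lookup S i) × (∀ j → j Fin.< i → φ ⊨[ R ] lookup S j)

HasNonRedundant : Relation D r → (n m : ℕ) → Set
HasNonRedundant {r = r} R n m = ∃ λ (S : Instance n r m) → NonRedundant R S

HasChain : Relation D r → (n m : ℕ) → Set
HasChain {r = r} R n m = ∃ λ (S : Instance n r m) → ChainWitness R S

------------------------------------------------------------------------
-- Existence of the maxima defining NRD and CL

NonRedundant⇒ChainWitness : (R : Relation D r) (S : Instance n r m) →
                            NonRedundant R S → ChainWitness R S
NonRedundant⇒ChainWitness R S nr i with nr i
... | φ , ¬sat , sat = φ , ¬sat , λ j j<i → sat j (Fin.<⇒≢ j<i)

ChainWitness-distinct : (R : Relation D r) (S : Instance n r m) →
                        ChainWitness R S → ∀ {i j} → i Fin.< j → lookup S i ≢ lookup S j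
ChainWitness-distinct R S cw {i} {j} i<j eq with cw j
... | φ , ¬sat , sat = ¬sat (subst (φ ⊨[ R ]_) eq (sat i i<j))

private
  encode : Constraint n r → Fin (n ^ r)
  encode S = Fin.funToFin (lookup S)

  encode-injective : {S S′ : Constraint n r} → encode S ≡ encode S′ → S ≡ S′
  encode-injective {S = S} {S′} eq = begin
    S                                        ≡⟨ decode S ⟨
    tabulate (Fin.finToFun (encode S))       ≡⟨ cong (tabulate ∘ Fin.finToFun) eq ⟩
    tabulate (Fin.finToFun (encode S′))      ≡⟨ decode S′ ⟩
    S′                                       ∎
    where
    open ≡-Reasoning
    decode : (S : Constraint n r) → tabulate (Fin.finToFun (encode S)) ≡ S
    decode S = trans (tabulate-cong (Fin.finToFun-funToFin (lookup S))) (tabulate∘lookup S)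

ChainWitness-bound : (R : Relation D r) (S : Instance n r m) → ChainWitness R S → m ≤ n ^ r
ChainWitness-bound {r = r} {n} {m} R S cw with m ≤? n ^ r
... | yes m≤n^r = m≤n^r
... | no  m≰n^r with Fin.pigeonhole (≰⇒> m≰n^r) (encode ∘ lookup S)
...   | i , j , i<j , eq = contradiction (encode-injective eq)
          (ChainWitness-distinct R S cw i<j)

private
  Searchable : Set → Set₁
  Searchable A = {P : Pred A 0ℓ} → Decidable P → Dec (∃ P)

  search-Vec : Searchable A → Searchable (Vec A n)
  search-Vec {n = zero}  search P? = map′ ([] ,_) (λ { ([] , p) → p }) (P? [])
  search-Vec {n = suc n} search P? =
    map′ (λ (x , xs , p) → x ∷ xs , p) (λ { (x ∷ xs , p) → x , xs , p })
         (search λ x → search-Vec search λ xs → P? (x ∷ xs))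

  search-↔ : A ↔ B → Searchable B → Searchable A
  search-↔ A↔B search {P} P? =
    map′ (λ (y , p) → from y , p)
         (λ (x , p) → to x , subst P (sym (strictlyInverseʳ x)) p)
         (search (P? ∘ from))
    where open Inverse A↔B

  search-Fun : Searchable D → {P : Pred (Fin n → D) 0ℓ} →
               (∀ {φ ψ} → φ ≗ ψ → P φ → P ψ) → Decidable P → Dec (∃ P)
  search-Fun search resp P? =
    map′ (λ (v , p) → lookup v , p)
         (λ (φ , p) → tabulate φ , resp (sym ∘ lookup∘tabulate φ) p)
         (search-Vec search (P? ∘ lookup))

  ⊨-resp : (R : Relation D r) {φ ψ : Fin n → D} → φ ≗ ψ →
           (S : Constraint n r) → φ ⊨[ R ] S → ψ ⊨[ R ] S
  ⊨-resp R φ≗ψ S = subst (T ∘ R) (map-cong φ≗ψ S)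

  witness? : Searchable D → (R : Relation D r) (S : Instance n r m) →
             {Q : Fin m → Fin m → Set} → (∀ i j → Dec (Q i j)) →
             Dec (∀ i → ∃ λ φ →
                  ¬ (φ ⊨[ R ] lookup S i) × (∀ j → Q i j → φ ⊨[ R ] lookup S j))
  witness? search R S Q? = Fin.all? λ i → search-Fun search
    (λ φ≗ψ (¬sat , sat) →
      ¬sat ∘ ⊨-resp R (sym ∘ φ≗ψ) (lookup S i) ,
      λ j q → ⊨-resp R φ≗ψ (lookup S j) (sat j q))
    (λ φ → ¬? (T? _) ×-dec Fin.all? λ j → Q? i j →-dec T? _)

  search-finite : D ↔ Fin d → Searchable D
  search-finite D↔Fin = search-↔ D↔Fin Fin.any?

  search-Instance : Searchable (Instance n r m)
  search-Instance = search-Vec (search-Vec Fin.any?)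

  maximum : {P : Pred ℕ 0ℓ} → Decidable P → P 0 →
            ∀ b → (∀ {k} → P k → k ≤ b) → ∃ (IsMaximum P)
  maximum P? p₀ zero    bound = 0 , p₀ , bound
  maximum {P} P? p₀ (suc b) bound with P? (suc b)
  ... | yes p = suc b , p , bound
  ... | no ¬p = maximum P? p₀ b λ {k} pₖ →
                  s≤s⁻¹ (≤∧≢⇒< (bound pₖ) (λ k≡1+b → ¬p (subst P k≡1+b pₖ)))

maximalNonRedundant : D ↔ Fin d → (R : Relation D r) (n : ℕ) →
                      ∃ (IsMaximum (HasNonRedundant R n))
maximalNonRedundant {r = r} fin R n = maximum
  (λ m → search-Instance λ S →
    witness? (search-finite fin) R S λ i j → ¬? (j Fin.≟ i))
  ([] , λ ())
  (n ^ r)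
  (λ (S , nr) → ChainWitness-bound R S (NonRedundant⇒ChainWitness R S nr))

maximalChain : D ↔ Fin d → (R : Relation D r) (n : ℕ) → ∃ (IsMaximum (HasChain R n))
maximalChain {r = r} fin R n = maximum
  (λ m → search-Instance λ S →
    witness? (search-finite fin) R S λ i j → j Fin.<? i)
  ([] , λ ())
  (n ^ r)
  (λ (S , cw) → ChainWitness-bound R S cw)

NRD : D ↔ Fin d → Relation D r → ℕ → ℕ
NRD fin R n = proj₁ (maximalNonRedundant fin R n)

CL : D ↔ Fin d → Relation D r → ℕ → ℕ
CL fin R n = proj₁ (maximalChain fin R n)

------------------------------------------------------------------------
-- The iterated logarithm

-- Rounding up at each step does not change the count: for an integer t,
-- log₂ x ≤ t iff ⌈log₂ x⌉ ≤ t, so both the real and the rounded k-fold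
-- iterate of n are at most 1 exactly when n is at most the k-th term of
-- 1, 2, 2^2, 2^(2^2), ….  (The case n = 0 is the convention log* 0 = 0.)
logIterations : ∀ n → ∃ (IsMinimum λ k → iterate ⌈log₂_⌉ n k ≤ 1)
logIterations n = go n (<-wellFounded n)
  where
  1+n≤2^n : ∀ n → suc n ≤ 2 ^ n
  1+n≤2^n zero    = ≤-refl
  1+n≤2^n (suc n) = begin
    1 + suc n          ≤⟨ +-mono-≤ (m^n>0 2 n) (1+n≤2^n n) ⟩
    2 ^ n + 2 ^ n      ≡⟨ cong (2 ^ n +_) (+-identityʳ (2 ^ n)) ⟨
    2 ^ suc n          ∎
    where open ≤-Reasoning

  ⌈log₂1+n⌉<1+n : ∀ n → ⌈log₂ suc n ⌉ < suc n
  ⌈log₂1+n⌉<1+n n = s≤s (begin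
    ⌈log₂ suc n ⌉      ≤⟨ ⌈log₂⌉-mono-≤ (1+n≤2^n n) ⟩
    ⌈log₂ (2 ^ n) ⌉    ≡⟨ ⌈log₂2^n⌉≡n n ⟩
    n                  ∎)
    where open ≤-Reasoning

  go : ∀ n → Acc _<_ n → ∃ (IsMinimum λ k → iterate ⌈log₂_⌉ n k ≤ 1)
  go 0 _ = 0 , z≤n , λ _ → z≤n
  go 1 _ = 0 , ≤-refl , λ _ → z≤n
  go n@(suc (suc n-2)) (acc rs) with go ⌈log₂ n ⌉ (rs (⌈log₂1+n⌉<1+n (suc n-2)))
  ... | k , p , least = suc k , p , least⁺
    where
    least⁺ : ∀ {j} → iterate ⌈log₂_⌉ n j ≤ 1 → suc k ≤ j
    least⁺ {zero}  (s≤s ())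
    least⁺ {suc j} q = s≤s (least q)

log* : ℕ → ℕ
log* n = proj₁ (logIterations n)

------------------------------------------------------------------------

-- x ≤ y / 2^(c k) over the reals, for a rational c = p / q ≥ 0: multiply out
-- and raise both sides to the q-th power, x^q 2^(p k) ≤ y^q.  Since k ≥ 0,
-- asking for some rational c > 0 is the same as asking for some real c > 0.
-- For negative c the definition is not meaningful.
infix 4 _≤_/2^[_·_]

_≤_/2^[_·_] : ℕ → ℕ → ℚ → ℕ → Set
x ≤ y /2^[ c · k ] = x ^ ↧ₙ c * 2 ^ (∣ ↥ c ∣ * k) ≤ y ^ ↧ₙ c

{-# OPTIONS --safe #-}

-- The relation on D = {0, 1, 2} requires of (w, x, y, z) that y = 1 implies z ≠ 0,
-- that y = 2 implies x ≠ 0, that y = 0 implies x = 0 ⇔ z = 0, and it excludes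
-- w = x = y = z = 0.
--
-- Chains: order the constraints (w, x, y, z) with z = x + y lexicographically by
-- (x, y, w), and let the assignment of a constraint be 0 exactly on its own
-- variables, 1 on smaller y and 2 on larger y.  Of the constraints sharing x or
-- z with it, the earlier ones have smaller resp. larger y.
--
-- Non-redundancy: O(n²) constraints are violated because y = 1 and z = 0, or y = 2
-- and x = 0 (two coordinates determine them), or y = 0 and exactly one of x, z is 0
-- (they form a forest on pairs of variables).  Consider those violated by 0000 with
-- a given w.  In the assignment of (x, y, z), another constraint through x and y′
-- forces y′ = 1, and another one through z and y′ forces y′ = 2.  Hence in the
-- tripartite graph spanned by these triples every edge is in exactly one triangle,
-- which is the Ruzsa–Szemerédi problem.  Its bound n² / 2^Ω(log* n) is a case of
-- Fox's triangle removal lemma; a direct proof is as follows.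
--
-- Colour the vertices, and label each cell (pair of colours) by some j, ideally log₂
-- of its inverse density.  The sum of j over all edges and of 2 ^ (- j) over all pairs
-- of vertices takes the role of Fox's entropy.  If a rectangle-like part of a cell
-- is large but has few edges, then raising the label there saves a constant fraction
-- of the edges of the cell.  Such a part exists in each dense triple X, Y, Z:
-- let U be the union of the rectangles N(y) × N(y) of a few y that cover almost as
-- much of X × Z as possible.  An edge xz in N(y) × N(y) has y as its third vertex, so U
-- has few edges.  If U is small, take a few x whose neighbourhoods cover almost as
-- much of Y as possible.  The rest of Y has few edges to X, and if it is small, then
-- the sets N(x) × (Z ∖ U(x)) cover much of Y × Z but have few edges.  For density
-- 2 ^ (- e) the initial cost is O(e) per edge, so there are O(e) refinements, and each
-- of them makes the number of colours at most doubly exponential in the previous one.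

module Submission where

open import Defs
import Algebra.Properties.Semiring.Sum as SemiringSum
open import Algebra.Bundles using (CommutativeRing)
open import Data.Bool as Bool using (Bool; true; false; _∧_; _∨_; not; if_then_else_; T; _xor_)
open import Data.Bool.ListAction using (any)
open import Data.Bool.Properties using (∧-zeroʳ; ∨-zeroʳ; ∨-identityʳ; ∧-assoc; xor-∧-commutativeRing)
open import Data.Fin as Fin using (Fin; zero; suc; combine; _↑ˡ_; _↑ʳ_; splitAt; fromℕ<; toℕ)
open import Data.Fin.Patterns using (0F; 1F; 2F; 3F)
import Data.Fin.Properties as Fin
import Data.Integer as ℤ
import Data.Integer.Properties as ℤ
open import Data.List as List using (List; []; _∷_; length; _++_; concatMap; allFin)
open import Data.List.Properties using (length-map; length-++; length-tabulate)
open import Data.List.Relation.Unary.All as All using (All; []; _∷_)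
import Data.List.Relation.Unary.All.Properties as All
open import Data.Maybe using (Maybe; just; nothing; _<∣>_; _>>=_)
open import Data.Nat renaming (_/_ to _div_)
open import Data.Nat.DivMod using (m≡m%n+[m/n]*n; m%n<n)
open import Data.Nat.GeneralisedArithmetic using (iterate)
open import Data.Nat.Induction using (<-rec)
open import Data.Nat.Logarithm
open import Data.Nat.Properties
open import Algebra.Properties.CommutativeSemigroup *-commutativeSemigroup using (x∙yz≈y∙xz; interchange)
open import Data.Nat.Tactic.RingSolver using (solve-∀)
open import Data.Product as Product using (∃; ∃₂; Σ; _×_; _,_; proj₁; proj₂; uncurry)
open import Data.Rational as ℚ using (ℚ; _/_; ↥_; ↧ₙ_; toℚᵘ)
import Data.Rational.Properties as ℚ
import Data.Rational.Unnormalised as ℚᵘ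
import Data.Rational.Unnormalised.Properties as ℚᵘ
open import Data.Sum using (_⊎_; inj₁; inj₂; [_,_]′; map₂)
open import Data.Vec as Vec using (Vec; []; _∷_; lookup)
open import Data.Vec.Properties using (lookup∘tabulate)
open import Function using (_∘_; case_of_; id; const; _↔_)
open import Function.Construct.Identity using (↔-id)
open import Relation.Binary.Definitions using (tri<; tri≈; tri>)
open import Relation.Binary.PropositionalEquality hiding (J)
open import Relation.Nullary using (¬_; Dec; yes; no; does; contradiction; _×-dec_)
open import Relation.Nullary.Decidable using (dec-true)

private
  variable
    A B C Ω : Set
    k l m n M : ℕ

  module Sum = SemiringSum +-*-semiring

-- Finite sums

infix 4 _==_
_==_ : Fin n → Fin n → Bool
u == v = does (u Fin.≟ v)

==-refl : (u : Fin n) → (u == u) ≡ true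
==-refl u = dec-true (u Fin.≟ u) refl

==⇒≡ : {u v : Fin n} → (u == v) ≡ true → u ≡ v
==⇒≡ {u = u} {v} eq with u Fin.≟ v
... | yes u≡v = u≡v
... | no _    = case eq of λ ()

≡⇒== : {u v : Fin n} → u ≡ v → (u == v) ≡ true
≡⇒== {u = u} refl = ==-refl u

∧-true : ∀ {p q} → p ∧ q ≡ true → p ≡ true × q ≡ true
∧-true {true} {true} _ = refl , refl

𝟙 : Bool → ℕ
𝟙 false = 0
𝟙 true  = 1

𝟙-∧ : ∀ p q → 𝟙 (p ∧ q) ≡ 𝟙 p * 𝟙 q
𝟙-∧ false q = refl
𝟙-∧ true  q = sym (+-identityʳ _)

𝟙≤1 : ∀ p → 𝟙 p ≤ 1
𝟙≤1 false = z≤n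
𝟙≤1 true  = ≤-refl

𝟙-mono : ∀ {p q} → (p ≡ true → q ≡ true) → 𝟙 p ≤ 𝟙 q
𝟙-mono {false} _ = z≤n
𝟙-mono {true}  f rewrite f refl = ≤-refl

𝟙*-mono : ∀ p {a b} → (p ≡ true → a ≤ b) → 𝟙 p * a ≤ 𝟙 p * b
𝟙*-mono false _ = z≤n
𝟙*-mono true  f = *-monoʳ-≤ 1 (f refl)

-- Opaque, because unfolding the library's sums is prohibitively slow.
opaque
  sum : (Fin n → ℕ) → ℕ
  sum = Sum.sum

  sum-suc : (f : Fin (suc n) → ℕ) → sum f ≡ f zero + sum (f ∘ suc)
  sum-suc f = refl

  sum-zero : (f : Fin 0 → ℕ) → sum f ≡ 0
  sum-zero f = refl

  sum-cong-≗ : {f g : Fin n → ℕ} → f ≗ g → sum f ≡ sum g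
  sum-cong-≗ = Sum.sum-cong-≗

  ∑-distrib-+ : (f g : Fin n → ℕ) → sum (λ i → f i + g i) ≡ sum f + sum g
  ∑-distrib-+ = Sum.∑-distrib-+

  ∑-comm : (f : Fin m → Fin n → ℕ) → sum (λ i → sum (f i)) ≡ sum (λ j → sum λ i → f i j)
  ∑-comm = Sum.∑-comm

  *-distribˡ-sum : (c : ℕ) (f : Fin n → ℕ) → c * sum f ≡ sum (λ i → c * f i)
  *-distribˡ-sum = Sum.*-distribˡ-sum

  *-distribʳ-sum : (c : ℕ) (f : Fin n → ℕ) → sum f * c ≡ sum (λ i → f i * c)
  *-distribʳ-sum = Sum.*-distribʳ-sum

  ∑-mono : {f g : Fin n → ℕ} → (∀ i → f i ≤ g i) → sum f ≤ sum g
  ∑-mono {zero}  f≤g = z≤n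
  ∑-mono {suc n} f≤g = +-mono-≤ (f≤g zero) (∑-mono (f≤g ∘ suc))

  ∑-const : ∀ n c → sum {n} (λ _ → c) ≡ n * c
  ∑-const zero    c = refl
  ∑-const (suc n) c = cong (c +_) (∑-const n c)

∑-bound : (f : Fin n → ℕ) (c : ℕ) → (∀ i → f i ≤ c) → sum f ≤ n * c
∑-bound {n} f c f≤c = ≤-trans (∑-mono f≤c) (≤-reflexive (∑-const n c))

∑-≡0 : {f : Fin n → ℕ} → (∀ i → f i ≡ 0) → sum f ≡ 0
∑-≡0 {n} eq = trans (sum-cong-≗ eq) (trans (∑-const n 0) (*-zeroʳ n))

∑-== : (v : Fin n) (f : Fin n → ℕ) → sum (λ u → 𝟙 (v == u) * f u) ≡ f v
∑-== zero    f = trans (sum-suc _) (trans (cong₂ _+_ (*-identityˡ (f zero)) (∑-≡0 λ _ → refl)) (+-identityʳ _))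
∑-== (suc v) f = trans (sum-suc _) (∑-== v (f ∘ suc))

count : (Fin n → Bool) → ℕ
count p = sum (𝟙 ∘ p)

count-unique : (p : Fin m → Bool) → (∀ i j → p i ≡ true → p j ≡ true → i ≡ j) → count p ≤ 1
count-unique {zero}  p unique = ≤-trans (≤-reflexive (sum-zero _)) z≤n
count-unique {suc m} p unique with p zero in eq | sum-suc (𝟙 ∘ p)
... | false | ∑p = ≤-trans (≤-reflexive ∑p)
  (count-unique (p ∘ suc) λ i j pᵢ pⱼ → Fin.suc-injective (unique (suc i) (suc j) pᵢ pⱼ))
... | true  | ∑p = ≤-reflexive (trans ∑p (cong suc (∑-≡0 absent)))
  where
  absent : ∀ i → 𝟙 (p (suc i)) ≡ 0
  absent i with p (suc i) in eqᵢ
  ... | false = refl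
  ... | true  = case unique zero (suc i) eq eqᵢ of λ ()

count-== : (v : Fin n) → count (v ==_) ≡ 1
count-== v = trans (sum-cong-≗ λ u → sym (*-identityʳ (𝟙 (v == u)))) (∑-== v (λ _ → 1))

∑∑-mono : {f g : Fin m → Fin n → ℕ} → (∀ i j → f i j ≤ g i j) →
          sum (λ i → sum (f i)) ≤ sum (λ i → sum (g i))
∑∑-mono f≤g = ∑-mono λ i → ∑-mono (f≤g i)

∑∑-cong : {f g : Fin m → Fin n → ℕ} → (∀ i j → f i j ≡ g i j) →
          sum (λ i → sum (f i)) ≡ sum (λ i → sum (g i))
∑∑-cong f≡g = sum-cong-≗ λ i → sum-cong-≗ (f≡g i)

∑∑-distrib-+ : (f g : Fin m → Fin n → ℕ) → sum (λ i → sum λ j → f i j + g i j) ≡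
               sum (λ i → sum (f i)) + sum (λ i → sum (g i))
∑∑-distrib-+ f g = trans (sum-cong-≗ λ i → ∑-distrib-+ (f i) (g i))
                         (∑-distrib-+ (λ i → sum (f i)) (λ i → sum (g i)))

∑∑-*ˡ : (c : ℕ) (f : Fin m → Fin n → ℕ) →
        c * sum (λ i → sum (f i)) ≡ sum (λ i → sum λ j → c * f i j)
∑∑-*ˡ c f = trans (*-distribˡ-sum c (λ i → sum (f i))) (sum-cong-≗ λ i → *-distribˡ-sum c (f i))

∑∑-const : ∀ m n c → sum {m} (λ _ → sum {n} (λ _ → c)) ≡ m * n * c
∑∑-const m n c = trans (trans (sum-cong-≗ {m} λ _ → ∑-const n c) (∑-const m (n * c)))
                       (sym (*-assoc m n c))

∑∑-product : (P : Fin m → Bool) (Q : Fin n → Bool) →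
             sum (λ u → sum λ v → 𝟙 (P u ∧ Q v)) ≡ count P * count Q
∑∑-product P Q = begin
  sum (λ u → sum λ v → 𝟙 (P u ∧ Q v))     ≡⟨ ∑∑-cong (λ u v → 𝟙-∧ (P u) (Q v)) ⟩
  sum (λ u → sum λ v → 𝟙 (P u) * 𝟙 (Q v)) ≡⟨ sum-cong-≗ (λ u → *-distribˡ-sum (𝟙 (P u)) (𝟙 ∘ Q)) ⟨
  sum (λ u → 𝟙 (P u) * count Q)           ≡⟨ *-distribʳ-sum (count Q) (𝟙 ∘ P) ⟨
  count P * count Q                       ∎
  where open ≡-Reasoning

∑∑-== : (a : Fin m) (b : Fin n) (f : Fin m → Fin n → ℕ) →
        sum (λ u → sum λ v → 𝟙 ((a == u) ∧ (b == v)) * f u v) ≡ f a b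
∑∑-== a b f = begin
  sum (λ u → sum λ v → 𝟙 ((a == u) ∧ (b == v)) * f u v)
    ≡⟨ ∑∑-cong (λ u v → trans (cong (_* f u v) (𝟙-∧ (a == u) (b == v))) (*-assoc (𝟙 (a == u)) _ _)) ⟩
  sum (λ u → sum λ v → 𝟙 (a == u) * (𝟙 (b == v) * f u v))
    ≡⟨ sum-cong-≗ (λ u → *-distribˡ-sum (𝟙 (a == u)) (λ v → 𝟙 (b == v) * f u v)) ⟨
  sum (λ u → 𝟙 (a == u) * sum (λ v → 𝟙 (b == v) * f u v))
    ≡⟨ sum-cong-≗ (λ u → cong (𝟙 (a == u) *_) (∑-== b (f u))) ⟩
  sum (λ u → 𝟙 (a == u) * f u b)
    ≡⟨ ∑-== a (λ u → f u b) ⟩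
  f a b ∎
  where open ≡-Reasoning

InjectivePair : (Fin m → Fin n) → (Fin m → Fin n) → Set
InjectivePair l r = ∀ i j → l i ≡ l j → r i ≡ r j → i ≡ j

-- Each pair `(u , v)` is `(l i , r i)` for at most one `i`, so every term on the left has its own
-- term in the double sum. This is how edge counts are bounded by areas throughout.
∑-injectivePair : {l r : Fin m → Fin n} → InjectivePair l r → (f : Fin n → Fin n → ℕ) →
                  sum (λ i → f (l i) (r i)) ≤ sum (λ u → sum (f u))
∑-injectivePair {m} {n} {l} {r} inj f = begin
  sum (λ i → f (l i) (r i))
    ≡⟨ sum-cong-≗ (λ i → ∑∑-== (l i) (r i) f) ⟨
  sum (λ i → sum λ u → sum λ v → 𝟙 ((l i == u) ∧ (r i == v)) * f u v)
    ≡⟨ ∑-comm {m} {n} (λ i u → sum λ v → 𝟙 ((l i == u) ∧ (r i == v)) * f u v) ⟩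
  sum (λ u → sum λ i → sum λ v → 𝟙 ((l i == u) ∧ (r i == v)) * f u v)
    ≡⟨ sum-cong-≗ {n} (λ u → ∑-comm {m} {n} (λ i v → 𝟙 ((l i == u) ∧ (r i == v)) * f u v)) ⟩
  sum (λ u → sum λ v → sum λ i → 𝟙 ((l i == u) ∧ (r i == v)) * f u v)
    ≡⟨ ∑∑-cong (λ u v → *-distribʳ-sum {m} (f u v) (λ i → 𝟙 ((l i == u) ∧ (r i == v)))) ⟨
  sum (λ u → sum λ v → count (λ i → (l i == u) ∧ (r i == v)) * f u v)
    ≤⟨ ∑∑-mono (λ u v → *-monoˡ-≤ (f u v) (count-unique _ (unique u v))) ⟩
  sum (λ u → sum λ v → 1 * f u v)
    ≡⟨ ∑∑-cong (λ u v → *-identityˡ (f u v)) ⟩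
  sum (λ u → sum (f u)) ∎
  where
  open ≤-Reasoning
  unique : ∀ u v i j → (l i == u) ∧ (r i == v) ≡ true → (l j == u) ∧ (r j == v) ≡ true → i ≡ j
  unique u v i j pᵢ pⱼ with ∧-true {l i == u} pᵢ | ∧-true {l j == u} pⱼ
  ... | lᵢ , rᵢ | lⱼ , rⱼ = inj i j (trans (==⇒≡ lᵢ) (sym (==⇒≡ lⱼ))) (trans (==⇒≡ rᵢ) (sym (==⇒≡ rⱼ)))

∑-fibres : (χ : Fin n → Fin k) (f : Fin n → Fin k → ℕ) →
           sum (λ a → sum λ u → 𝟙 (χ u == a) * f u a) ≡ sum (λ u → f u (χ u))
∑-fibres {n} {k} χ f = trans (∑-comm {k} {n} λ a u → 𝟙 (χ u == a) * f u a)
                     (sum-cong-≗ λ u → ∑-== (χ u) (f u))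

∑-fibres₂ : (χ χ′ : Fin n → Fin k) (f : Fin n → Fin k → Fin k → ℕ) →
            sum (λ a → sum λ b → sum λ i → 𝟙 ((χ i == a) ∧ (χ′ i == b)) * f i a b) ≡
            sum (λ i → f i (χ i) (χ′ i))
∑-fibres₂ {n} {k} χ χ′ f = begin
  sum (λ a → sum λ b → sum λ i → 𝟙 ((χ i == a) ∧ (χ′ i == b)) * f i a b)
    ≡⟨ sum-cong-≗ {k} (λ a → ∑-comm {k} {n} λ b i → 𝟙 ((χ i == a) ∧ (χ′ i == b)) * f i a b) ⟩
  sum (λ a → sum λ i → sum λ b → 𝟙 ((χ i == a) ∧ (χ′ i == b)) * f i a b)
    ≡⟨ ∑-comm {k} {n} (λ a i → sum λ b → 𝟙 ((χ i == a) ∧ (χ′ i == b)) * f i a b) ⟩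
  sum (λ i → sum λ a → sum λ b → 𝟙 ((χ i == a) ∧ (χ′ i == b)) * f i a b)
    ≡⟨ sum-cong-≗ (λ i → ∑∑-== (χ i) (χ′ i) (f i)) ⟩
  sum (λ i → f i (χ i) (χ′ i)) ∎
  where open ≡-Reasoning

∑∑-fibres : (χ : Fin n → Fin k) (f : Fin n → Fin n → Fin k → Fin k → ℕ) →
            sum (λ a → sum λ b → sum λ u → sum λ v → 𝟙 ((χ u == a) ∧ (χ v == b)) * f u v a b) ≡
            sum (λ u → sum λ v → f u v (χ u) (χ v))
∑∑-fibres {n} {k} χ f = begin
  sum (λ a → sum λ b → sum λ u → sum λ v → 𝟙 ((χ u == a) ∧ (χ v == b)) * f u v a b)
    ≡⟨ sum-cong-≗ {k} (λ a → ∑-comm {k} {n} λ b u → sum λ v → 𝟙 ((χ u == a) ∧ (χ v == b)) * f u v a b) ⟩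
  sum (λ a → sum λ u → sum λ b → sum λ v → 𝟙 ((χ u == a) ∧ (χ v == b)) * f u v a b)
    ≡⟨ ∑-comm {k} {n} (λ a u → sum λ b → sum λ v → 𝟙 ((χ u == a) ∧ (χ v == b)) * f u v a b) ⟩
  sum (λ u → sum λ a → sum λ b → sum λ v → 𝟙 ((χ u == a) ∧ (χ v == b)) * f u v a b)
    ≡⟨ sum-cong-≗ {n} (λ u → ∑-fibres₂ (λ _ → χ u) χ (f u)) ⟩
  sum (λ u → sum λ v → f u v (χ u) (χ v)) ∎
  where open ≡-Reasoning

-- Greedy covers and averaging

greedy-cover : (μ : (Ω → Bool) → ℕ) {a Q : ℕ} → 0 < a → (∀ (p : Ω → Bool) → μ p ≤ a) →
               (∀ (p q : Ω → Bool) → μ p + μ (λ ω → q ω ∧ not (p ω)) ≤ μ (λ ω → q ω ∨ p ω)) →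
               (cand : Fin n → Bool) (R : Fin n → Ω → Bool) →
               ∃ λ (L : List (Fin n)) → length L ≤ Q × All (λ y → cand y ≡ true) L ×
               (∀ y → cand y ≡ true → Q * μ (λ ω → R y ω ∧ not (any (λ y′ → R y′ ω) L)) ≤ a)
greedy-cover {Ω = Ω} {n = n} μ {a} {Q} 0<a μ≤a μ-∨ cand R =
  go (suc Q) [] [] z≤n (≤-reflexive (cong suc (sym (+-identityʳ Q))))
  where
  ⋃ : List (Fin n) → Ω → Bool
  ⋃ L ω = any (λ y → R y ω) L

  gain : List (Fin n) → Fin n → ℕ
  gain L y = μ (λ ω → R y ω ∧ not (⋃ L ω))

  -- Each set that is added raises the measure of the union by at least `a / Q`, hence the invariant
  -- `length L * a ≤ Q * μ (⋃ L)`. As the measure never exceeds `a`, at most `Q` sets are added, and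
  -- `suc Q` units of fuel cannot run out.
  go : ∀ fuel (L : List (Fin n)) → All (λ y → cand y ≡ true) L → length L * a ≤ Q * μ (⋃ L) →
       suc Q ≤ fuel + length L →
       ∃ λ (L : List (Fin n)) → length L ≤ Q × All (λ y → cand y ≡ true) L ×
       (∀ y → cand y ≡ true → Q * gain L y ≤ a)
  go fuel L L⊆ inv enough with *-cancelʳ-≤ (length L) Q a {{>-nonZero 0<a}} (≤-trans inv (*-monoʳ-≤ Q (μ≤a (⋃ L))))
  go zero L L⊆ inv enough | |L|≤Q = contradiction |L|≤Q (<⇒≱ enough)
  go (suc fuel) L L⊆ inv enough | |L|≤Q
    with Fin.any? (λ y → (cand y Bool.≟ true) ×-dec (a ≤? Q * gain L y))
  ... | no ¬big = L , |L|≤Q , L⊆ , λ y y∈ → <⇒≤ (≰⇒> λ big → ¬big (y , y∈ , big))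
  ... | yes (y , y∈ , big) = go fuel (y ∷ L) (y∈ ∷ L⊆)
      (begin
        a + length L * a                 ≤⟨ +-mono-≤ big inv ⟩
        Q * gain L y + Q * μ (⋃ L)       ≡⟨ *-distribˡ-+ Q (gain L y) (μ (⋃ L)) ⟨
        Q * (gain L y + μ (⋃ L))         ≡⟨ cong (Q *_) (+-comm (gain L y) _) ⟩
        Q * (μ (⋃ L) + gain L y)         ≤⟨ *-monoʳ-≤ Q (μ-∨ (⋃ L) (R y)) ⟩
        Q * μ (⋃ (y ∷ L))                ∎)
      (≤-trans enough (≤-reflexive (sym (+-suc fuel (length L)))))
    where open ≤-Reasoning

𝟙-∨-∧ : ∀ c p q → 𝟙 (c ∧ p) + 𝟙 (c ∧ (q ∧ not p)) ≡ 𝟙 (c ∧ (q ∨ p))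
𝟙-∨-∧ false p     q     = refl
𝟙-∨-∧ true  false false = refl
𝟙-∨-∧ true  false true  = refl
𝟙-∨-∧ true  true  false = refl
𝟙-∨-∧ true  true  true  = refl

𝟙-∧≤ : ∀ c p → 𝟙 (c ∧ p) ≤ 𝟙 c
𝟙-∧≤ false p = z≤n
𝟙-∧≤ true  p = 𝟙≤1 p

union-bound : (t : ℕ) (c : Fin m → Bool) (r : A → Fin m → Bool) {b : ℕ} (L : List A) →
              All (λ a → t * count (λ i → c i ∧ r a i) ≤ b) L →
              t * count (λ i → c i ∧ any (λ a → r a i) L) ≤ length L * b
union-bound t c r []      []           =
  ≤-reflexive (trans (cong (t *_) (∑-≡0 λ i → cong 𝟙 (∧-zeroʳ (c i)))) (*-zeroʳ t))
union-bound t c r {b} (a ∷ L) (small ∷ all) = begin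
  t * count (λ i → c i ∧ (r a i ∨ any (λ a → r a i) L))
    ≤⟨ *-monoʳ-≤ t (∑-mono (λ i → split (c i) (r a i) _)) ⟩
  t * sum (λ i → 𝟙 (c i ∧ r a i) + 𝟙 (c i ∧ any (λ a → r a i) L))
    ≡⟨ cong (t *_) (∑-distrib-+ (λ i → 𝟙 (c i ∧ r a i)) _) ⟩
  t * (count (λ i → c i ∧ r a i) + count (λ i → c i ∧ any (λ a → r a i) L))
    ≡⟨ *-distribˡ-+ t (count (λ i → c i ∧ r a i)) _ ⟩
  t * count (λ i → c i ∧ r a i) + t * count (λ i → c i ∧ any (λ a → r a i) L)
    ≤⟨ +-mono-≤ small (union-bound t c r L all) ⟩
  b + length L * b ∎
  where
  open ≤-Reasoning
  split : ∀ c p q → 𝟙 (c ∧ (p ∨ q)) ≤ 𝟙 (c ∧ p) + 𝟙 (c ∧ q)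
  split false p     q = z≤n
  split true  false q = ≤-refl
  split true  true  q = s≤s z≤n

≤ᵇ-true : ∀ {a b} → (a ≤ᵇ b) ≡ true → a ≤ b
≤ᵇ-true {a} {b} eq = ≤ᵇ⇒≤ a b (subst T (sym eq) _)

≤ᵇ-false : ∀ {a b} → (a ≤ᵇ b) ≡ false → b < a
≤ᵇ-false eq = ≰⇒> λ a≤b → subst T eq (≤⇒≤ᵇ a≤b)

-- Markov's inequality: every bad element contributes more than `t` to a sum that is at most
-- `count X * t / 4`.
markov : (X : Fin n → Bool) (f : Fin n → ℕ) (t : ℕ) → 0 < t →
         4 * sum (λ x → 𝟙 (X x) * f x) ≤ count X * t →
         4 * count (λ x → X x ∧ not (f x ≤ᵇ t)) ≤ count X
markov X f t 0<t mean = *-cancelʳ-≤ _ _ t {{>-nonZero 0<t}} (begin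
  4 * count bad * t                      ≡⟨ *-assoc 4 (count bad) t ⟩
  4 * (count bad * t)                    ≡⟨ cong (4 *_) (*-distribʳ-sum t (𝟙 ∘ bad)) ⟩
  4 * sum (λ x → 𝟙 (bad x) * t)          ≤⟨ *-monoʳ-≤ 4 (∑-mono large) ⟩
  4 * sum (λ x → 𝟙 (X x) * f x)          ≤⟨ mean ⟩
  count X * t                            ∎)
  where
  open ≤-Reasoning
  bad : Fin _ → Bool
  bad x = X x ∧ not (f x ≤ᵇ t)
  large : ∀ x → 𝟙 (bad x) * t ≤ 𝟙 (X x) * f x
  large x with X x | f x ≤ᵇ t in eq
  ... | false | _     = z≤n
  ... | true  | true  = z≤n
  ... | true  | false = *-monoʳ-≤ 1 (<⇒≤ (≤ᵇ-false eq))

-- Splitting a dense triple of cells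

any-map : (f : B → Bool) (g : A → B) (L : List A) → any f (List.map g L) ≡ any (f ∘ g) L
any-map f g []      = refl
any-map f g (a ∷ L) = cong (f (g a) ∨_) (any-map f g L)

-- The last component says that `a` occurs in `L`, in the form in which it is applied: to another
-- predicate `g` in place of `f`.
any-true : (f : A → Bool) {P : A → Set} (L : List A) → All P L → any f L ≡ true →
           ∃ λ a → P a × f a ≡ true × (∀ g → g a ≡ true → any g L ≡ true)
any-true f (a ∷ L) (Pa ∷ PL) any≡true with f a in fa
... | true = a , Pa , fa , λ g ga → cong (_∨ any g L) ga
... | false with any-true f L PL any≡true
...   | a′ , Pa′ , fa′ , in′ = a′ , Pa′ , fa′ , λ g ga′ → trans (cong (g a ∨_) (in′ g ga′)) (∨-zeroʳ (g a))

-- Opaque, lest 64 * t be unfolded.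
opaque
  c₆₄ : ℕ
  c₆₄ = 64

  c₆₄≡64 : c₆₄ ≡ 64
  c₆₄≡64 = refl

0<c₆₄ : 0 < c₆₄
0<c₆₄ = subst (0 <_) (sym c₆₄≡64) z<s

rectangle : (Fin n → Bool) × (Fin n → Bool) → Fin n → Fin n → Bool
rectangle (α , β) u v = α u ∧ β v

-- `S` is a union of rectangles so that membership of a pair depends only on Boolean values attached
-- to its two ends, which a finer colouring can record. An eighth of the area against a 64th of the
-- edges is the imbalance for which raising the label on `S` pays, see `split-arith`.
record Split {m n} (l r : Fin m → Fin n) (P Q : Fin n → Bool) (K : ℕ) : Set where
  field
    S          : Fin n → Fin n → Bool
    rectangles : List ((Fin n → Bool) × (Fin n → Bool))
    few        : length rectangles ≤ K
    S≡⋃        : ∀ u v → S u v ≡ any (λ ρ → rectangle ρ u v) rectangles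
    large      : count P * count Q ≤ 8 * sum (λ u → sum λ v → 𝟙 ((P u ∧ Q v) ∧ S u v))
    sparse     : c₆₄ * count (λ i → (P (l i) ∧ Q (r i)) ∧ S (l i) (r i)) ≤ count (λ i → P (l i) ∧ Q (r i))

private
  complement : ∀ p q → 𝟙 (p ∧ q) + 𝟙 (p ∧ not q) ≡ 𝟙 p
  complement false q     = refl
  complement true  false = refl
  complement true  true  = refl

  rearrange₁ : ∀ c₆₄ d r c → 4 * d * r * (c₆₄ * c) ≡ 4 * c₆₄ * d * r * c
  rearrange₁ = solve-∀

  rearrange₂ : ∀ d r c → r * (4 * (d * c)) ≡ 4 * d * r * c
  rearrange₂ = solve-∀

  rearrange₃ : ∀ c d q x → d * (q * (c * x)) ≡ x * (c * d * q)
  rearrange₃ = solve-∀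

  rearrange₄ : ∀ a b → 2 * a * (2 * b) ≡ 4 * (a * b)
  rearrange₄ = solve-∀

  rearrange₅ : ∀ a b c → 4 * (b * (a * c)) ≡ a * (4 * (b * c))
  rearrange₅ = solve-∀

  distribute : ∀ g a b → 4 * (g + (a + b)) ≡ 2 * (2 * g) + (4 * a + 4 * b)
  distribute = solve-∀

-- The triples are the triangles, and `A₁` and `A₂` are relations containing their xy- and yz-edges.
-- Uniqueness of triangles takes the form of a unique middle vertex over each xz-edge, because this
-- is what makes rectangles N(y) × N(y) poor in edges.
record IsRuzsaSzemerédi {m n} (x y z : Fin m → Fin n) (A₁ A₂ : Fin n → Fin n → Bool) : Set where
  field
    injective₁₂ : InjectivePair x y
    injective₂₃ : InjectivePair y z
    injective₁₃ : InjectivePair x z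
    edge₁₂      : ∀ i → A₁ (x i) (y i) ≡ true
    edge₂₃      : ∀ i → A₂ (y i) (z i) ≡ true
    induced     : ∀ i v → A₁ (x i) v ≡ true → A₂ v (z i) ≡ true → v ≡ y i

module _ {m n} {x y z : Fin m → Fin n} {A₁ A₂ : Fin n → Fin n → Bool}
         (rs : IsRuzsaSzemerédi x y z A₁ A₂)
         (X Y Z : Fin n → Bool) {d : ℕ} (0<d : 0 < d) where

  open IsRuzsaSzemerédi rs

  private
    -- In `split₁₂`, gains of at most `count Y / R` leave at most a fraction `d / R = 1 / 64` of the
    -- xy-edges. In `split₂₃`, at most `R` rectangles with at most `4 * count Y * count Z / Q` edges
    -- each contain at most a fraction `4 * R * d / Q = 1 / 64` of the yz-edges.
    R Q : ℕ
    R = c₆₄ * d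
    Q = 4 * c₆₄ * d * R

    0<R : 0 < R
    0<R = *-mono-< 0<c₆₄ 0<d

    0<4cd : 0 < 4 * c₆₄ * d
    0<4cd = *-mono-< (*-mono-< {0} {4} z<s 0<c₆₄) 0<d

    0<Q : 0 < Q
    0<Q = *-mono-< 0<4cd 0<R

    instance
      d≢0 : NonZero d
      d≢0 = >-nonZero 0<d

  dense-triple-splits : count X * count Y ≤ d * count (λ i → X (x i) ∧ Y (y i)) →
                   count Y * count Z ≤ d * count (λ i → Y (y i) ∧ Z (z i)) →
                   count X * count Z ≤ d * count (λ i → X (x i) ∧ Z (z i)) →
                   c₆₄ * d * Q ≤ count Z → 0 < count X → 0 < count Y →
                   Split x y X Y Q ⊎ Split y z Y Z Q ⊎ Split x z X Z Q
  dense-triple-splits dense₁₂ dense₂₃ dense₁₃ Z-big 0<|X| 0<|Y| = outcome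
    where
    0<|Z| : 0 < count Z
    0<|Z| = <-≤-trans (*-mono-< 0<R 0<Q) Z-big

    μ₁ : (Fin n × Fin n → Bool) → ℕ
    μ₁ p = sum λ u → sum λ w → 𝟙 ((X u ∧ Z w) ∧ p (u , w))

    R₁ : Fin n → Fin n × Fin n → Bool
    R₁ v (u , w) = A₁ u v ∧ A₂ v w

    μ₁-∨ : ∀ p q → μ₁ p + μ₁ (λ ω → q ω ∧ not (p ω)) ≤ μ₁ (λ ω → q ω ∨ p ω)
    μ₁-∨ p q = ≤-reflexive (trans
      (sym (∑∑-distrib-+ (λ u w → 𝟙 ((X u ∧ Z w) ∧ p (u , w))) (λ u w → 𝟙 ((X u ∧ Z w) ∧ (q (u , w) ∧ not (p (u , w)))))))
      (∑∑-cong λ u w → 𝟙-∨-∧ (X u ∧ Z w) (p (u , w)) (q (u , w))))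

    cover₁ = greedy-cover μ₁ {count X * count Z} {Q} (*-mono-< 0<|X| 0<|Z|)
      (λ p → ≤-trans (∑∑-mono λ u w → 𝟙-∧≤ (X u ∧ Z w) _) (≤-reflexive (∑∑-product X Z)))
      μ₁-∨ Y R₁

    L₁ : List (Fin n)
    L₁ = proj₁ cover₁

    U : Fin n → Fin n → Bool
    U u w = any (λ v → R₁ v (u , w)) L₁

    -- By `induced`, an xz-edge in the rectangle of `v` belongs to a triple with middle vertex `v`,
    -- and such a triple is determined by its `x`.
    U-edges : ∀ v → c₆₄ * count (λ i → (X (x i) ∧ Z (z i)) ∧ R₁ v (x i , z i)) ≤ c₆₄ * count X
    U-edges v = *-monoʳ-≤ c₆₄ (begin
      count (λ i → (X (x i) ∧ Z (z i)) ∧ R₁ v (x i , z i))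
        ≤⟨ ∑-mono (λ i → 𝟙-mono (at-v i)) ⟩
      count (λ i → X (x i) ∧ (v == y i))
        ≤⟨ ∑-injectivePair injective₁₂ (λ u v′ → 𝟙 (X u ∧ (v == v′))) ⟩
      sum (λ u → sum λ v′ → 𝟙 (X u ∧ (v == v′)))
        ≡⟨ ∑∑-product X (v ==_) ⟩
      count X * count (v ==_)
        ≡⟨ trans (cong (count X *_) (count-== v)) (*-identityʳ _) ⟩
      count X ∎)
      where
      open ≤-Reasoning
      at-v : ∀ i → (X (x i) ∧ Z (z i)) ∧ R₁ v (x i , z i) ≡ true → X (x i) ∧ (v == y i) ≡ true
      at-v i eq with ∧-true {X (x i) ∧ Z (z i)} eq
      ... | XZ , A with ∧-true {A₁ (x i) v} A
      ...   | a₁ , a₂ = cong₂ _∧_ (proj₁ (∧-true {X (x i)} XZ)) (≡⇒== (induced i v a₁ a₂))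

    -- The at most `Q` rectangles have at most `count X` edges each, which is few because `Z` is
    -- large: this is the origin of the threshold `c₆₄ * d * Q`.
    split₁₃ : count X * count Z ≤ 8 * μ₁ (uncurry U) → Split x z X Z Q
    split₁₃ U-large = record
      { S          = U
      ; rectangles = List.map (λ v → (λ u → A₁ u v) , A₂ v) L₁
      ; few        = ≤-trans (≤-reflexive (length-map _ L₁)) (proj₁ (proj₂ cover₁))
      ; S≡⋃        = λ u w → sym (any-map (λ ρ → rectangle ρ u w) _ L₁)
      ; large      = U-large
      ; sparse     = *-cancelˡ-≤ d (begin
          d * (c₆₄ * count (λ i → (X (x i) ∧ Z (z i)) ∧ U (x i) (z i)))
            ≤⟨ *-monoʳ-≤ d (union-bound c₆₄ (λ i → X (x i) ∧ Z (z i)) (λ v i → R₁ v (x i , z i)) L₁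
                 (All.universal U-edges L₁)) ⟩
          d * (length L₁ * (c₆₄ * count X))
            ≤⟨ *-monoʳ-≤ d (*-monoˡ-≤ (c₆₄ * count X) (proj₁ (proj₂ cover₁))) ⟩
          d * (Q * (c₆₄ * count X))
            ≡⟨ rearrange₃ c₆₄ d Q (count X) ⟩
          count X * (c₆₄ * d * Q)
            ≤⟨ *-monoʳ-≤ (count X) Z-big ⟩
          count X * count Z
            ≤⟨ dense₁₃ ⟩
          d * count (λ i → X (x i) ∧ Z (z i)) ∎)
      }
      where
      open ≤-Reasoning

    module _ (U-small : 8 * μ₁ (uncurry U) ≤ count X * count Z) where

      new : Fin n → Fin n → Fin n → Bool
      new u v w = R₁ v (u , w) ∧ not (U u w)

      paths covered : Fin n → ℕ
      paths u = sum λ v → sum λ w → 𝟙 ((Y v ∧ Z w) ∧ new u v w)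
      covered u = sum λ w → 𝟙 (Z w ∧ U u w)

      -- After exchanging the sums, each `v` in `Y` contributes its gain over `U`, which is at most
      -- `count X * count Z / Q` because the cover is greedy.
      paths-total : Q * sum (λ u → 𝟙 (X u) * paths u) ≤ count Y * (count X * count Z)
      paths-total = begin
        Q * sum (λ u → 𝟙 (X u) * paths u)
          ≡⟨ cong (Q *_) (sum-cong-≗ λ u → ∑∑-*ˡ (𝟙 (X u)) _) ⟩
        Q * sum (λ u → sum λ v → sum λ w → 𝟙 (X u) * 𝟙 ((Y v ∧ Z w) ∧ new u v w))
          ≡⟨ cong (Q *_) (∑-comm {n} {n} λ u v → sum λ w → 𝟙 (X u) * 𝟙 ((Y v ∧ Z w) ∧ new u v w)) ⟩
        Q * sum (λ v → sum λ u → sum λ w → 𝟙 (X u) * 𝟙 ((Y v ∧ Z w) ∧ new u v w))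
          ≡⟨ cong (Q *_) (sum-cong-≗ {n} λ v → ∑∑-cong λ u w → exchange (X u) (Y v) (Z w) (new u v w)) ⟩
        Q * sum (λ v → sum λ u → sum λ w → 𝟙 (Y v) * 𝟙 ((X u ∧ Z w) ∧ new u v w))
          ≡⟨ cong (Q *_) (sum-cong-≗ λ v → ∑∑-*ˡ (𝟙 (Y v)) (λ u w → 𝟙 ((X u ∧ Z w) ∧ new u v w))) ⟨
        Q * sum (λ v → 𝟙 (Y v) * μ₁ (λ ω → R₁ v ω ∧ not (uncurry U ω)))
          ≡⟨ *-distribˡ-sum Q (λ v → 𝟙 (Y v) * μ₁ (λ ω → R₁ v ω ∧ not (uncurry U ω))) ⟩
        sum (λ v → Q * (𝟙 (Y v) * μ₁ (λ ω → R₁ v ω ∧ not (uncurry U ω))))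
          ≡⟨ sum-cong-≗ (λ v → x∙yz≈y∙xz Q (𝟙 (Y v)) _) ⟩
        sum (λ v → 𝟙 (Y v) * (Q * μ₁ (λ ω → R₁ v ω ∧ not (uncurry U ω))))
          ≤⟨ ∑-mono (λ v → 𝟙*-mono (Y v) (proj₂ (proj₂ (proj₂ cover₁)) v)) ⟩
        sum (λ v → 𝟙 (Y v) * (count X * count Z))
          ≡⟨ *-distribʳ-sum (count X * count Z) (𝟙 ∘ Y) ⟨
        count Y * (count X * count Z) ∎
        where
        open ≤-Reasoning
        exchange : ∀ p q r s → 𝟙 p * 𝟙 ((q ∧ r) ∧ s) ≡ 𝟙 q * 𝟙 ((p ∧ r) ∧ s)
        exchange false false r s = refl
        exchange false true  r s = refl
        exchange true  false r s = refl
        exchange true  true  r s = refl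

      covered-total : sum (λ u → 𝟙 (X u) * covered u) ≡ μ₁ (uncurry U)
      covered-total = sum-cong-≗ λ u → trans (*-distribˡ-sum (𝟙 (X u)) (λ w → 𝟙 (Z w ∧ U u w)))
        (sum-cong-≗ λ w → trans (sym (𝟙-∧ (X u) (Z w ∧ U u w))) (cong 𝟙 (sym (∧-assoc (X u) (Z w) (U u w)))))

      G : Fin n → Bool
      G u = X u ∧ ((2 * covered u ≤ᵇ count Z) ∧ (Q * paths u ≤ᵇ 4 * (count Y * count Z)))

      -- Each of the two conditions in `G` fails for at most a quarter of `X`, by `markov`: on
      -- average over `X`, `2 * covered u` is at most `count Z / 4` since `U` is small, and
      -- `Q * paths u` is at most `count Y * count Z` by `paths-total`.
      |X|≤2|G| : count X ≤ 2 * count G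
      |X|≤2|G| = *-cancelˡ-≤ 2 (+-cancelʳ-≤ (2 * count X) _ _ (begin
        2 * count X + 2 * count X
          ≡⟨ *-distribʳ-+ (count X) 2 2 ⟨
        4 * count X
          ≤⟨ *-monoʳ-≤ 4 (≤-trans (∑-mono trichotomy)
               (≤-reflexive (trans (∑-distrib-+ (𝟙 ∘ G) (λ u → 𝟙 (bad₁ u) + 𝟙 (bad₂ u)))
                                   (cong (count G +_) (∑-distrib-+ (𝟙 ∘ bad₁) (𝟙 ∘ bad₂)))))) ⟩
        4 * (count G + (count bad₁ + count bad₂))
          ≡⟨ distribute (count G) (count bad₁) (count bad₂) ⟩
        2 * (2 * count G) + (4 * count bad₁ + 4 * count bad₂)
          ≤⟨ +-monoʳ-≤ (2 * (2 * count G)) (+-mono-≤ markov₁ markov₂) ⟩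
        2 * (2 * count G) + (count X + count X)
          ≡⟨ cong (λ t → 2 * (2 * count G) + (count X + t)) (+-identityʳ _) ⟨
        2 * (2 * count G) + 2 * count X ∎))
        where
        open ≤-Reasoning
        bad₁ bad₂ : Fin n → Bool
        bad₁ u = X u ∧ not (2 * covered u ≤ᵇ count Z)
        bad₂ u = X u ∧ not (Q * paths u ≤ᵇ 4 * (count Y * count Z))
        trichotomy : ∀ u → 𝟙 (X u) ≤ 𝟙 (G u) + (𝟙 (bad₁ u) + 𝟙 (bad₂ u))
        trichotomy u with X u | 2 * covered u ≤ᵇ count Z | Q * paths u ≤ᵇ 4 * (count Y * count Z)
        ... | false | _     | _     = z≤n
        ... | true  | true  | true  = s≤s z≤n
        ... | true  | true  | false = s≤s z≤n
        ... | true  | false | _     = s≤s z≤n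
        *-swap-sum : ∀ c (f : Fin n → ℕ) → sum (λ u → 𝟙 (X u) * (c * f u)) ≡ c * sum (λ u → 𝟙 (X u) * f u)
        *-swap-sum c f = trans (sum-cong-≗ λ u → x∙yz≈y∙xz (𝟙 (X u)) c (f u)) (sym (*-distribˡ-sum c _))
        markov₁ : 4 * count bad₁ ≤ count X
        markov₁ = markov X (λ u → 2 * covered u) (count Z) 0<|Z| (begin
          4 * sum (λ u → 𝟙 (X u) * (2 * covered u))
            ≡⟨ cong (4 *_) (*-swap-sum 2 covered) ⟩
          4 * (2 * sum (λ u → 𝟙 (X u) * covered u))
            ≡⟨ trans (sym (*-assoc 4 2 (sum λ u → 𝟙 (X u) * covered u))) (cong (8 *_) covered-total) ⟩
          8 * μ₁ (uncurry U)
            ≤⟨ U-small ⟩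
          count X * count Z ∎)
        markov₂ : 4 * count bad₂ ≤ count X
        markov₂ = markov X (λ u → Q * paths u) (4 * (count Y * count Z))
          (*-mono-< {0} {4} z<s (*-mono-< 0<|Y| 0<|Z|)) (begin
          4 * sum (λ u → 𝟙 (X u) * (Q * paths u))
            ≡⟨ cong (4 *_) (*-swap-sum Q paths) ⟩
          4 * (Q * sum (λ u → 𝟙 (X u) * paths u))
            ≤⟨ *-monoʳ-≤ 4 paths-total ⟩
          4 * (count Y * (count X * count Z))
            ≡⟨ rearrange₅ (count X) (count Y) (count Z) ⟩
          count X * (4 * (count Y * count Z)) ∎)

      μ₂ : (Fin n → Bool) → ℕ
      μ₂ q = count λ v → Y v ∧ q v

      cover₂ = greedy-cover μ₂ {count Y} {R} 0<|Y| (λ p → ∑-mono λ v → 𝟙-∧≤ (Y v) _)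
        (λ p q → ≤-reflexive (trans (sym (∑-distrib-+ (λ v → 𝟙 (Y v ∧ p v)) (λ v → 𝟙 (Y v ∧ (q v ∧ not (p v))))))
                                    (sum-cong-≗ λ v → 𝟙-∨-∧ (Y v) (p v) (q v))))
        G A₁

      L₂ : List (Fin n)
      L₂ = proj₁ cover₂

      V : Fin n → Bool
      V v = any (λ u → A₁ u v) L₂

      -- By the choice of `L₂`, a vertex of `G` has at most `count Y / R` neighbours in `Y` outside
      -- `V`, so the single rectangle of `G` and the complement of `V` is sparse. It is large since
      -- it takes up at least half of `X` and half of `Y`.
      split₁₂ : count Y ≤ 2 * μ₂ (not ∘ V) → Split x y X Y Q
      split₁₂ rest-large = record
        { S          = λ u v → G u ∧ not (V v)
        ; rectangles = (G , not ∘ V) ∷ []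
        ; few        = 0<Q
        ; S≡⋃        = λ u v → sym (∨-identityʳ _)
        ; large      = begin
            count X * count Y
              ≤⟨ *-mono-≤ |X|≤2|G| rest-large ⟩
            2 * count G * (2 * μ₂ (not ∘ V))
              ≡⟨ rearrange₄ (count G) (μ₂ (not ∘ V)) ⟩
            4 * (count G * μ₂ (not ∘ V))
              ≤⟨ *-monoˡ-≤ (count G * μ₂ (not ∘ V)) {4} {8} (s≤s (s≤s (s≤s (s≤s z≤n)))) ⟩
            8 * (count G * μ₂ (not ∘ V))
              ≡⟨ cong (8 *_) (∑∑-product G (λ v → Y v ∧ not (V v))) ⟨
            8 * sum (λ u → sum λ v → 𝟙 (G u ∧ (Y v ∧ not (V v))))
              ≤⟨ *-monoʳ-≤ 8 (∑∑-mono λ u v → 𝟙-mono (expand (X u) _ (Y v) (not (V v)))) ⟩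
            8 * sum (λ u → sum λ v → 𝟙 ((X u ∧ Y v) ∧ (G u ∧ not (V v)))) ∎
        ; sparse     = *-cancelˡ-≤ d (begin
            d * (c₆₄ * count (λ i → (X (x i) ∧ Y (y i)) ∧ (G (x i) ∧ not (V (y i)))))
              ≡⟨ trans (sym (*-assoc d c₆₄ _)) (cong (_* count (λ i → (X (x i) ∧ Y (y i)) ∧ (G (x i) ∧ not (V (y i))))) (*-comm d c₆₄)) ⟩
            R * count (λ i → (X (x i) ∧ Y (y i)) ∧ (G (x i) ∧ not (V (y i))))
              ≤⟨ *-monoʳ-≤ R (∑-mono λ i → 𝟙-mono (contract (X (x i)) (Y (y i)) (G (x i)) (not (V (y i))) (edge₁₂ i))) ⟩
            R * sum (λ i → 𝟙 (G (x i) ∧ (Y (y i) ∧ (A₁ (x i) (y i) ∧ not (V (y i))))))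
              ≤⟨ *-monoʳ-≤ R (∑-injectivePair injective₁₂ (λ u v → 𝟙 (G u ∧ (Y v ∧ (A₁ u v ∧ not (V v)))))) ⟩
            R * sum (λ u → sum λ v → 𝟙 (G u ∧ (Y v ∧ (A₁ u v ∧ not (V v)))))
              ≡⟨ cong (R *_) (sum-cong-≗ λ u → trans (sum-cong-≗ λ v → 𝟙-∧ (G u) _) (sym (*-distribˡ-sum (𝟙 (G u)) (λ v → 𝟙 (Y v ∧ (A₁ u v ∧ not (V v))))))) ⟩
            R * sum (λ u → 𝟙 (G u) * μ₂ (λ v → A₁ u v ∧ not (V v)))
              ≡⟨ trans (*-distribˡ-sum R (λ u → 𝟙 (G u) * μ₂ (λ v → A₁ u v ∧ not (V v)))) (sum-cong-≗ λ u → x∙yz≈y∙xz R (𝟙 (G u)) _) ⟩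
            sum (λ u → 𝟙 (G u) * (R * μ₂ (λ v → A₁ u v ∧ not (V v))))
              ≤⟨ ∑-mono (λ u → 𝟙*-mono (G u) (proj₂ (proj₂ (proj₂ cover₂)) u)) ⟩
            sum (λ u → 𝟙 (G u) * count Y)
              ≡⟨ *-distribʳ-sum (count Y) (𝟙 ∘ G) ⟨
            count G * count Y
              ≤⟨ *-monoˡ-≤ (count Y) (∑-mono λ u → 𝟙-∧≤ (X u) _) ⟩
            count X * count Y
              ≤⟨ dense₁₂ ⟩
            d * count (λ i → X (x i) ∧ Y (y i)) ∎)
        }
        where
        open ≤-Reasoning
        expand : ∀ p g q r → (p ∧ g) ∧ (q ∧ r) ≡ true → (p ∧ q) ∧ ((p ∧ g) ∧ r) ≡ true
        expand true true true true _ = refl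
        contract : ∀ p q g r {a} → a ≡ true → (p ∧ q) ∧ (g ∧ r) ≡ true → g ∧ (q ∧ (a ∧ r)) ≡ true
        contract true true true true refl _ = refl

      -- A yz-edge `(v , w)` in the rectangle of `u` gives a path from `u` over `v` to `w` with
      -- `(u , w)` outside `U`, and a vertex of `G` has few such paths. The area is large because
      -- every `v` in `V` has a neighbour `u` in `L₂`, for which `U` leaves at least half of `Z`
      -- uncovered.
      split₂₃ : count Y ≤ 2 * μ₂ V → Split y z Y Z Q
      split₂₃ V-large = record
        { S          = S
        ; rectangles = List.map (λ u → A₁ u , (λ w → not (U u w))) L₂
        ; few        = begin
            length (List.map (λ u → A₁ u , (λ w → not (U u w))) L₂) ≡⟨ length-map _ L₂ ⟩
            length L₂                                   ≤⟨ proj₁ (proj₂ cover₂) ⟩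
            R                                           ≤⟨ m≤n*m R (4 * c₆₄ * d) {{>-nonZero (0<4cd)}} ⟩
            Q                                           ∎
        ; S≡⋃        = λ v w → sym (any-map (λ ρ → rectangle ρ v w) _ L₂)
        ; large      = begin
            count Y * count Z
              ≤⟨ *-monoˡ-≤ (count Z) V-large ⟩
            2 * μ₂ V * count Z
              ≡⟨ trans (*-assoc 2 (μ₂ V) _) (cong (2 *_) (*-distribʳ-sum (count Z) (λ v → 𝟙 (Y v ∧ V v)))) ⟩
            2 * sum (λ v → 𝟙 (Y v ∧ V v) * count Z)
              ≤⟨ *-monoʳ-≤ 2 (∑-mono fibre) ⟩
            2 * sum (λ v → 2 * sum (λ w → 𝟙 ((Y v ∧ Z w) ∧ S v w)))
              ≡⟨ cong (2 *_) (*-distribˡ-sum 2 (λ v → sum (λ w → 𝟙 ((Y v ∧ Z w) ∧ S v w)))) ⟨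
            2 * (2 * sum (λ v → sum (λ w → 𝟙 ((Y v ∧ Z w) ∧ S v w))))
              ≡⟨ *-assoc 2 2 (sum (λ v → sum (λ w → 𝟙 ((Y v ∧ Z w) ∧ S v w)))) ⟨
            4 * sum (λ v → sum (λ w → 𝟙 ((Y v ∧ Z w) ∧ S v w)))
              ≤⟨ *-monoˡ-≤ (sum (λ v → sum (λ w → 𝟙 ((Y v ∧ Z w) ∧ S v w)))) {4} {8} (s≤s (s≤s (s≤s (s≤s z≤n)))) ⟩
            8 * sum (λ v → sum (λ w → 𝟙 ((Y v ∧ Z w) ∧ S v w))) ∎
        ; sparse     = *-cancelˡ-≤ (4 * d * R) {{>-nonZero (*-mono-< (*-mono-< {0} {4} z<s 0<d) 0<R)}} (begin
            4 * d * R * (c₆₄ * count (λ i → (Y (y i) ∧ Z (z i)) ∧ S (y i) (z i)))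
              ≡⟨ rearrange₁ c₆₄ d R _ ⟩
            Q * count (λ i → (Y (y i) ∧ Z (z i)) ∧ S (y i) (z i))
              ≤⟨ union-bound Q (λ i → Y (y i) ∧ Z (z i)) (λ u i → A₁ u (y i) ∧ not (U u (z i))) L₂
                   (All.map (λ {u} → few-paths u) (proj₁ (proj₂ (proj₂ cover₂)))) ⟩
            length L₂ * (4 * (count Y * count Z))
              ≤⟨ *-mono-≤ (proj₁ (proj₂ cover₂)) (*-monoʳ-≤ 4 dense₂₃) ⟩
            R * (4 * (d * count (λ i → Y (y i) ∧ Z (z i))))
              ≡⟨ rearrange₂ d R _ ⟩
            4 * d * R * count (λ i → Y (y i) ∧ Z (z i)) ∎)
        }
        where
        open ≤-Reasoning
        S : Fin n → Fin n → Bool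
        S v w = any (λ u → A₁ u v ∧ not (U u w)) L₂
        good : ∀ {u} → G u ≡ true → 2 * covered u ≤ count Z × Q * paths u ≤ 4 * (count Y * count Z)
        good {u} Gu = Product.map ≤ᵇ-true ≤ᵇ-true (∧-true {2 * covered u ≤ᵇ count Z} (proj₂ (∧-true {X u} Gu)))
        few-paths : ∀ u → G u ≡ true →
                    Q * count (λ i → (Y (y i) ∧ Z (z i)) ∧ (A₁ u (y i) ∧ not (U u (z i)))) ≤ 4 * (count Y * count Z)
        few-paths u Gu = begin
          Q * count (λ i → (Y (y i) ∧ Z (z i)) ∧ (A₁ u (y i) ∧ not (U u (z i))))
            ≡⟨ cong (Q *_) (sum-cong-≗ λ i → cong (λ a → 𝟙 ((Y (y i) ∧ Z (z i)) ∧ (a ∧ not (U u (z i)))))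
                 (trans (sym (∧-identity (A₁ u (y i)))) (cong (A₁ u (y i) ∧_) (sym (edge₂₃ i))))) ⟩
          Q * sum (λ i → 𝟙 ((Y (y i) ∧ Z (z i)) ∧ new u (y i) (z i)))
            ≤⟨ *-monoʳ-≤ Q (∑-injectivePair injective₂₃ (λ v w → 𝟙 ((Y v ∧ Z w) ∧ new u v w))) ⟩
          Q * paths u
            ≤⟨ proj₂ (good {u} Gu) ⟩
          4 * (count Y * count Z) ∎
          where
          ∧-identity : ∀ p → p ∧ true ≡ p
          ∧-identity false = refl
          ∧-identity true  = refl
        fibre′ : ∀ {v} → (∃ λ u → G u ≡ true × A₁ u v ≡ true × (∀ g → g u ≡ true → any g L₂ ≡ true)) →
                 count Z ≤ 2 * sum (λ w → 𝟙 (Z w ∧ S v w))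
        fibre′ {v} (u , Gu , A₁uv , ∈L₂) = begin
          count Z
            ≤⟨ +-cancelˡ-≤ (count Z) _ _ (begin
                 count Z + count Z
                   ≡⟨ cong (count Z +_) (+-identityʳ _) ⟨
                 2 * count Z
                   ≡⟨ cong (2 *_) (trans (sum-cong-≗ λ w → sym (complement (Z w) (U u w)))
                                         (∑-distrib-+ (λ w → 𝟙 (Z w ∧ U u w)) (λ w → 𝟙 (Z w ∧ not (U u w))))) ⟩
                 2 * (covered u + count (λ w → Z w ∧ not (U u w)))
                   ≡⟨ *-distribˡ-+ 2 (covered u) _ ⟩
                 2 * covered u + 2 * count (λ w → Z w ∧ not (U u w))
                   ≤⟨ +-monoˡ-≤ _ (proj₁ (good {u} Gu)) ⟩
                 count Z + 2 * count (λ w → Z w ∧ not (U u w)) ∎) ⟩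
          2 * count (λ w → Z w ∧ not (U u w))
            ≤⟨ *-monoʳ-≤ 2 (∑-mono λ w → 𝟙-mono (inside w)) ⟩
          2 * sum (λ w → 𝟙 (Z w ∧ S v w)) ∎
          where
          inside : ∀ w → Z w ∧ not (U u w) ≡ true → Z w ∧ S v w ≡ true
          inside w eq = cong₂ _∧_ (proj₁ (∧-true {Z w} eq))
            (∈L₂ (λ u → A₁ u v ∧ not (U u w)) (cong₂ _∧_ A₁uv (proj₂ (∧-true {Z w} eq))))
        fibre : ∀ v → 𝟙 (Y v ∧ V v) * count Z ≤ 2 * sum (λ w → 𝟙 ((Y v ∧ Z w) ∧ S v w))
        fibre v = masked (Y v) (V v) λ Vv → fibre′ (any-true (λ u → A₁ u v) L₂ (proj₁ (proj₂ (proj₂ cover₂))) Vv)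
          where
          masked : ∀ p q {a} {f g : Fin n → Bool} → (q ≡ true → a ≤ 2 * sum (λ w → 𝟙 (f w ∧ g w))) →
                   𝟙 (p ∧ q) * a ≤ 2 * sum (λ w → 𝟙 ((p ∧ f w) ∧ g w))
          masked false q     _ = z≤n
          masked true  false _ = z≤n
          masked true  true  h = ≤-trans (≤-reflexive (*-identityˡ _)) (h refl)

      outcome₂ : Split x y X Y Q ⊎ Split y z Y Z Q
      outcome₂ = [ inj₁ ∘ split₁₂ , inj₂ ∘ split₂₃ ∘ V-large ]′ (≤-total (count Y) (2 * μ₂ (not ∘ V)))
        where
        open ≤-Reasoning
        V-large : 2 * μ₂ (not ∘ V) ≤ count Y → count Y ≤ 2 * μ₂ V
        V-large rest-small = +-cancelʳ-≤ (count Y) _ _ (begin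
          count Y + count Y
            ≡⟨ cong (count Y +_) (+-identityʳ _) ⟨
          2 * count Y
            ≡⟨ cong (2 *_) (trans (sum-cong-≗ λ v → sym (complement (Y v) (V v)))
                                (∑-distrib-+ (λ v → 𝟙 (Y v ∧ V v)) (λ v → 𝟙 (Y v ∧ not (V v))))) ⟩
          2 * (μ₂ V + μ₂ (not ∘ V))
            ≡⟨ *-distribˡ-+ 2 (μ₂ V) (μ₂ (not ∘ V)) ⟩
          2 * μ₂ V + 2 * μ₂ (not ∘ V)
            ≤⟨ +-monoʳ-≤ (2 * μ₂ V) rest-small ⟩
          2 * μ₂ V + count Y ∎)

    outcome : Split x y X Y Q ⊎ Split y z Y Z Q ⊎ Split x z X Z Q
    outcome = [ inj₂ ∘ inj₂ ∘ split₁₃ , map₂ inj₁ ∘ outcome₂ ]′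
                (≤-total (count X * count Z) (8 * μ₁ (uncurry U)))

-- Labels and their cost

-- 2 ^ (- j), scaled by 2 ^ H; only labels j ≤ H are meaningful.
weight : ℕ → ℕ → ℕ
weight H j = 2 ^ (H ∸ j)

-- Only an inequality, as truncation makes 0 its own predecessor and gives all labels from `H` on
-- the same weight.
weight-pred : ∀ H j → weight H (pred j) ≤ 2 * weight H j
weight-pred H zero    = m≤m+n (weight H 0) _
weight-pred H (suc j) = ^-monoʳ-≤ 2 {H ∸ j} {suc (H ∸ suc j)}
  (≤-trans (m≤n+m∸n (H ∸ j) 1) (s≤s (≤-reflexive (trans (∸-+-assoc H j 1) (cong (H ∸_) (+-comm j 1))))))

weight-suc : ∀ H j → 2 ≤ weight H j → weight H j ≡ 2 * weight H (suc j)
weight-suc H j 2≤w with j <? H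
... | yes j<H = cong (2 ^_) (+-∸-assoc 1 j<H)
... | no  j≮H = contradiction (subst (λ t → 2 ≤ 2 ^ t) (m≤n⇒m∸n≡0 (≮⇒≥ j≮H)) 2≤w) (<⇒≱ ≤-refl)

cost : (l r : Fin m → Fin n) (H : ℕ) → (Fin n → Fin n → ℕ) → ℕ
cost l r H f = 2 ^ H * sum (λ i → f (l i) (r i)) + sum (λ u → sum λ v → weight H (f u v))

cost-cong : (l r : Fin m → Fin n) (H : ℕ) {f g : Fin n → Fin n → ℕ} → (∀ u v → f u v ≡ g u v) →
            cost l r H f ≡ cost l r H g
cost-cong l r H f≡g = cong₂ _+_ (cong (2 ^ H *_) (sum-cong-≗ λ i → f≡g (l i) (r i)))
                                (∑∑-cong λ u v → cong (weight H) (f≡g u v))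

Agree : (u v : Fin n) → List (Fin n → Bool) → Set
Agree u v = All (λ p → p u ≡ p v)

module _ {m n M} (l r : Fin m → Fin n) (χ : Fin n → Fin M) (H d K : ℕ) where

  cell : Fin M → Fin M → Fin n → Fin n → Bool
  cell a b u v = (χ u == a) ∧ (χ v == b)

  edges area : Fin M → Fin M → ℕ
  edges a b = count (λ i → cell a b (l i) (r i))
  area a b  = count (λ u → χ u == a) * count (λ u → χ u == b)

  cellCost : Fin M → Fin M → (Fin n → Fin n → ℕ) → ℕ
  cellCost a b f = 2 ^ H * sum (λ i → 𝟙 (cell a b (l i) (r i)) * f (l i) (r i)) +
                   sum (λ u → sum λ v → 𝟙 (cell a b u v) * weight H (f u v))

  -- `over` marks a cell with density above `2 * 2 ^ (- j)`, whose label will be lowered; `split`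
  -- marks one whose label will be raised on the set of its `Split`. The inequalities carried along
  -- are those by which `cell-gain` shows that the change lowers the cost.
  data Flag (a b : Fin M) (j : ℕ) : Set where
    none  : Flag a b j
    over  : 2 * (area a b * weight H j) < edges a b * 2 ^ H → Flag a b j
    split : edges a b * 2 ^ H ≤ 2 * (area a b * weight H j) → area a b ≤ d * edges a b →
            0 < edges a b → Split l r (λ u → χ u == a) (λ u → χ u == b) K → Flag a b j

  flagged : ∀ {a b j} → Flag a b j → Bool
  flagged none            = false
  flagged (over _)        = true
  flagged (split _ _ _ _) = true

  relabel : ∀ {a b} j → Flag a b j → Fin n → Fin n → ℕ
  relabel j none            u v = j
  relabel j (over _)        u v = pred j
  relabel j (split _ _ _ s) u v = j + 𝟙 (Split.S s u v)

  predicates : ∀ {a b j} → Flag a b j → List (Fin n → Bool)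
  predicates none            = []
  predicates (over _)        = []
  predicates (split _ _ _ s) = concatMap (λ (α , β) → α ∷ β ∷ []) (Split.rectangles s)

  private
    length-pairs : (L : List ((Fin n → Bool) × (Fin n → Bool))) →
                   length (concatMap (λ (α , β) → α ∷ β ∷ []) L) ≡ 2 * length L
    length-pairs []      = refl
    length-pairs (_ ∷ L) = trans (cong (2 +_) (length-pairs L)) (sym (*-suc 2 (length L)))

    any-agree : (L : List ((Fin n → Bool) × (Fin n → Bool))) {u u′ v v′ : Fin n} →
                Agree u u′ (concatMap (λ (α , β) → α ∷ β ∷ []) L) →
                Agree v v′ (concatMap (λ (α , β) → α ∷ β ∷ []) L) →
                any (λ ρ → rectangle ρ u v) L ≡ any (λ ρ → rectangle ρ u′ v′) L
    any-agree []      _             _             = refl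
    any-agree (_ ∷ L) (αu ∷ _ ∷ us) (_ ∷ βv ∷ vs) = cong₂ _∨_ (cong₂ _∧_ αu βv) (any-agree L us vs)

  length-predicates : ∀ {a b j} (f : Flag a b j) → length (predicates f) ≤ 2 * K
  length-predicates none            = z≤n
  length-predicates (over _)        = z≤n
  length-predicates (split _ _ _ s) =
    ≤-trans (≤-reflexive (length-pairs (Split.rectangles s))) (*-monoʳ-≤ 2 (Split.few s))

  relabel-agree : ∀ {a b j} (f : Flag a b j) {u u′ v v′} → Agree u u′ (predicates f) →
                  Agree v v′ (predicates f) → relabel j f u v ≡ relabel j f u′ v′
  relabel-agree         none            _  _  = refl
  relabel-agree         (over _)        _  _  = refl
  relabel-agree {j = j} (split _ _ _ s) {u} {u′} {v} {v′} us vs = cong (λ p → j + 𝟙 p) (begin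
    Split.S s u v                                            ≡⟨ Split.S≡⋃ s u v ⟩
    any (λ ρ → rectangle ρ u v) (Split.rectangles s)         ≡⟨ any-agree (Split.rectangles s) us vs ⟩
    any (λ ρ → rectangle ρ u′ v′) (Split.rectangles s)       ≡⟨ Split.S≡⋃ s u′ v′ ⟨
    Split.S s u′ v′                                          ∎)
    where open ≡-Reasoning

  cellCost-const : ∀ a b j → cellCost a b (λ _ _ → j) ≡ 2 ^ H * (edges a b * j) + area a b * weight H j
  cellCost-const a b j = cong₂ _+_ (cong (2 ^ H *_) (sym (*-distribʳ-sum j _)))
    (trans (sum-cong-≗ λ u → sym (*-distribʳ-sum (weight H j) (λ v → 𝟙 (cell a b u v))))
    (trans (sym (*-distribʳ-sum (weight H j) (λ u → sum λ v → 𝟙 (cell a b u v))))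
           (cong (_* weight H j) (∑∑-product (λ u → χ u == a) (λ v → χ v == b)))))

private
  over-rearrange₁ : ∀ c h e j a w → c * (h * (e * j) + a * (2 * w)) + h * (e * 1) ≡
                    c * (h * (e * j) + a * w) + (c * (a * w) + h * e)
  over-rearrange₁ = solve-∀

  over-rearrange₂ : ∀ c h e j a w → c * (h * (e * j) + a * w) + c * (h * e) ≡
                    c * (h * (e * suc j) + a * w)
  over-rearrange₂ = solve-∀

  over-rearrange₃ : ∀ c h e a w → 2 * (c * (a * w) + h * e) ≡ c * (2 * (a * w)) + 2 * (h * e)
  over-rearrange₃ = solve-∀

  over-rearrange₄ : ∀ c h e → c * (e * h) + c * (h * e) ≡ 2 * (c * (h * e))
  over-rearrange₄ = solve-∀

  -- Lowering the label saves `h * e` on the edges, while the weight of the area grows by at most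
  -- `a * w < h * e / 2`. The net saving of `h * e / 2` is scaled by `c ≥ 2`.
  over-arith : ∀ c h e j a w w′ → 2 ≤ c → 2 * (a * w) < e * h → w′ ≤ 2 * w →
               c * (h * (e * j) + a * w′) + h * (e * 1) ≤ c * (h * (e * suc j) + a * w)
  over-arith c h e j a w w′ 2≤c 2aw<eh w′≤2w = begin
    c * (h * (e * j) + a * w′) + h * (e * 1)
      ≤⟨ +-monoˡ-≤ (h * (e * 1)) (*-monoʳ-≤ c (+-monoʳ-≤ (h * (e * j)) (*-monoʳ-≤ a w′≤2w))) ⟩
    c * (h * (e * j) + a * (2 * w)) + h * (e * 1)
      ≡⟨ over-rearrange₁ c h e j a w ⟩
    c * (h * (e * j) + a * w) + (c * (a * w) + h * e)
      ≤⟨ +-monoʳ-≤ (c * (h * (e * j) + a * w)) (*-cancelˡ-≤ 2 (begin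
           2 * (c * (a * w) + h * e)           ≡⟨ over-rearrange₃ c h e a w ⟩
           c * (2 * (a * w)) + 2 * (h * e)     ≤⟨ +-mono-≤ (*-monoʳ-≤ c (<⇒≤ 2aw<eh)) (*-monoˡ-≤ (h * e) 2≤c) ⟩
           c * (e * h) + c * (h * e)           ≡⟨ over-rearrange₄ c h e ⟩
           2 * (c * (h * e))                   ∎)) ⟩
    c * (h * (e * j) + a * w) + c * (h * e)
      ≡⟨ over-rearrange₂ c h e j a w ⟩
    c * (h * (e * suc j) + a * w) ∎
    where open ≤-Reasoning

  split-rearrange₁ : ∀ c h e j eₛ N → c * (h * (e * j + eₛ) + N) + h * (e * 1) ≡
                     c * (h * (e * j) + N) + (h * (c * eₛ) + h * e)
  split-rearrange₁ = solve-∀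

  split-rearrange₂ : ∀ h e → h * e + h * e ≡ 2 * (e * h)
  split-rearrange₂ = solve-∀

  split-rearrange₃ : ∀ s w → 2 * (2 * (8 * s * (2 * w))) ≡ 64 * (s * w)
  split-rearrange₃ = solve-∀

  split-rearrange₄ : ∀ c x N y → c * (x + N) + c * y ≡ c * (x + (N + y))
  split-rearrange₄ = solve-∀

  -- The edges in `S` cost `h * eₛ ≤ h * e / 64`. The area of `S` saves
  -- `s * w′ ≥ (a / 8) * (w / 2) ≥ h * e / 32`, where the last step holds since the density is at
  -- most twice what the label says. The difference is at least `h * e / 64`, which explains the
  -- factor `c₆₄`.
  split-arith : ∀ h e a w w′ N s eₛ j → c₆₄ * eₛ ≤ e → a ≤ 8 * s → e * h ≤ 2 * (a * w) → w ≡ 2 * w′ →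
                N + s * w′ ≡ a * w →
                c₆₄ * (h * (e * j + eₛ) + N) + h * (e * 1) ≤ c₆₄ * (h * (e * j) + a * w)
  split-arith h e a w w′ N s eₛ j sparse large dense w≡2w′ N+sw′≡aw = begin
    c₆₄ * (h * (e * j + eₛ) + N) + h * (e * 1)
      ≡⟨ split-rearrange₁ c₆₄ h e j eₛ N ⟩
    c₆₄ * (h * (e * j) + N) + (h * (c₆₄ * eₛ) + h * e)
      ≤⟨ +-monoʳ-≤ (c₆₄ * (h * (e * j) + N)) (begin
           h * (c₆₄ * eₛ) + h * e          ≤⟨ +-monoˡ-≤ (h * e) (*-monoʳ-≤ h sparse) ⟩
           h * e + h * e                   ≡⟨ split-rearrange₂ h e ⟩
           2 * (e * h)                     ≤⟨ *-monoʳ-≤ 2 dense ⟩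
           2 * (2 * (a * w))               ≡⟨ cong (λ t → 2 * (2 * (a * t))) w≡2w′ ⟩
           2 * (2 * (a * (2 * w′)))        ≤⟨ *-monoʳ-≤ 2 (*-monoʳ-≤ 2 (*-monoˡ-≤ (2 * w′) large)) ⟩
           2 * (2 * (8 * s * (2 * w′)))    ≡⟨ split-rearrange₃ s w′ ⟩
           64 * (s * w′)                   ≡⟨ cong (_* (s * w′)) {c₆₄} {64} c₆₄≡64 ⟨
           c₆₄ * (s * w′)                  ∎) ⟩
    c₆₄ * (h * (e * j) + N) + c₆₄ * (s * w′)
      ≡⟨ split-rearrange₄ c₆₄ (h * (e * j)) N (s * w′) ⟩
    c₆₄ * (h * (e * j) + (N + s * w′))
      ≡⟨ cong (λ t → c₆₄ * (h * (e * j) + t)) N+sw′≡aw ⟩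
    c₆₄ * (h * (e * j) + a * w) ∎
    where open ≤-Reasoning

module _ {m n M} {l r : Fin m → Fin n} (injective : InjectivePair l r) (χ : Fin n → Fin M)
         {H d K : ℕ} (2^H≡4d : 2 ^ H ≡ 4 * d) where

  private
    cell′  = cell l r χ H d K
    edges′ = edges l r χ H d K
    area′  = area l r χ H d K
    cost′  = cost l r H
    cellCost′ = cellCost l r χ H d K
    flagged′ : ∀ {a b j} → Flag l r χ H d K a b j → Bool
    flagged′ = flagged l r χ H d K
    relabel′ : ∀ {a b} j → Flag l r χ H d K a b j → Fin n → Fin n → ℕ
    relabel′ = relabel l r χ H d K

  edges≤area : ∀ a b → edges′ a b ≤ area′ a b
  edges≤area a b = ≤-trans (∑-injectivePair injective (λ u v → 𝟙 (cell′ a b u v)))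
                           (≤-reflexive (∑∑-product (λ u → χ u == a) (λ v → χ v == b)))

  cell-gain : ∀ a b j (f : Flag l r χ H d K a b j) →
              c₆₄ * cellCost′ a b (relabel′ j f) + 2 ^ H * (edges′ a b * 𝟙 (flagged′ f)) ≤
              c₆₄ * cellCost′ a b (λ _ _ → j)
  cell-gain a b j none = ≤-reflexive (trans (cong (c₆₄ * cellCost′ a b (λ _ _ → j) +_)
    (trans (cong (2 ^ H *_) (*-zeroʳ (edges′ a b))) (*-zeroʳ (2 ^ H)))) (+-identityʳ _))
  -- Label 0 has weight `2 ^ H`, and a cell has at most as many edges as pairs of vertices, so no
  -- cell is too dense for label 0.
  cell-gain a b zero (over 2aw<eh) = contradiction
    (≤-trans (*-monoˡ-≤ (2 ^ H) (edges≤area a b)) (m≤m+n _ _)) (<⇒≱ 2aw<eh)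
  cell-gain a b (suc j) (over 2aw<eh) = begin
    c₆₄ * cellCost′ a b (λ _ _ → j) + 2 ^ H * (edges′ a b * 1)
      ≡⟨ cong (λ t → c₆₄ * t + 2 ^ H * (edges′ a b * 1)) (cellCost-const l r χ H d K a b j) ⟩
    c₆₄ * (2 ^ H * (edges′ a b * j) + area′ a b * weight H j) + 2 ^ H * (edges′ a b * 1)
      ≤⟨ over-arith c₆₄ (2 ^ H) (edges′ a b) j (area′ a b) (weight H (suc j)) (weight H j)
           (≤-trans (s≤s (s≤s z≤n)) (≤-reflexive (sym c₆₄≡64))) 2aw<eh (weight-pred H (suc j)) ⟩
    c₆₄ * (2 ^ H * (edges′ a b * suc j) + area′ a b * weight H (suc j))
      ≡⟨ cong (c₆₄ *_) (cellCost-const l r χ H d K a b (suc j)) ⟨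
    c₆₄ * cellCost′ a b (λ _ _ → suc j) ∎
    where open ≤-Reasoning
  cell-gain a b j f@(split dense low 0<e s) = begin
    c₆₄ * cellCost′ a b (relabel′ j f) + 2 ^ H * (edges′ a b * 1)
      ≡⟨ cong (λ t → c₆₄ * (2 ^ H * t + N) + 2 ^ H * (edges′ a b * 1)) edge-labels ⟩
    c₆₄ * (2 ^ H * (edges′ a b * j + eₛ) + N) + 2 ^ H * (edges′ a b * 1)
      ≤⟨ split-arith (2 ^ H) (edges′ a b) (area′ a b) (weight H j) (weight H (suc j)) N aₛ eₛ j
           (Split.sparse s) (Split.large s) dense w≡2w′ areas ⟩
    c₆₄ * (2 ^ H * (edges′ a b * j) + area′ a b * weight H j)
      ≡⟨ cong (c₆₄ *_) (cellCost-const l r χ H d K a b j) ⟨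
    c₆₄ * cellCost′ a b (λ _ _ → j) ∎
    where
    open ≤-Reasoning
    open Split s using (S)
    N aₛ eₛ : ℕ
    N  = sum λ u → sum λ v → 𝟙 (cell′ a b u v) * weight H (j + 𝟙 (S u v))
    aₛ = sum λ u → sum λ v → 𝟙 (cell′ a b u v ∧ S u v)
    eₛ = count λ i → cell′ a b (l i) (r i) ∧ S (l i) (r i)

    -- The cell is not too dense for its label and not too sparse, so its label is less than H.
    w≡2w′ : weight H j ≡ 2 * weight H (suc j)
    w≡2w′ = weight-suc H j (*-cancelˡ-≤ (edges′ a b * (2 * d)) {{>-nonZero (*-mono-< 0<e 0<2d)}} (begin
      edges′ a b * (2 * d) * 2              ≡⟨ *-assoc (edges′ a b) (2 * d) 2 ⟩
      edges′ a b * (2 * d * 2)              ≡⟨ cong (edges′ a b *_) (trans (*-comm (2 * d) 2) (sym (*-assoc 2 2 d))) ⟩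
      edges′ a b * (4 * d)                  ≡⟨ cong (edges′ a b *_) 2^H≡4d ⟨
      edges′ a b * 2 ^ H                    ≤⟨ dense ⟩
      2 * (area′ a b * weight H j)          ≤⟨ *-monoʳ-≤ 2 (*-monoˡ-≤ (weight H j) low) ⟩
      2 * (d * edges′ a b * weight H j)     ≡⟨ rearrange (edges′ a b) (weight H j) ⟩
      edges′ a b * (2 * d) * weight H j     ∎))
      where
      0<2d : 0 < 2 * d
      0<2d = *-mono-< {0} {2} {0} {d} z<s (n≢0⇒n>0 λ { refl → <⇒≢ (m^n>0 2 H) (sym 2^H≡4d) })
      rearrange : ∀ e w → 2 * (d * e * w) ≡ e * (2 * d) * w
      rearrange e w = trans (sym (*-assoc 2 (d * e) w)) (cong (_* w)
        (trans (cong (2 *_) (*-comm d e)) (trans (sym (*-assoc 2 e d)) (trans (cong (_* d) (*-comm 2 e)) (*-assoc e 2 d)))))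

    edge-labels : sum (λ i → 𝟙 (cell′ a b (l i) (r i)) * (j + 𝟙 (S (l i) (r i)))) ≡ edges′ a b * j + eₛ
    edge-labels = trans
      (sum-cong-≗ λ i → trans (*-distribˡ-+ (𝟙 (cell′ a b (l i) (r i))) j _)
                              (cong (𝟙 (cell′ a b (l i) (r i)) * j +_) (sym (𝟙-∧ (cell′ a b (l i) (r i)) _))))
      (trans (∑-distrib-+ (λ i → 𝟙 (cell′ a b (l i) (r i)) * j) _)
             (cong (_+ eₛ) (sym (*-distribʳ-sum j _))))

    cell-weight : ∀ c p → 𝟙 c * weight H (j + 𝟙 p) + 𝟙 (c ∧ p) * weight H (suc j) ≡ 𝟙 c * weight H j
    cell-weight false p     = refl
    cell-weight true  false = trans (+-identityʳ _) (cong (λ t → 1 * weight H t) (+-identityʳ j))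
    cell-weight true  true  = trans (cong₂ _+_ (trans (*-identityˡ _) (cong (weight H) (+-comm j 1))) (*-identityˡ _))
      (trans (cong (weight H (suc j) +_) (sym (+-identityʳ _))) (trans (sym w≡2w′) (sym (*-identityˡ _))))

    areas : N + aₛ * weight H (suc j) ≡ area′ a b * weight H j
    areas = begin-equality
      N + aₛ * weight H (suc j)
        ≡⟨ cong (N +_) (trans (*-distribʳ-sum (weight H (suc j)) (λ u → sum λ v → 𝟙 (cell′ a b u v ∧ S u v)))
                              (sum-cong-≗ λ u → *-distribʳ-sum (weight H (suc j)) (λ v → 𝟙 (cell′ a b u v ∧ S u v)))) ⟩
      N + sum (λ u → sum λ v → 𝟙 (cell′ a b u v ∧ S u v) * weight H (suc j))
        ≡⟨ ∑∑-distrib-+ (λ u v → 𝟙 (cell′ a b u v) * weight H (j + 𝟙 (S u v)))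
                        (λ u v → 𝟙 (cell′ a b u v ∧ S u v) * weight H (suc j)) ⟨
      sum (λ u → sum λ v → 𝟙 (cell′ a b u v) * weight H (j + 𝟙 (S u v)) + 𝟙 (cell′ a b u v ∧ S u v) * weight H (suc j))
        ≡⟨ ∑∑-cong (λ u v → cell-weight (cell′ a b u v) (S u v)) ⟩
      sum (λ u → sum λ v → 𝟙 (cell′ a b u v) * weight H j)
        ≡⟨ trans (*-distribʳ-sum (weight H j) (λ u → sum λ v → 𝟙 (cell′ a b u v)))
                 (sum-cong-≗ λ u → *-distribʳ-sum (weight H j) (λ v → 𝟙 (cell′ a b u v))) ⟨
      sum (λ u → sum λ v → 𝟙 (cell′ a b u v)) * weight H j
        ≡⟨ cong (_* weight H j) (∑∑-product (λ u → χ u == a) (λ v → χ v == b)) ⟩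
      area′ a b * weight H j ∎

  private
    cost-cells : (f : Fin M → Fin M → Fin n → Fin n → ℕ) →
                 sum (λ a → sum λ b → cellCost′ a b (f a b)) ≡ cost′ (λ u v → f (χ u) (χ v) u v)
    cost-cells f = trans
      (∑∑-distrib-+ (λ a b → 2 ^ H * sum (λ i → 𝟙 (cell′ a b (l i) (r i)) * f a b (l i) (r i)))
                    (λ a b → sum λ u → sum λ v → 𝟙 (cell′ a b u v) * weight H (f a b u v)))
      (cong₂ _+_ (trans (sym (∑∑-*ˡ (2 ^ H) (λ a b → sum (λ i → 𝟙 (cell′ a b (l i) (r i)) * f a b (l i) (r i)))))
                        (cong (2 ^ H *_) (∑-fibres₂ (χ ∘ l) (χ ∘ r) (λ i a b → f a b (l i) (r i)))))
                 (∑∑-fibres χ (λ u v a b → weight H (f a b u v))))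

  gain : (J : Fin M → Fin M → ℕ) (F : ∀ a b → Flag l r χ H d K a b (J a b)) →
         c₆₄ * cost′ (λ u v → relabel′ (J (χ u) (χ v)) (F (χ u) (χ v)) u v) +
         2 ^ H * count (λ i → flagged′ (F (χ (l i)) (χ (r i)))) ≤
         c₆₄ * cost′ (λ u v → J (χ u) (χ v))
  gain J F = begin
    c₆₄ * cost′ (λ u v → relabel′ (J (χ u) (χ v)) (F (χ u) (χ v)) u v) +
    2 ^ H * count (λ i → flagged′ (F (χ (l i)) (χ (r i))))
      ≡⟨ cong₂ (λ s t → c₆₄ * s + 2 ^ H * t) (cost-cells (λ a b → relabel′ (J a b) (F a b))) flags ⟨
    c₆₄ * sum (λ a → sum λ b → cellCost′ a b (relabel′ (J a b) (F a b))) +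
    2 ^ H * sum (λ a → sum λ b → edges′ a b * 𝟙 (flagged′ (F a b)))
      ≡⟨ cong₂ _+_ (∑∑-*ˡ c₆₄ (λ a b → cellCost′ a b (relabel′ (J a b) (F a b))))
                   (∑∑-*ˡ (2 ^ H) (λ a b → edges′ a b * 𝟙 (flagged′ (F a b)))) ⟩
    sum (λ a → sum λ b → c₆₄ * cellCost′ a b (relabel′ (J a b) (F a b))) +
    sum (λ a → sum λ b → 2 ^ H * (edges′ a b * 𝟙 (flagged′ (F a b))))
      ≡⟨ ∑∑-distrib-+ (λ a b → c₆₄ * cellCost′ a b (relabel′ (J a b) (F a b)))
                      (λ a b → 2 ^ H * (edges′ a b * 𝟙 (flagged′ (F a b)))) ⟨
    sum (λ a → sum λ b → c₆₄ * cellCost′ a b (relabel′ (J a b) (F a b)) + 2 ^ H * (edges′ a b * 𝟙 (flagged′ (F a b))))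
      ≤⟨ ∑∑-mono (λ a b → cell-gain a b (J a b) (F a b)) ⟩
    sum (λ a → sum λ b → c₆₄ * cellCost′ a b (λ _ _ → J a b))
      ≡⟨ ∑∑-*ˡ c₆₄ (λ a b → cellCost′ a b (λ _ _ → J a b)) ⟨
    c₆₄ * sum (λ a → sum λ b → cellCost′ a b (λ _ _ → J a b))
      ≡⟨ cong (c₆₄ *_) (cost-cells (λ a b _ _ → J a b)) ⟩
    c₆₄ * cost′ (λ u v → J (χ u) (χ v)) ∎
    where
    open ≤-Reasoning
    flags : sum (λ a → sum λ b → edges′ a b * 𝟙 (flagged′ (F a b))) ≡ count (λ i → flagged′ (F (χ (l i)) (χ (r i))))
    flags = trans (∑∑-cong λ a b → *-distribʳ-sum (𝟙 (flagged′ (F a b))) (λ i → 𝟙 (cell′ a b (l i) (r i))))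
                  (∑-fibres₂ (χ ∘ l) (χ ∘ r) (λ i a b → 𝟙 (flagged′ (F a b))))

-- Refining a colouring

bit : Bool → Fin 2
bit false = zero
bit true  = suc zero

bit-injective : ∀ {p q} → bit p ≡ bit q → p ≡ q
bit-injective {false} {false} _ = refl
bit-injective {true}  {true}  _ = refl

code : (ps : List (Fin n → Bool)) → Fin n → Fin (2 ^ length ps)
code []       u = zero
code (p ∷ ps) u = combine (bit (p u)) (code ps u)

code-injective : (ps : List (Fin n → Bool)) {u v : Fin n} → code ps u ≡ code ps v → Agree u v ps
code-injective []       eq = []
code-injective (p ∷ ps) {u} {v} eq
  with Fin.combine-injective (bit (p u)) (code ps u) (bit (p v)) (code ps v) eq
... | bits , codes = bit-injective bits ∷ code-injective ps codes

refine : (Fin n → Fin M) → (ps : List (Fin n → Bool)) → Fin n → Fin (2 ^ length ps * M)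
refine χ ps u = combine (code ps u) (χ u)

refine-injective : (χ : Fin n → Fin M) (ps : List (Fin n → Bool)) {u v : Fin n} →
                   refine χ ps u ≡ refine χ ps v → χ u ≡ χ v × Agree u v ps
refine-injective χ ps {u} {v} eq with Fin.combine-injective (code ps u) (χ u) (code ps v) (χ v) eq
... | codes , χ≡ = χ≡ , code-injective ps codes

-- A function of vertices that respects the colours is read off at representatives. A pair
-- containing a colour that no vertex has gets the label 0.
factor : (χ : Fin n → Fin M) (f : Fin n → Fin n → ℕ) →
         (∀ {u u′ v v′} → χ u ≡ χ u′ → χ v ≡ χ v′ → f u v ≡ f u′ v′) →
         ∃ λ (J : Fin M → Fin M → ℕ) → ∀ u v → J (χ u) (χ v) ≡ f u v
factor {n} {M} χ f resp = label , label≡f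
  where
  label : Fin M → Fin M → ℕ
  label a b with Fin.any? (λ u → χ u Fin.≟ a) | Fin.any? (λ v → χ v Fin.≟ b)
  ... | yes (u , _) | yes (v , _) = f u v
  ... | yes _       | no _        = 0
  ... | no _        | _           = 0
  label≡f : ∀ u v → label (χ u) (χ v) ≡ f u v
  label≡f u v with Fin.any? (λ u′ → χ u′ Fin.≟ χ u) | Fin.any? (λ v′ → χ v′ Fin.≟ χ v)
  ... | yes (_ , u≡) | yes (_ , v≡) = resp u≡ v≡
  ... | yes _        | no ¬v        = contradiction (v , refl) ¬v
  ... | no ¬u        | _            = contradiction (u , refl) ¬u

first : (Fin n → Maybe A) → Maybe A
first {zero}  f = nothing
first {suc n} f = f zero <∣> first (f ∘ suc)

first-just : (f : Fin n → Maybe A) (i : Fin n) {a : A} → f i ≡ just a → ∃ λ a′ → first f ≡ just a′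
first-just f zero    eq rewrite eq = _ , refl
first-just f (suc i) eq with f zero
... | just a  = a , refl
... | nothing = first-just (f ∘ suc) i eq

length-concatMap-≤ : (f : A → List B) {c : ℕ} (as : List A) → (∀ a → length (f a) ≤ c) →
                     length (concatMap f as) ≤ length as * c
length-concatMap-≤ f []       bound = z≤n
length-concatMap-≤ f (a ∷ as) bound = ≤-trans (≤-reflexive (length-++ (f a)))
  (+-mono-≤ (bound a) (length-concatMap-≤ f as bound))

tableList : (Fin M → Fin M → List A) → List A
tableList {M} f = concatMap (λ a → concatMap (f a) (allFin M)) (allFin M)

length-tableList : (f : Fin M → Fin M → List A) {c : ℕ} → (∀ a b → length (f a b) ≤ c) →
                   length (tableList f) ≤ M * (M * c)
length-tableList {M} f {c} bound = subst (λ k → length (tableList f) ≤ k * (k * c)) (length-tabulate {n = M} id)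
  (length-concatMap-≤ _ (allFin M) λ a → length-concatMap-≤ (f a) (allFin M) (bound a))

tableList-All : {P : A → Set} (f : Fin M → Fin M → List A) → All P (tableList f) → ∀ a b → All P (f a b)
tableList-All f all a b = All.tabulate⁻ (All.map⁻ (All.concat⁻ {xss = List.map (f a) (allFin _)} inner)) b
  where
  inner : All _ (concatMap (f a) (allFin _))
  inner = All.tabulate⁻ {f = id} (All.map⁻ (All.concat⁻ {xss = List.map (λ a → concatMap (f a) (allFin _)) (allFin _)} all)) a

0<count : (p : Fin n → Bool) (i : Fin n) → p i ≡ true → 0 < count p
0<count {n} p i pᵢ = ≤-trans (≤-reflexive (sym (trans (∑-== i (λ _ → 1)) refl)))
  (∑-mono λ j → ≤-trans (≤-reflexive (*-identityʳ _)) (𝟙-mono λ i==j → subst (λ j → p j ≡ true) (==⇒≡ i==j) pᵢ))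

-- Flagging cells and counting the exceptions

module _ {m n M} (l r : Fin m → Fin n) (χ : Fin n → Fin M) (H d K : ℕ) where

  private
    edges′ = edges l r χ H d K
    area′  = area l r χ H d K

  dense : Fin M → Fin M → Bool
  dense a b = area′ a b ≤ᵇ d * edges′ a b

  -- `over` takes precedence, so that a cell flagged as `split` is known not to be too dense for its
  -- label.
  flag : ∀ {a b} j → Maybe (Split l r (λ u → χ u == a) (λ u → χ u == b) K) → Flag l r χ H d K a b j
  flag {a} {b} j s with 2 * (area′ a b * weight H j) <? edges′ a b * 2 ^ H | area′ a b ≤? d * edges′ a b
                      | 0 <? edges′ a b | s
  ... | yes o | _      | _       | _      = over o
  ... | no ¬o | yes de | yes 0<e | just s = split (≮⇒≥ ¬o) de 0<e s
  ... | no _  | _      | _       | _      = none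

  -- If the cell is too dense for its label, then the flag is `over`, which counts as well;
  -- otherwise it is `split`.
  flag-flagged : ∀ {a b} j {s s′} → dense a b ≡ true → 0 < edges′ a b → s ≡ just s′ →
                 flagged l r χ H d K (flag {a} {b} j s) ≡ true
  flag-flagged {a} {b} j de 0<e refl
    with 2 * (area′ a b * weight H j) <? edges′ a b * 2 ^ H | area′ a b ≤? d * edges′ a b | 0 <? edges′ a b
  ... | yes _ | _      | _      = refl
  ... | no _  | yes _  | yes _  = refl
  ... | no _  | no ¬de | _      = contradiction (≤ᵇ-true de) ¬de
  ... | no _  | yes _  | no ¬0< = contradiction 0<e ¬0<

  -- A cell that is not dense has fewer than `area′ a b / d` edges, and the areas of all cells add
  -- up to `n * n`.
  sparse-count : d * count (λ i → not (dense (χ (l i)) (χ (r i)))) ≤ n * n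
  sparse-count = begin
    d * count (λ i → not (dense (χ (l i)) (χ (r i))))
      ≡⟨ cong (d *_) (∑-fibres₂ (χ ∘ l) (χ ∘ r) (λ i a b → 𝟙 (not (dense a b)))) ⟨
    d * sum (λ a → sum λ b → sum λ i → 𝟙 (cell l r χ H d K a b (l i) (r i)) * 𝟙 (not (dense a b)))
      ≡⟨ cong (d *_) (∑∑-cong λ a b → *-distribʳ-sum (𝟙 (not (dense a b))) (λ i → 𝟙 (cell l r χ H d K a b (l i) (r i)))) ⟨
    d * sum (λ a → sum λ b → edges′ a b * 𝟙 (not (dense a b)))
      ≡⟨ ∑∑-*ˡ d (λ a b → edges′ a b * 𝟙 (not (dense a b))) ⟩
    sum (λ a → sum λ b → d * (edges′ a b * 𝟙 (not (dense a b))))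
      ≤⟨ ∑∑-mono sparse-cell ⟩
    sum (λ a → sum λ b → area′ a b)
      ≡⟨ ∑∑-cong (λ a b → trans (sym (∑∑-product (λ u → χ u == a) (λ v → χ v == b)))
                                (∑∑-cong λ u v → sym (*-identityʳ (𝟙 ((χ u == a) ∧ (χ v == b)))))) ⟩
    sum (λ a → sum λ b → sum λ u → sum λ v → 𝟙 ((χ u == a) ∧ (χ v == b)) * 1)
      ≡⟨ ∑∑-fibres χ (λ _ _ _ _ → 1) ⟩
    sum {n} (λ u → sum {n} λ v → 1)
      ≡⟨ trans (∑∑-const n n 1) (*-identityʳ _) ⟩
    n * n ∎
    where
    open ≤-Reasoning
    sparse-cell : ∀ a b → d * (edges′ a b * 𝟙 (not (dense a b))) ≤ area′ a b
    sparse-cell a b with area′ a b ≤ᵇ d * edges′ a b in eq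
    ... | true  = ≤-trans (≤-reflexive (trans (cong (d *_) (*-zeroʳ (edges′ a b))) (*-zeroʳ d))) z≤n
    ... | false = ≤-trans (≤-reflexive (cong (d *_) (*-identityʳ (edges′ a b)))) (<⇒≤ (≤ᵇ-false eq))

-- The at most `M` classes smaller than `s` have at most `M * s` vertices in all, and each vertex is
-- the right end of at most `n` edges.
tiny-count : {r′ r : Fin m → Fin n} → InjectivePair r′ r → (χ : Fin n → Fin M) (s : ℕ) →
             count (λ i → not (s ≤ᵇ count (λ u → χ u == χ (r i)))) ≤ n * (M * s)
tiny-count {m} {n} {M} {r′} {r} injective χ s = begin
  count (λ i → tiny (χ (r i)))
    ≤⟨ ∑-injectivePair injective (λ _ w → 𝟙 (tiny (χ w))) ⟩
  sum {n} (λ _ → sum λ w → 𝟙 (tiny (χ w)))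
    ≡⟨ ∑-const n _ ⟩
  n * sum (λ w → 𝟙 (tiny (χ w)))
    ≡⟨ cong (n *_) (∑-fibres χ (λ w c → 𝟙 (tiny c))) ⟨
  n * sum (λ c → sum λ w → 𝟙 (χ w == c) * 𝟙 (tiny c))
    ≡⟨ cong (n *_) (sum-cong-≗ λ c → *-distribʳ-sum (𝟙 (tiny c)) (λ w → 𝟙 (χ w == c))) ⟨
  n * sum (λ c → count (λ w → χ w == c) * 𝟙 (tiny c))
    ≤⟨ *-monoʳ-≤ n (∑-bound _ s tiny-class) ⟩
  n * (M * s) ∎
  where
  open ≤-Reasoning
  tiny : Fin M → Bool
  tiny c = not (s ≤ᵇ count (λ u → χ u == c))
  tiny-class : ∀ c → count (λ w → χ w == c) * 𝟙 (tiny c) ≤ s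
  tiny-class c with s ≤ᵇ count (λ u → χ u == c) in eq
  ... | true  = ≤-trans (≤-reflexive (*-zeroʳ (count (λ w → χ w == c)))) z≤n
  ... | false = ≤-trans (≤-reflexive (*-identityʳ _)) (<⇒≤ (≤ᵇ-false eq))

-- One refinement step

record Labelling (n M : ℕ) : Set where
  field
    χ           : Fin n → Fin M
    J₁₂ J₂₃ J₁₃ : Fin M → Fin M → ℕ

module _ {m n} (x y z : Fin m → Fin n) (H : ℕ) where

  totalCost : Labelling n M → ℕ
  totalCost L = cost x y H (λ u v → J₁₂ (χ u) (χ v)) +
                (cost y z H (λ u v → J₂₃ (χ u) (χ v)) + cost x z H (λ u v → J₁₃ (χ u) (χ v)))
    where open Labelling L

private
  some-flag : ∀ p₁ p₂ p₃ p₄ f₁ f₂ f₃ →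
              (p₁ ≡ true → p₂ ≡ true → p₃ ≡ true → p₄ ≡ true → f₁ ≡ true ⊎ f₂ ≡ true ⊎ f₃ ≡ true) →
              1 ≤ 𝟙 (not p₁) + (𝟙 (not p₂) + (𝟙 (not p₃) + 𝟙 (not p₄))) + (𝟙 f₁ + (𝟙 f₂ + 𝟙 f₃))
  some-flag false p₂    p₃    p₄    f₁    f₂    f₃ _ = s≤s z≤n
  some-flag true  false p₃    p₄    f₁    f₂    f₃ _ = s≤s z≤n
  some-flag true  true  false p₄    f₁    f₂    f₃ _ = s≤s z≤n
  some-flag true  true  true  false f₁    f₂    f₃ _ = s≤s z≤n
  some-flag true  true  true  true  true  f₂    f₃ _ = s≤s z≤n
  some-flag true  true  true  true  false true  f₃ _ = s≤s z≤n
  some-flag true  true  true  true  false false f₃ h with h refl refl refl refl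
  ... | inj₂ (inj₂ refl) = s≤s z≤n

  gains-rearrange₁ : ∀ c h a₁ a₂ a₃ f₁ f₂ f₃ →
    2 * (c * (a₁ + (a₂ + a₃)) + h * (f₁ + (f₂ + f₃))) ≡
    2 * ((c * a₁ + h * f₁) + ((c * a₂ + h * f₂) + (c * a₃ + h * f₃)))
  gains-rearrange₁ = solve-∀

  gains-rearrange₂ : ∀ c b₁ b₂ b₃ → 2 * (c * b₁ + (c * b₂ + c * b₃)) ≡ 2 * c * (b₁ + (b₂ + b₃))
  gains-rearrange₂ = solve-∀

  gains-rearrange₃ : ∀ c h a f → 2 * c * a + h * (2 * f) ≡ 2 * (c * a + h * f)
  gains-rearrange₃ = solve-∀

  -- The four exceptional counts take up at most `4 * (m / 8)`, so at least half of `m` is left for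
  -- the flags.
  half-arith : ∀ m s₁ s₂ s₃ t f → m ≤ s₁ + (s₂ + (s₃ + t)) + f →
               8 * s₁ ≤ m → 8 * s₂ ≤ m → 8 * s₃ ≤ m → 8 * t ≤ m → m ≤ 2 * f
  half-arith m s₁ s₂ s₃ t f m≤ b₁ b₂ b₃ b₄ = *-cancelˡ-≤ 4 (+-cancelˡ-≤ (4 * m) _ _ (begin
    4 * m + 4 * m                                      ≡⟨ *-distribʳ-+ m 4 4 ⟨
    8 * m                                              ≤⟨ *-monoʳ-≤ 8 m≤ ⟩
    8 * (s₁ + (s₂ + (s₃ + t)) + f)                     ≡⟨ expand s₁ s₂ s₃ t f ⟩
    (8 * s₁ + (8 * s₂ + (8 * s₃ + 8 * t))) + 4 * (2 * f) ≤⟨ +-monoˡ-≤ (4 * (2 * f)) (+-mono-≤ b₁ (+-mono-≤ b₂ (+-mono-≤ b₃ b₄))) ⟩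
    (m + (m + (m + m))) + 4 * (2 * f)                  ≡⟨ cong (_+ 4 * (2 * f)) (four m) ⟩
    4 * m + 4 * (2 * f)                                ∎))
    where
    open ≤-Reasoning
    expand : ∀ s₁ s₂ s₃ t f → 8 * (s₁ + (s₂ + (s₃ + t)) + f) ≡ (8 * s₁ + (8 * s₂ + (8 * s₃ + 8 * t))) + 4 * (2 * f)
    expand = solve-∀
    four : ∀ m → m + (m + (m + m)) ≡ 4 * m
    four = solve-∀

-- The bound `Q` on the number of rectangles in `dense-triple-splits`.
breadth : ℕ → ℕ
breadth d = 4 * c₆₄ * d * (c₆₄ * d)

module _ {m n} {x y z : Fin m → Fin n} {A₁ A₂ : Fin n → Fin n → Bool}
         (rs : IsRuzsaSzemerédi x y z A₁ A₂) {H d : ℕ} (0<d : 0 < d) (2^H≡4d : 2 ^ H ≡ 4 * d) where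

  open IsRuzsaSzemerédi rs

  private
    K s : ℕ
    K = breadth d
    s = c₆₄ * d * K

  module _ {M} (L : Labelling n M) where
    open Labelling L

    private
      class : Fin M → Fin n → Bool
      class a u = χ u == a

      e₁₂ e₂₃ e₁₃ a₁₂ : Fin M → Fin M → ℕ
      e₁₂ = edges x y χ H d K
      e₂₃ = edges y z χ H d K
      e₁₃ = edges x z χ H d K
      a₁₂ = area x y χ H d K

      Good : (a b c : Fin M) → Set
      Good a b c = a₁₂ a b ≤ d * e₁₂ a b × a₁₂ b c ≤ d * e₂₃ b c × a₁₂ a c ≤ d * e₁₃ a c ×
                   s ≤ count (class c) × 0 < count (class a) × 0 < count (class b)

      good? : ∀ a b c → Dec (Good a b c)
      good? a b c = (a₁₂ a b ≤? _) ×-dec (a₁₂ b c ≤? _) ×-dec (a₁₂ a c ≤? _) ×-dec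
                    (s ≤? _) ×-dec (0 <? _) ×-dec (0 <? _)

      Outcome : (a b c : Fin M) → Set
      Outcome a b c = Split x y (class a) (class b) K ⊎ Split y z (class b) (class c) K ⊎
                      Split x z (class a) (class c) K

      outcome : ∀ a b c → Maybe (Outcome a b c)
      outcome a b c with good? a b c
      ... | yes (de₁₂ , de₂₃ , de₁₃ , big , 0<a , 0<b) =
        just (dense-triple-splits rs (class a) (class b) (class c) 0<d de₁₂ de₂₃ de₁₃ big 0<a 0<b)
      ... | no _ = nothing

      outcome-just : ∀ a b c → Good a b c → ∃ λ o → outcome a b c ≡ just o
      outcome-just a b c good with good? a b c
      ... | yes (de₁₂ , de₂₃ , de₁₃ , big , 0<a , 0<b) = _ , refl
      ... | no ¬good = contradiction good ¬good

      left : A ⊎ B ⊎ C → Maybe A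
      left = [ just , const nothing ]′

      middle : A ⊎ B ⊎ C → Maybe B
      middle = [ const nothing , [ just , const nothing ]′ ]′

      right : A ⊎ B ⊎ C → Maybe C
      right = [ const nothing , [ const nothing , just ]′ ]′

      -- A pair of colours may be split by several triples of colours. The first split found is
      -- taken; any choice is fine, since a triple only needs one of its cells to be flagged.
      F₁₂ : ∀ a b → Flag x y χ H d K a b (J₁₂ a b)
      F₁₂ a b = flag x y χ H d K (J₁₂ a b) (first λ c → outcome a b c >>= left)

      F₂₃ : ∀ b c → Flag y z χ H d K b c (J₂₃ b c)
      F₂₃ b c = flag y z χ H d K (J₂₃ b c) (first λ a → outcome a b c >>= middle)

      F₁₃ : ∀ a c → Flag x z χ H d K a c (J₁₃ a c)
      F₁₃ a c = flag x z χ H d K (J₁₃ a c) (first λ b → outcome a b c >>= right)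

      f₁₂ f₂₃ f₁₃ : Fin m → Bool
      f₁₂ i = flagged x y χ H d K (F₁₂ (χ (x i)) (χ (y i)))
      f₂₃ i = flagged y z χ H d K (F₂₃ (χ (y i)) (χ (z i)))
      f₁₃ i = flagged x z χ H d K (F₁₃ (χ (x i)) (χ (z i)))

      d₁₂ d₂₃ d₁₃ big : Fin m → Bool
      d₁₂ i = dense x y χ H d K (χ (x i)) (χ (y i))
      d₂₃ i = dense y z χ H d K (χ (y i)) (χ (z i))
      d₁₃ i = dense x z χ H d K (χ (x i)) (χ (z i))
      big i = s ≤ᵇ count (class (χ (z i)))

      nonempty : ∀ u → 0 < count (class (χ u))
      nonempty u = 0<count (class (χ u)) u (==-refl (χ u))

      0<edges : (l r : Fin m → Fin n) (i : Fin m) → 0 < edges l r χ H d K (χ (l i)) (χ (r i))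
      0<edges l r i = 0<count _ i (cong₂ _∧_ (==-refl (χ (l i))) (==-refl (χ (r i))))

      flag-found : ∀ i → d₁₂ i ≡ true → d₂₃ i ≡ true → d₁₃ i ≡ true →
                   (∃ λ o → outcome (χ (x i)) (χ (y i)) (χ (z i)) ≡ just o) →
                   f₁₂ i ≡ true ⊎ f₂₃ i ≡ true ⊎ f₁₃ i ≡ true
      flag-found i p₁ p₂ p₃ (inj₁ o , eq) = inj₁ (flag-flagged x y χ H d K _ p₁ (0<edges x y i)
        (proj₂ (first-just _ (χ (z i)) (cong (_>>= left) eq))))
      flag-found i p₁ p₂ p₃ (inj₂ (inj₁ o) , eq) = inj₂ (inj₁ (flag-flagged y z χ H d K _ p₂ (0<edges y z i)
        (proj₂ (first-just _ (χ (x i)) (cong (_>>= middle) eq)))))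
      flag-found i p₁ p₂ p₃ (inj₂ (inj₂ o) , eq) = inj₂ (inj₂ (flag-flagged x z χ H d K _ p₃ (0<edges x z i)
        (proj₂ (first-just _ (χ (y i)) (cong (_>>= right) eq)))))

      flag-exists : ∀ i → d₁₂ i ≡ true → d₂₃ i ≡ true → d₁₃ i ≡ true → big i ≡ true →
                    f₁₂ i ≡ true ⊎ f₂₃ i ≡ true ⊎ f₁₃ i ≡ true
      flag-exists i p₁ p₂ p₃ p₄ = flag-found i p₁ p₂ p₃ (outcome-just (χ (x i)) (χ (y i)) (χ (z i))
        (≤ᵇ-true p₁ , ≤ᵇ-true p₂ , ≤ᵇ-true p₃ , ≤ᵇ-true p₄ , nonempty (x i) , nonempty (y i)))

      flags : ℕ
      flags = count f₁₂ + (count f₂₃ + count f₁₃)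

      -- If all three cells of a triple are dense and the class of its `z` is big, then
      -- `dense-triple-splits` splits one of these cells, which is therefore flagged.
      m≤counts : m ≤ count (not ∘ d₁₂) + (count (not ∘ d₂₃) + (count (not ∘ d₁₃) + count (not ∘ big))) + flags
      m≤counts = begin
        m ≡⟨ trans (∑-const m 1) (*-identityʳ m) ⟨
        sum {m} (λ _ → 1)
          ≤⟨ ∑-mono (λ i → some-flag (d₁₂ i) (d₂₃ i) (d₁₃ i) (big i) (f₁₂ i) (f₂₃ i) (f₁₃ i) (flag-exists i)) ⟩
        sum (λ i → 𝟙 (not (d₁₂ i)) + (𝟙 (not (d₂₃ i)) + (𝟙 (not (d₁₃ i)) + 𝟙 (not (big i)))) +
                   (𝟙 (f₁₂ i) + (𝟙 (f₂₃ i) + 𝟙 (f₁₃ i))))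
          ≡⟨ trans (∑-distrib-+ _ _) (cong₂ _+_
               (trans (∑-distrib-+ _ _) (cong (count (not ∘ d₁₂) +_)
                 (trans (∑-distrib-+ _ _) (cong (count (not ∘ d₂₃) +_) (∑-distrib-+ _ _)))))
               (trans (∑-distrib-+ _ _) (cong (count f₁₂ +_) (∑-distrib-+ _ _)))) ⟩
        count (not ∘ d₁₂) + (count (not ∘ d₂₃) + (count (not ∘ d₁₃) + count (not ∘ big))) + flags ∎
        where open ≤-Reasoning

      ps₁₂ ps₂₃ ps₁₃ ps : List (Fin n → Bool)
      ps₁₂ = tableList λ a b → predicates x y χ H d K (F₁₂ a b)
      ps₂₃ = tableList λ a b → predicates y z χ H d K (F₂₃ a b)
      ps₁₃ = tableList λ a b → predicates x z χ H d K (F₁₃ a b)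
      ps   = ps₁₂ ++ ps₂₃ ++ ps₁₃

      length-ps : length ps ≤ 3 * (M * (M * (2 * K)))
      length-ps = begin
        length ps
          ≡⟨ trans (length-++ ps₁₂) (cong (length ps₁₂ +_) (length-++ ps₂₃)) ⟩
        length ps₁₂ + (length ps₂₃ + length ps₁₃)
          ≤⟨ +-mono-≤ (length-tableList _ λ a b → length-predicates x y χ H d K (F₁₂ a b))
            (+-mono-≤ (length-tableList _ λ a b → length-predicates y z χ H d K (F₂₃ a b))
                      (length-tableList _ λ a b → length-predicates x z χ H d K (F₁₃ a b))) ⟩
        t + (t + t)
          ≡⟨ cong (λ t′ → t + (t + t′)) (+-identityʳ t) ⟨
        3 * t ∎
        where
        open ≤-Reasoning
        t : ℕ
        t = M * (M * (2 * K))

      χ′ : Fin n → Fin (2 ^ length ps * M)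
      χ′ = refine χ ps

      module _ {l r : Fin m → Fin n} (J : Fin M → Fin M → ℕ) (F : ∀ a b → Flag l r χ H d K a b (J a b)) where

        relabelled : Fin n → Fin n → ℕ
        relabelled u v = relabel l r χ H d K (J (χ u) (χ v)) (F (χ u) (χ v)) u v

        -- The old colours select the flag and the predicates in `ps` decide its set `S`, so the new
        -- label depends only on the new colours. `sub` extracts from `ps` the predicates of one of
        -- the three labellings.
        relabelled-resp : (∀ {u v} → Agree u v ps → Agree u v (tableList λ a b → predicates l r χ H d K (F a b))) →
                          ∀ {u u′ v v′} → χ′ u ≡ χ′ u′ → χ′ v ≡ χ′ v′ → relabelled u v ≡ relabelled u′ v′
        relabelled-resp sub {u} {u′} {v} {v′} u≡ v≡ = trans
          (relabel-agree l r χ H d K (F (χ u) (χ v))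
            (tableList-All _ (sub (proj₂ (refine-injective χ ps u≡))) (χ u) (χ v))
            (tableList-All _ (sub (proj₂ (refine-injective χ ps v≡))) (χ u) (χ v)))
          (cong₂ (λ a b → relabel l r χ H d K (J a b) (F a b) u′ v′)
            (proj₁ (refine-injective χ ps u≡)) (proj₁ (refine-injective χ ps v≡)))

      J₁₂′ = factor χ′ (relabelled J₁₂ F₁₂) (relabelled-resp J₁₂ F₁₂ (All.++⁻ˡ ps₁₂))
      J₂₃′ = factor χ′ (relabelled J₂₃ F₂₃) (relabelled-resp J₂₃ F₂₃ (All.++⁻ˡ ps₂₃ ∘ All.++⁻ʳ ps₁₂))
      J₁₃′ = factor χ′ (relabelled J₁₃ F₁₃) (relabelled-resp J₁₃ F₁₃ (All.++⁻ʳ ps₂₃ ∘ All.++⁻ʳ ps₁₂))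

      L′ : Labelling n (2 ^ length ps * M)
      L′ = record { χ = χ′ ; J₁₂ = proj₁ J₁₂′ ; J₂₃ = proj₁ J₂₃′ ; J₁₃ = proj₁ J₁₃′ }

      cost₁₂ cost₂₃ cost₁₃ : ℕ
      cost₁₂ = cost x y H (relabelled J₁₂ F₁₂)
      cost₂₃ = cost y z H (relabelled J₂₃ F₂₃)
      cost₁₃ = cost x z H (relabelled J₁₃ F₁₃)

      totalCost′ : totalCost x y z H L′ ≡ cost₁₂ + (cost₂₃ + cost₁₃)
      totalCost′ = cong₂ _+_ (cost-cong x y H (proj₂ J₁₂′))
                             (cong₂ _+_ (cost-cong y z H (proj₂ J₂₃′)) (cost-cong x z H (proj₂ J₁₃′)))

      8-sparse : {t : ℕ} → 8 * (n * n) ≤ d * m → d * t ≤ n * n → 8 * t ≤ m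
      8-sparse {t} 8nn≤dm dt≤nn = *-cancelˡ-≤ d {{>-nonZero 0<d}} (begin
        d * (8 * t)   ≡⟨ trans (sym (*-assoc d 8 t)) (trans (cong (_* t) (*-comm d 8)) (*-assoc 8 d t)) ⟩
        8 * (d * t)   ≤⟨ *-monoʳ-≤ 8 dt≤nn ⟩
        8 * (n * n)   ≤⟨ 8nn≤dm ⟩
        d * m         ∎)
        where open ≤-Reasoning

    -- The hypotheses limit the edges of each kind in sparse cells, and the triples with `z` in a
    -- tiny class, to `m / 8`. So at least `m / 2` edges lie in flagged cells, and by `gain` each of
    -- them saves `2 ^ H` of `c₆₄` times the cost. The exponent in the number of colours comes from
    -- three tables of `M * M` cells with at most `2 * breadth d` predicates each.
    refinement-step : 8 * (n * n) ≤ d * m → 8 * (n * (M * (c₆₄ * d * breadth d))) ≤ m →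
                      ∃₂ λ M′ (L′ : Labelling n M′) → M′ ≤ 2 ^ (3 * (M * (M * (2 * breadth d)))) * M ×
                      2 * c₆₄ * totalCost x y z H L′ + 2 ^ H * m ≤ 2 * c₆₄ * totalCost x y z H L
    refinement-step 8nn≤dm 8nMs≤m = _ , L′ , *-monoˡ-≤ M (^-monoʳ-≤ 2 length-ps) , (begin
      2 * c₆₄ * totalCost x y z H L′ + 2 ^ H * m
        ≤⟨ +-mono-≤ (≤-reflexive (cong (2 * c₆₄ *_) totalCost′)) (*-monoʳ-≤ (2 ^ H)
             (half-arith m (count (not ∘ d₁₂)) (count (not ∘ d₂₃)) (count (not ∘ d₁₃)) (count (not ∘ big)) flags m≤counts
               (8-sparse 8nn≤dm (sparse-count x y χ H d K)) (8-sparse 8nn≤dm (sparse-count y z χ H d K))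
               (8-sparse 8nn≤dm (sparse-count x z χ H d K))
               (≤-trans (*-monoʳ-≤ 8 (tiny-count injective₂₃ χ s)) 8nMs≤m))) ⟩
      2 * c₆₄ * (cost₁₂ + (cost₂₃ + cost₁₃)) + 2 ^ H * (2 * flags)
        ≡⟨ gains-rearrange₃ c₆₄ (2 ^ H) _ flags ⟩
      2 * (c₆₄ * (cost₁₂ + (cost₂₃ + cost₁₃)) + 2 ^ H * flags)
        ≡⟨ gains-rearrange₁ c₆₄ (2 ^ H) cost₁₂ cost₂₃ cost₁₃ (count f₁₂) (count f₂₃) (count f₁₃) ⟩
      2 * ((c₆₄ * cost₁₂ + 2 ^ H * count f₁₂) +
           ((c₆₄ * cost₂₃ + 2 ^ H * count f₂₃) + (c₆₄ * cost₁₃ + 2 ^ H * count f₁₃)))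
        ≤⟨ *-monoʳ-≤ 2 (+-mono-≤ (gain injective₁₂ χ 2^H≡4d J₁₂ F₁₂)
                       (+-mono-≤ (gain injective₂₃ χ 2^H≡4d J₂₃ F₂₃) (gain injective₁₃ χ 2^H≡4d J₁₃ F₁₃))) ⟩
      2 * (c₆₄ * cost x y H (λ u v → J₁₂ (χ u) (χ v)) +
           (c₆₄ * cost y z H (λ u v → J₂₃ (χ u) (χ v)) + c₆₄ * cost x z H (λ u v → J₁₃ (χ u) (χ v))))
        ≡⟨ gains-rearrange₂ c₆₄ _ _ _ ⟩
      2 * c₆₄ * totalCost x y z H L ∎)
      where open ≤-Reasoning

-- Towers

tower : ℕ → ℕ
tower zero    = 1
tower (suc k) = 2 ^ tower k

n<2^n : ∀ n → n < 2 ^ n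
n<2^n zero    = ≤-refl
n<2^n (suc n) = begin-strict
  suc n          ≤⟨ n<2^n n ⟩
  2 ^ n          <⟨ m<m+n (2 ^ n) (m^n>0 2 n) ⟩
  2 ^ n + 2 ^ n  ≡⟨ cong (2 ^ n +_) (+-identityʳ _) ⟨
  2 ^ suc n      ∎
  where open ≤-Reasoning

4n≤2^n : ∀ n → 4 * (4 + n) ≤ 2 ^ (4 + n)
4n≤2^n zero    = ≤-refl
4n≤2^n (suc n) = begin
  4 * (5 + n)                   ≡⟨ *-suc 4 (4 + n) ⟩
  4 + 4 * (4 + n)               ≤⟨ +-mono-≤ (*-monoʳ-≤ 4 {1} {4 + n} (s≤s z≤n)) (4n≤2^n n) ⟩
  4 * (4 + n) + 2 ^ (4 + n)     ≤⟨ +-monoˡ-≤ (2 ^ (4 + n)) (4n≤2^n n) ⟩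
  2 ^ (4 + n) + 2 ^ (4 + n)     ≡⟨ cong (2 ^ (4 + n) +_) (+-identityʳ _) ⟨
  2 ^ (5 + n)                   ∎
  where open ≤-Reasoning

4n≤2^n′ : ∀ {n} → 4 ≤ n → 4 * n ≤ 2 ^ n
4n≤2^n′ 4≤n = subst (λ n → 4 * n ≤ 2 ^ n) (m+[n∸m]≡n 4≤n) (4n≤2^n _)

tower-mono : ∀ {j k} → j ≤ k → tower j ≤ tower k
tower-mono {k = zero}  z≤n = ≤-refl
tower-mono {k = suc k} z≤n = m^n>0 2 (tower k)
tower-mono (s≤s j≤k)       = ^-monoʳ-≤ 2 (tower-mono j≤k)

-- Serves to bound the quantity `W` below, which is `2 ^ (4 * e + 32)`. The next level of the tower
-- is at least four times the present one, which leaves room for adding 4.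
tower-linear : ∀ e → 4 * e + 32 ≤ tower (4 + e)
tower-linear zero    = ≤ᵇ⇒≤ 32 65536 _
tower-linear (suc e) = begin
  4 * suc e + 32           ≡⟨ cong (_+ 32) (*-suc 4 e) ⟩
  4 + (4 * e + 32)         ≤⟨ +-mono-≤ (≤-trans (≤ᵇ⇒≤ 4 32 _) (m≤n+m 32 (4 * e))) ≤-refl ⟩
  (4 * e + 32) + (4 * e + 32)   ≤⟨ +-mono-≤ (tower-linear e) (tower-linear e) ⟩
  t + t                    ≤⟨ m≤m+n (t + t) (t + (t + 0)) ⟩
  (t + t) + (t + (t + 0))  ≡⟨ +-assoc t t _ ⟩
  4 * t                    ≤⟨ 4n≤2^n′ (≤-trans (≤-trans (≤ᵇ⇒≤ 4 32 _) (m≤n+m 32 (4 * e))) (tower-linear e)) ⟩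
  2 ^ t                    ∎
  where
  open ≤-Reasoning
  t : ℕ
  t = tower (4 + e)

n≤2^⌈log₂n⌉ : ∀ n → n ≤ 2 ^ ⌈log₂ n ⌉
n≤2^⌈log₂n⌉ = <-rec _ λ where
  0 _ → z≤n
  1 _ → ≤-refl
  n@(suc (suc n-2)) rec → let open ≤-Reasoning in begin
    n                              ≡⟨ ⌊n/2⌋+⌈n/2⌉≡n n ⟨
    ⌊ n /2⌋ + ⌈ n /2⌉              ≤⟨ +-monoˡ-≤ ⌈ n /2⌉ (⌊n/2⌋≤⌈n/2⌉ n) ⟩
    ⌈ n /2⌉ + ⌈ n /2⌉              ≡⟨ cong (⌈ n /2⌉ +_) (+-identityʳ _) ⟨
    2 * ⌈ n /2⌉                    ≤⟨ *-monoʳ-≤ 2 (rec (⌈n/2⌉<n n-2)) ⟩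
    2 ^ suc ⌈log₂ ⌈ n /2⌉ ⌉        ≡⟨ cong (λ t → 2 ^ suc t) (⌈log₂⌈n/2⌉⌉≡⌈log₂n⌉∸1 n) ⟩
    2 ^ suc (⌈log₂ n ⌉ ∸ 1)        ≡⟨ cong (2 ^_) (m+[n∸m]≡n (⌈log₂⌉-mono-≤ {2} {n} (s≤s (s≤s z≤n)))) ⟩
    2 ^ ⌈log₂ n ⌉                  ∎

iterate-log≤1⇒≤tower : ∀ k {n} → iterate ⌈log₂_⌉ n k ≤ 1 → n ≤ tower k
iterate-log≤1⇒≤tower zero        n≤1 = n≤1
iterate-log≤1⇒≤tower (suc k) {n} it  =
  ≤-trans (n≤2^⌈log₂n⌉ n) (^-monoʳ-≤ 2 (iterate-log≤1⇒≤tower k it))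

≤tower⇒iterate-log≤1 : ∀ k {n} → n ≤ tower k → iterate ⌈log₂_⌉ n k ≤ 1
≤tower⇒iterate-log≤1 zero        n≤1 = n≤1
≤tower⇒iterate-log≤1 (suc k) {n} n≤  = ≤tower⇒iterate-log≤1 k
  (≤-trans (⌈log₂⌉-mono-≤ n≤) (≤-reflexive (⌈log₂2^n⌉≡n (tower k))))

n≤tower-log* : ∀ n → n ≤ tower (log* n)
n≤tower-log* n = iterate-log≤1⇒≤tower (log* n) (proj₁ (proj₂ (logIterations n)))

tower<⇒<log* : ∀ {k n} → tower k < n → k < log* n
tower<⇒<log* {k} {n} tower<n = ≰⇒> λ log*≤k →
  <⇒≱ tower<n (≤-trans (n≤tower-log* n) (tower-mono log*≤k))

<log*⇒tower< : ∀ {k n} → k < log* n → tower k < n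
<log*⇒tower< {k} {n} k<log* = ≰⇒> λ n≤tower →
  <⇒≱ k<log* (proj₂ (proj₂ (logIterations n)) (≤tower⇒iterate-log≤1 k n≤tower))

-- Bounds the number of colours after t refinements.
colours : ℕ → ℕ → ℕ
colours d zero    = 1
colours d (suc t) = 2 ^ (3 * (colours d t * (colours d t * (2 * breadth d)))) * colours d t

colours-suc : ∀ d t → colours d t ≤ colours d (suc t)
colours-suc d t = m≤n*m (colours d t) (2 ^ (3 * (colours d t * (colours d t * (2 * breadth d)))))
  {{>-nonZero (m^n>0 2 (3 * (colours d t * (colours d t * (2 * breadth d)))))}}

-- Iterating the refinement

module _ {m n} {x y z : Fin m → Fin n} {A₁ A₂ : Fin n → Fin n → Bool}
         (rs : IsRuzsaSzemerédi x y z A₁ A₂) (e : ℕ) (n²≤m2^e : n * n ≤ m * 2 ^ e) where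

  private
    -- The density is at least `2 ^ (- e)`. The factor 8 in `d` gives `8 * (n * n) ≤ d * m`, so
    -- sparse cells take up at most an eighth of the edges of each kind, and `H` is determined by
    -- `2 ^ H ≡ 4 * d`.
    d H : ℕ
    d = 2 ^ (3 + e)
    H = 5 + e

    0<d : 0 < d
    0<d = m^n>0 2 (3 + e)

    2^H≡4d : 2 ^ H ≡ 4 * d
    2^H≡4d = sym (*-assoc 2 2 d)

    s : ℕ
    s = c₆₄ * d * breadth d

    initial : Labelling n 1
    initial = record { χ = λ _ → zero ; J₁₂ = λ _ _ → e ; J₂₃ = λ _ _ → e ; J₁₃ = λ _ _ → e }

    -- The edges cost `e` units of `2 ^ H * m`. As `weight H e` is `2 ^ 5`, the pairs of vertices
    -- weigh at most `m * 2 ^ e * 2 ^ 5`, which is one more unit.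
    initial-cost : (l r : Fin m → Fin n) → cost l r H (λ _ _ → e) ≤ suc e * (2 ^ H * m)
    initial-cost l r = begin
      2 ^ H * sum {m} (λ _ → e) + sum {n} (λ _ → sum {n} λ _ → weight H e)
        ≡⟨ cong₂ _+_ (trans (cong (2 ^ H *_) (trans (∑-const m e) (*-comm m e)))
                            (trans (sym (*-assoc (2 ^ H) e m)) (trans (cong (_* m) (*-comm (2 ^ H) e)) (*-assoc e (2 ^ H) m))))
                     (∑∑-const n n (weight H e)) ⟩
      e * (2 ^ H * m) + n * n * weight H e
        ≤⟨ +-monoʳ-≤ (e * (2 ^ H * m)) (*-mono-≤ n²≤m2^e (≤-reflexive (cong (2 ^_) (m+n∸n≡m 5 e)))) ⟩
      e * (2 ^ H * m) + m * 2 ^ e * 2 ^ 5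
        ≡⟨ cong (e * (2 ^ H * m) +_) (trans (*-assoc m (2 ^ e) (2 ^ 5)) (trans (cong (m *_)
             (trans (sym (^-distribˡ-+-* 2 e 5)) (cong (2 ^_) (+-comm e 5)))) (*-comm m (2 ^ H)))) ⟩
      e * (2 ^ H * m) + 2 ^ H * m
        ≡⟨ +-comm (e * (2 ^ H * m)) _ ⟩
      suc e * (2 ^ H * m) ∎
      where open ≤-Reasoning

    run : ∀ t → d * (colours d t * s) ≤ n → ∃₂ λ M (L : Labelling n M) → M ≤ colours d t ×
          2 * c₆₄ * totalCost x y z H L + t * (2 ^ H * m) ≤ 2 * c₆₄ * totalCost x y z H initial
    run zero    _     = 1 , initial , ≤-refl , ≤-reflexive (+-identityʳ _)
    run (suc t) large = step (run t smaller)
      where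
      open ≤-Reasoning
      smaller : d * (colours d t * s) ≤ n
      smaller = ≤-trans (*-monoʳ-≤ d (*-monoˡ-≤ s (colours-suc d t))) large
      8n²≤dm : 8 * (n * n) ≤ d * m
      8n²≤dm = begin
        8 * (n * n)          ≤⟨ *-monoʳ-≤ 8 n²≤m2^e ⟩
        8 * (m * 2 ^ e)      ≡⟨ cong (8 *_) (*-comm m (2 ^ e)) ⟩
        8 * (2 ^ e * m)      ≡⟨ *-assoc 8 (2 ^ e) m ⟨
        8 * 2 ^ e * m        ≡⟨ cong (_* m) (^-distribˡ-+-* 2 3 e) ⟨
        d * m                ∎
      tiny : ∀ {M} → M ≤ colours d t → 8 * (n * (M * s)) ≤ m
      tiny {M} M≤ = *-cancelˡ-≤ (2 ^ e) {{>-nonZero (m^n>0 2 e)}} (begin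
        2 ^ e * (8 * (n * (M * s)))   ≡⟨ *-assoc (2 ^ e) 8 _ ⟨
        2 ^ e * 8 * (n * (M * s))     ≡⟨ cong (_* (n * (M * s))) (trans (*-comm (2 ^ e) 8) (sym (^-distribˡ-+-* 2 3 e))) ⟩
        d * (n * (M * s))             ≤⟨ *-monoʳ-≤ d (*-monoʳ-≤ n (*-monoˡ-≤ s M≤)) ⟩
        d * (n * (colours d t * s))   ≡⟨ trans (sym (*-assoc d n _)) (trans (cong (_* (colours d t * s)) (*-comm d n)) (*-assoc n d _)) ⟩
        n * (d * (colours d t * s))   ≤⟨ *-monoʳ-≤ n smaller ⟩
        n * n                         ≤⟨ n²≤m2^e ⟩
        m * 2 ^ e                     ≡⟨ *-comm m (2 ^ e) ⟩
        2 ^ e * m                     ∎)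
      step : (∃₂ λ M (L : Labelling n M) → M ≤ colours d t ×
                2 * c₆₄ * totalCost x y z H L + t * (2 ^ H * m) ≤ 2 * c₆₄ * totalCost x y z H initial) →
             ∃₂ λ M (L : Labelling n M) → M ≤ colours d (suc t) ×
                2 * c₆₄ * totalCost x y z H L + suc t * (2 ^ H * m) ≤ 2 * c₆₄ * totalCost x y z H initial
      step (M , L , M≤ , inv) = combine-with (refinement-step rs {H = H} {d = d} 0<d 2^H≡4d L 8n²≤dm (tiny M≤))
        where
        combine-with : (∃₂ λ M′ (L′ : Labelling n M′) → M′ ≤ 2 ^ (3 * (M * (M * (2 * breadth d)))) * M ×
                         2 * c₆₄ * totalCost x y z H L′ + 2 ^ H * m ≤ 2 * c₆₄ * totalCost x y z H L) →
                       ∃₂ λ M (L : Labelling n M) → M ≤ colours d (suc t) ×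
                         2 * c₆₄ * totalCost x y z H L + suc t * (2 ^ H * m) ≤ 2 * c₆₄ * totalCost x y z H initial
        combine-with (M′ , L′ , M′≤ , drop) = M′ , L′ ,
          ≤-trans M′≤ (*-mono-≤ (^-monoʳ-≤ 2 (*-monoʳ-≤ 3 (*-mono-≤ M≤ (*-monoˡ-≤ (2 * breadth d) M≤)))) M≤) ,
          (begin
            2 * c₆₄ * totalCost x y z H L′ + (2 ^ H * m + t * (2 ^ H * m))
              ≡⟨ +-assoc (2 * c₆₄ * totalCost x y z H L′) _ _ ⟨
            2 * c₆₄ * totalCost x y z H L′ + 2 ^ H * m + t * (2 ^ H * m)
              ≤⟨ +-monoˡ-≤ (t * (2 ^ H * m)) drop ⟩
            2 * c₆₄ * totalCost x y z H L + t * (2 ^ H * m)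
              ≤⟨ inv ⟩
            2 * c₆₄ * totalCost x y z H initial ∎)

  -- By `initial-cost`, the three costs scaled by `2 * c₆₄` start at no more than `6 * c₆₄ * suc e`
  -- units of `2 ^ H * m`. Each refinement saves one unit, so one refinement more than that is
  -- impossible.
  few-colours-impossible : 0 < m → ¬ (d * (colours d (suc (6 * c₆₄ * suc e)) * s) ≤ n)
  few-colours-impossible 0<m large = contradict (run (suc (6 * c₆₄ * suc e)) large)
    where
    open ≤-Reasoning
    contradict : ¬ (∃₂ λ M (L : Labelling n M) → M ≤ colours d (suc (6 * c₆₄ * suc e)) ×
                    2 * c₆₄ * totalCost x y z H L + suc (6 * c₆₄ * suc e) * (2 ^ H * m) ≤ 2 * c₆₄ * totalCost x y z H initial)
    contradict (M , L , _ , inv) = <⇒≱ (m<n+m (6 * c₆₄ * suc e * (2 ^ H * m)) (*-mono-< (m^n>0 2 H) 0<m)) (begin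
      suc (6 * c₆₄ * suc e) * (2 ^ H * m)
        ≤⟨ m≤n+m _ (2 * c₆₄ * totalCost x y z H L) ⟩
      2 * c₆₄ * totalCost x y z H L + suc (6 * c₆₄ * suc e) * (2 ^ H * m)
        ≤⟨ inv ⟩
      2 * c₆₄ * totalCost x y z H initial
        ≤⟨ *-monoʳ-≤ (2 * c₆₄) (+-mono-≤ (initial-cost x y) (+-mono-≤ (initial-cost y z) (initial-cost x z))) ⟩
      2 * c₆₄ * (c + (c + c))
        ≡⟨ three c₆₄ (suc e) (2 ^ H * m) ⟩
      6 * c₆₄ * suc e * (2 ^ H * m) ∎)
      where
      c : ℕ
      c = suc e * (2 ^ H * m)
      three : ∀ c e h → 2 * c * (e * h + (e * h + e * h)) ≡ 6 * c * e * h
      three = solve-∀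

private
  +-exp : ∀ a b {x y} → x ≡ 2 ^ a → y ≡ 2 ^ b → x * y ≡ 2 ^ (a + b)
  +-exp a b refl refl = sym (^-distribˡ-+-* 2 a b)

module _ (e : ℕ) where

  private
    d W : ℕ
    d = 2 ^ (3 + e)
    W = d * (c₆₄ * d * breadth d)

    W≡2^ : W ≡ 2 ^ (4 * e + 32)
    W≡2^ = trans (product (3 + e) c₆₄≡64 refl) (cong (2 ^_) (exponent e))
      where
      product : ∀ f {c d} → c ≡ 2 ^ 6 → d ≡ 2 ^ f →
                d * (c * d * (4 * c * d * (c * d))) ≡ 2 ^ (f + (6 + f + (2 + 6 + f + (6 + f))))
      product f c≡ d≡ = +-exp f (6 + f + (2 + 6 + f + (6 + f))) d≡
        (+-exp (6 + f) (2 + 6 + f + (6 + f)) (+-exp 6 f c≡ d≡)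
        (+-exp (2 + 6 + f) (6 + f) (+-exp (2 + 6) f (+-exp 2 6 refl c≡) d≡) (+-exp 6 f c≡ d≡)))
      exponent : ∀ e → 3 + e + (6 + (3 + e) + (2 + 6 + (3 + e) + (6 + (3 + e)))) ≡ 4 * e + 32
      exponent = solve-∀

    -- A refinement costs two levels: the number of colours goes into an exponent, and the second
    -- exponential absorbs the polynomial there. The start `5 + e` is such that `V` also bounds `W`.
    V : ℕ → ℕ
    V t = tower (5 + e + 2 * t)

    W≤V : ∀ t → W ≤ V t
    W≤V t = begin
      W                   ≡⟨ W≡2^ ⟩
      2 ^ (4 * e + 32)    ≤⟨ ^-monoʳ-≤ 2 (tower-linear e) ⟩
      tower (5 + e)       ≤⟨ tower-mono (m≤m+n (5 + e) (2 * t)) ⟩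
      V t                 ∎
      where open ≤-Reasoning

    6K≤W : 6 * breadth d ≤ W
    6K≤W = begin
      6 * breadth d                   ≤⟨ *-monoˡ-≤ (breadth d) (≤-trans (≤ᵇ⇒≤ 6 8 _) (*-monoʳ-≤ 8 (m^n>0 2 e))) ⟩
      8 * 2 ^ e * breadth d           ≡⟨ cong (_* breadth d) (^-distribˡ-+-* 2 3 e) ⟨
      d * breadth d                   ≤⟨ *-monoʳ-≤ d (m≤n*m (breadth d) (c₆₄ * d) {{>-nonZero (*-mono-< 0<c₆₄ (m^n>0 2 (3 + e)))}}) ⟩
      W                               ∎
      where open ≤-Reasoning

    -- With v = 2 ^ u, the exponent v ^ 3 + v of the next bound is at most v ^ 4 = 2 ^ (4 * u).
    double-exponential : ∀ u → 4 ≤ u → let v = 2 ^ u in 2 ^ (v * (v * v)) * v ≤ 2 ^ (2 ^ v)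
    double-exponential u 4≤u = begin
      2 ^ (v * (v * v)) * v           ≤⟨ *-monoʳ-≤ (2 ^ (v * (v * v))) (<⇒≤ (n<2^n v)) ⟩
      2 ^ (v * (v * v)) * 2 ^ v       ≡⟨ ^-distribˡ-+-* 2 (v * (v * v)) v ⟨
      2 ^ (v * (v * v) + v)           ≤⟨ ^-monoʳ-≤ 2 (begin
        v * (v * v) + v                 ≤⟨ +-monoʳ-≤ (v * (v * v)) (m≤m*n v (v * v) {{>-nonZero (*-mono-< 0<v 0<v)}}) ⟩
        v * (v * v) + v * (v * v)       ≡⟨ cong (v * (v * v) +_) (+-identityʳ _) ⟨
        2 * (v * (v * v))               ≤⟨ *-monoˡ-≤ (v * (v * v)) (^-monoʳ-≤ 2 {1} {u} (≤-trans (s≤s z≤n) 4≤u)) ⟩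
        v * (v * (v * v))               ≡⟨ +-exp u _ refl (+-exp u _ refl (+-exp u u refl refl)) ⟩
        2 ^ (u + (u + (u + u)))         ≡⟨ cong (λ t → 2 ^ (u + (u + (u + t)))) (+-identityʳ u) ⟨
        2 ^ (4 * u)                     ≤⟨ ^-monoʳ-≤ 2 (4n≤2^n′ 4≤u) ⟩
        2 ^ v                           ∎) ⟩
      2 ^ (2 ^ v)                     ∎
      where
      open ≤-Reasoning
      v : ℕ
      v = 2 ^ u
      0<v : 0 < v
      0<v = m^n>0 2 u

    4≤tower : ∀ j → 4 ≤ tower (4 + j)
    4≤tower j = ≤-trans (≤ᵇ⇒≤ 4 32 _) (≤-trans (m≤n+m 32 (4 * j)) (tower-linear j))

    colours≤tower : ∀ t → colours d t ≤ V t
    colours≤tower zero    = tower-mono {0} {5 + e + 0} z≤n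
    colours≤tower (suc t) = begin
      2 ^ (3 * (colours d t * (colours d t * (2 * breadth d)))) * colours d t
        ≡⟨ cong (λ t′ → 2 ^ t′ * colours d t) (rearrange (colours d t) (breadth d)) ⟩
      2 ^ (colours d t * (colours d t * (6 * breadth d))) * colours d t
        ≤⟨ *-mono-≤ (^-monoʳ-≤ 2 (*-mono-≤ (colours≤tower t) (*-mono-≤ (colours≤tower t) (≤-trans 6K≤W (W≤V t))))) (colours≤tower t) ⟩
      2 ^ (V t * (V t * V t)) * V t
        ≤⟨ double-exponential (tower (4 + e + 2 * t)) (4≤tower (e + 2 * t)) ⟩
      2 ^ (2 ^ V t)
        ≡⟨ cong tower (two-more e t) ⟩
      V (suc t) ∎
      where
      open ≤-Reasoning
      rearrange : ∀ c k → 3 * (c * (c * (2 * k))) ≡ c * (c * (6 * k))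
      rearrange = solve-∀
      two-more : ∀ e t → 7 + e + 2 * t ≡ 5 + e + 2 * suc t
      two-more = solve-∀

  steps-fit : ∀ {n} → tower (800 * suc e) ≤ n →
              d * (colours d (suc (6 * c₆₄ * suc e)) * (c₆₄ * d * breadth d)) ≤ n
  steps-fit {n} tower≤n = begin
    d * (colours d t * (c₆₄ * d * breadth d))
      ≡⟨ x∙yz≈y∙xz d (colours d t) (c₆₄ * d * breadth d) ⟩
    colours d t * W
      ≤⟨ *-mono-≤ (colours≤tower t) (W≤V t) ⟩
    V t * V t
      ≡⟨ +-exp u u refl refl ⟩
    2 ^ (u + u)
      ≤⟨ ^-monoʳ-≤ 2 (begin
           u + u            ≤⟨ m≤m+n (u + u) (u + (u + 0)) ⟩
           u + u + (u + (u + 0)) ≡⟨ +-assoc u u (u + (u + 0)) ⟩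
           4 * u            ≤⟨ 4n≤2^n′ (4≤tower (e + 2 * t)) ⟩
           V t              ∎) ⟩
    tower (6 + e + 2 * t)
      ≤⟨ tower-mono height ⟩
    tower (800 * suc e)
      ≤⟨ tower≤n ⟩
    n ∎
    where
    open ≤-Reasoning
    t u : ℕ
    t = suc (6 * c₆₄ * suc e)
    u = tower (4 + e + 2 * t)
    -- The left side is `769 * e + 776`, whence the constant 800.
    height : 6 + e + 2 * t ≤ 800 * suc e
    height = subst (λ c → 6 + e + 2 * suc (6 * c * suc e) ≤ 800 * suc e) (sym c₆₄≡64)
      (≤-trans (m≤m+n _ (31 * e + 24)) (≤-reflexive (slack e)))
      where
      slack : ∀ e → 6 + e + 2 * suc (6 * 64 * suc e) + (31 * e + 24) ≡ 800 * suc e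
      slack = solve-∀

-- A Ruzsa–Szemerédi system with more than n ^ 2 / 2 ^ e triples would allow more
-- refinement steps than its cost can pay for.
ruzsa-szemerédi : {x y z : Fin m → Fin n} {A₁ A₂ : Fin n → Fin n → Bool} →
                  IsRuzsaSzemerédi x y z A₁ A₂ → ∀ e → tower (800 * suc e) ≤ n → m * 2 ^ e ≤ n * n
ruzsa-szemerédi {m} {n} rs e tower≤n = ≮⇒≥ λ n²<m2^e →
  few-colours-impossible rs e (<⇒≤ n²<m2^e) (0<m n²<m2^e) (steps-fit e tower≤n)
  where
  0<m : n * n < m * 2 ^ e → 0 < m
  0<m lt = n≢0⇒n>0 λ { refl → case lt of λ () }

-- Makes `n` so large in `types-bound` that quadratically many constraints are negligible.
2^[2+e]≤tower : ∀ e → 2 ^ (2 + e) ≤ tower (800 * suc e)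
2^[2+e]≤tower e = begin
  2 ^ (2 + e)          ≤⟨ ^-monoʳ-≤ 2 (≤-trans (+-mono-≤ {2} {32} (≤ᵇ⇒≤ 2 32 _) (m≤n*m e 4)) (≤-trans (≤-reflexive (+-comm 32 (4 * e))) (tower-linear e))) ⟩
  tower (5 + e)        ≤⟨ tower-mono (+-mono-≤ {5} {800} (≤ᵇ⇒≤ 5 800 _) (m≤n*m e 800)) ⟩
  tower (800 + 800 * e) ≡⟨ cong tower (*-suc 800 e) ⟨
  tower (800 * suc e)  ∎
  where open ≤-Reasoning

-- Non-redundancy

-- Reindexes a subset by a `Fin k` of its own, because the bounds to be applied are about whole
-- families.
enumerate : (p : Fin m → Bool) → ∃₂ λ k (f : Fin k → Fin m) →
            k ≡ count p × (∀ i j → f i ≡ f j → i ≡ j) × (∀ i → p (f i) ≡ true)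
enumerate {zero}  p = 0 , (λ ()) , sym (sum-zero _) , (λ ()) , λ ()
enumerate {suc m} p with p zero in eq | sum-suc (𝟙 ∘ p) | enumerate (p ∘ suc)
... | false | ∑p | k , f , k≡ , inj , pf =
  k , suc ∘ f , trans k≡ (sym ∑p) , (λ i j → inj i j ∘ Fin.suc-injective) , pf
... | true  | ∑p | k , f , k≡ , inj , pf =
  suc k , f′ , trans (cong suc k≡) (sym ∑p) , inj′ , pf′
  where
  f′ : Fin (suc k) → Fin (suc m)
  f′ zero    = zero
  f′ (suc i) = suc (f i)
  inj′ : ∀ i j → f′ i ≡ f′ j → i ≡ j
  inj′ zero    zero    _  = refl
  inj′ (suc i) (suc j) eq = cong suc (inj i j (Fin.suc-injective eq))
  pf′ : ∀ i → p (f′ i) ≡ true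
  pf′ zero    = eq
  pf′ (suc i) = pf i

injectivePair-bound : {l r : Fin m → Fin n} → InjectivePair l r → m ≤ n * n
injectivePair-bound {m} {n} inj = begin
  m                                    ≡⟨ trans (∑-const m 1) (*-identityʳ m) ⟨
  sum {m} (λ _ → 1)                    ≤⟨ ∑-injectivePair inj (λ _ _ → 1) ⟩
  sum {n} (λ _ → sum {n} λ _ → 1)      ≡⟨ trans (∑∑-const n n 1) (*-identityʳ _) ⟩
  n * n                                ∎
  where open ≤-Reasoning

-- Independent edge sets over the field with two elements

private
  module Xor = SemiringSum (CommutativeRing.semiring xor-∧-commutativeRing)

  xor-== : (v : Fin n) (f : Fin n → Bool) → Xor.sum (λ u → f u ∧ (v == u)) ≡ f v
  xor-== {suc n} zero f = trans (cong₂ _xor_ (∧-true-r (f zero)) (zeros n)) (xor-false (f zero))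
    where
    ∧-true-r : ∀ p → p ∧ true ≡ p
    ∧-true-r false = refl
    ∧-true-r true  = refl
    xor-false : ∀ p → p xor false ≡ p
    xor-false false = refl
    xor-false true  = refl
    zeros : ∀ n {g : Fin n → Bool} → Xor.sum (λ u → g u ∧ false) ≡ false
    zeros zero    = refl
    zeros (suc n) {g} with g zero
    ... | false = zeros n
    ... | true  = zeros n
  xor-== {suc n} (suc v) f with f zero
  ... | false = xor-== v (f ∘ suc)
  ... | true  = xor-== v (f ∘ suc)

-- A set of edges P i — Q i is independent over F₂, hence has at most as many
-- elements as there are nodes, if for each edge i some 0/1 labelling (U i , V i)
-- of the nodes is constant on all edges except i.
module _ (P Q : Fin k → Fin M) (U V : Fin k → Fin M → Bool)
         (separated : ∀ i j → U i (P j) xor V i (Q j) ≡ (i == j)) where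

  private
    degree : (Fin k → Fin M) → (Fin k → Bool) → Fin M → Bool
    degree P b a = Xor.sum λ j → b j ∧ (P j == a)

    evaluate : (P : Fin k → Fin M) (b : Fin k → Bool) (U : Fin M → Bool) →
               Xor.sum (λ a → U a ∧ degree P b a) ≡ Xor.sum (λ j → b j ∧ U (P j))
    evaluate P b U = begin
      Xor.sum (λ a → U a ∧ degree P b a)
        ≡⟨ Xor.sum-cong-≗ (λ a → Xor.*-distribˡ-sum (U a) (λ j → b j ∧ (P j == a))) ⟩
      Xor.sum (λ a → Xor.sum λ j → U a ∧ (b j ∧ (P j == a)))
        ≡⟨ Xor.∑-comm (λ a j → U a ∧ (b j ∧ (P j == a))) ⟩
      Xor.sum (λ j → Xor.sum λ a → U a ∧ (b j ∧ (P j == a)))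
        ≡⟨ Xor.sum-cong-≗ (λ j → trans (Xor.sum-cong-≗ λ a → exchange (U a) (b j) (P j == a))
             (trans (sym (Xor.*-distribˡ-sum (b j) (λ a → U a ∧ (P j == a)))) (cong (b j ∧_) (xor-== (P j) U)))) ⟩
      Xor.sum (λ j → b j ∧ U (P j)) ∎
      where
      open ≡-Reasoning
      exchange : ∀ p q r → p ∧ (q ∧ r) ≡ q ∧ (p ∧ r)
      exchange false false r = refl
      exchange false true  r = refl
      exchange true  false r = refl
      exchange true  true  r = refl

    -- Pairing the degree parities of the edge set `b` with labelling `i` counts, modulo 2, the
    -- edges in `b` whose two ends have different labels. By `separated`, only edge `i` is of this
    -- kind.
    recover : ∀ b i → Xor.sum (λ a → U i a ∧ degree P b a) xor Xor.sum (λ a → V i a ∧ degree Q b a) ≡ b i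
    recover b i = begin
      Xor.sum (λ a → U i a ∧ degree P b a) xor Xor.sum (λ a → V i a ∧ degree Q b a)
        ≡⟨ cong₂ _xor_ (evaluate P b (U i)) (evaluate Q b (V i)) ⟩
      Xor.sum (λ j → b j ∧ U i (P j)) xor Xor.sum (λ j → b j ∧ V i (Q j))
        ≡⟨ Xor.∑-distrib-+ (λ j → b j ∧ U i (P j)) (λ j → b j ∧ V i (Q j)) ⟨
      Xor.sum (λ j → (b j ∧ U i (P j)) xor (b j ∧ V i (Q j)))
        ≡⟨ Xor.sum-cong-≗ (λ j → trans (distrib (b j) _ _) (cong (b j ∧_) (separated i j))) ⟩
      Xor.sum (λ j → b j ∧ (i == j))
        ≡⟨ xor-== i b ⟩
      b i ∎
      where
      open ≡-Reasoning
      distrib : ∀ p q r → (p ∧ q) xor (p ∧ r) ≡ p ∧ (q xor r)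
      distrib false q r = refl
      distrib true  q r = refl

    toBool : Fin 2 → Bool
    toBool zero    = false
    toBool (suc _) = true

    bit-toBool : ∀ c → bit (toBool c) ≡ c
    bit-toBool zero       = refl
    bit-toBool (suc zero) = refl

    subset : Fin (2 ^ k) → Fin k → Bool
    subset t = toBool ∘ Fin.finToFun t

    parities : Fin (2 ^ k) → Fin (2 ^ M * 2 ^ M)
    parities t = combine (Fin.funToFin (bit ∘ degree P (subset t))) (Fin.funToFin (bit ∘ degree Q (subset t)))

    funToFin-injective : {f g : Fin M → Fin 2} → Fin.funToFin f ≡ Fin.funToFin g → f ≗ g
    funToFin-injective {f} {g} eq a = trans (sym (Fin.finToFun-funToFin f a))
      (trans (cong (λ t → Fin.finToFun t a) eq) (Fin.finToFun-funToFin g a))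

    funToFin-cong : ∀ {k} {f g : Fin k → Fin 2} → f ≗ g → Fin.funToFin f ≡ Fin.funToFin g
    funToFin-cong {zero}  f≗g = refl
    funToFin-cong {suc k} f≗g = cong₂ combine (f≗g zero) (funToFin-cong (f≗g ∘ suc))

    parities-injective : ∀ {s t} → parities s ≡ parities t → s ≡ t
    parities-injective {s} {t} eq = begin
      s                                  ≡⟨ Fin.funToFin-finToFin {k} {2} s ⟨
      Fin.funToFin (Fin.finToFun {2} {k} s)      ≡⟨ funToFin-cong (λ i → begin
        Fin.finToFun s i                   ≡⟨ bit-toBool (Fin.finToFun s i) ⟨
        bit (subset s i)                   ≡⟨ cong bit (begin
          subset s i                         ≡⟨ recover (subset s) i ⟨
          _                                  ≡⟨ cong₂ _xor_ (Xor.sum-cong-≗ λ a → cong (U i a ∧_) (same-P a))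
                                                            (Xor.sum-cong-≗ λ a → cong (V i a ∧_) (same-Q a)) ⟩
          _                                  ≡⟨ recover (subset t) i ⟩
          subset t i                         ∎) ⟩
        bit (subset t i)                   ≡⟨ bit-toBool (Fin.finToFun t i) ⟩
        Fin.finToFun t i                   ∎) ⟩
      Fin.funToFin (Fin.finToFun {2} {k} t)      ≡⟨ Fin.funToFin-finToFin {k} {2} t ⟩
      t                                  ∎
      where
      open ≡-Reasoning
      codes = Fin.combine-injective (Fin.funToFin (bit ∘ degree P (subset s))) _ (Fin.funToFin (bit ∘ degree P (subset t))) _ eq
      same-P : degree P (subset s) ≗ degree P (subset t)
      same-P a = bit-injective (funToFin-injective (proj₁ codes) a)
      same-Q : degree Q (subset s) ≗ degree Q (subset t)
      same-Q a = bit-injective (funToFin-injective (proj₂ codes) a)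

  -- By `recover`, the `2 ^ k` edge sets have distinct pairs of parity vectors, and there are only
  -- `2 ^ (M + M)` such pairs; this counting takes the place of a dimension argument.
  separated-edges-bound : k ≤ M + M
  separated-edges-bound = ≮⇒≥ λ M+M<k →
    let s , t , s<t , eq = Fin.pigeonhole (<-≤-trans (≤-<-trans (≤-reflexive (sym (^-distribˡ-+-* 2 M M)))
                             (^-monoʳ-< 2 (s≤s (s≤s z≤n)) M+M<k)) ≤-refl) parities
    in Fin.<⇒≢ s<t (parities-injective eq)

-- The relation and the four ways to violate it

isZero : Fin 3 → Bool
isZero zero    = true
isZero (suc _) = false

-- The Boolean arguments are the truth values of w = 0, x = 0 and z = 0.
holds : Bool → Bool → Fin 3 → Bool → Bool
holds w x 0F z = if x then z ∧ not w else not z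
holds w x 1F z = not z
holds w x 2F z = not x

separating : Relation (Fin 3) 4
separating (w ∷ x ∷ y ∷ z ∷ []) = holds (isZero w) (isZero x) y (isZero z)

separating-map : (φ : Fin n → Fin 3) (s : Constraint n 4) → separating (Vec.map φ s) ≡
                 holds (isZero (φ (lookup s 0F))) (isZero (φ (lookup s 1F))) (φ (lookup s 2F)) (isZero (φ (lookup s 3F)))
separating-map φ (w ∷ x ∷ y ∷ z ∷ []) = refl

type₁ type₂ type₃ type₄ : Bool → Bool → Fin 3 → Bool → Bool
type₁ w x y z = does (y Fin.≟ 1F) ∧ z
type₂ w x y z = does (y Fin.≟ 2F) ∧ x
type₃ w x y z = does (y Fin.≟ 0F) ∧ (x xor z)
type₄ w x y z = does (y Fin.≟ 0F) ∧ (w ∧ (x ∧ z))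

types-exhaust : ∀ w x y z → holds w x y z ≡ false →
                1 ≤ 𝟙 (type₁ w x y z) + (𝟙 (type₂ w x y z) + (𝟙 (type₃ w x y z) + 𝟙 (type₄ w x y z)))
types-exhaust false true  0F false _ = s≤s z≤n
types-exhaust true  true  0F false _ = s≤s z≤n
types-exhaust true  true  0F true  _ = s≤s z≤n
types-exhaust false false 0F true  _ = s≤s z≤n
types-exhaust true  false 0F true  _ = s≤s z≤n
types-exhaust w     x     1F true  _ = s≤s z≤n
types-exhaust w     x     1F false ()
types-exhaust w     true  2F z     _ = s≤s z≤n
types-exhaust w     false 2F z     ()

type₁-sound : ∀ w x y z → type₁ w x y z ≡ true → y ≡ 1F × z ≡ true
type₁-sound w x 1F true _ = refl , refl

type₂-sound : ∀ w x y z → type₂ w x y z ≡ true → y ≡ 2F × x ≡ true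
type₂-sound w true 2F z _ = refl , refl

type₄-sound : ∀ w x y z → type₄ w x y z ≡ true → w ≡ true × x ≡ true × y ≡ 0F × z ≡ true
type₄-sound true true 0F true _ = refl , refl , refl , refl

-- The two edges of a constraint of type 3 are (x , y) and (y , z), and an
-- edge is labelled by whether both of its ends are 0.
edge-label : Fin 3 → Bool → Bool
edge-label y p = isZero y ∧ p

type₃-label : ∀ w x y z → type₃ w x y z ≡ true → edge-label y x xor edge-label y z ≡ true
type₃-label w x 0F z eq = eq

holds-label : ∀ w x y z → holds w x y z ≡ true → edge-label y x xor edge-label y z ≡ false
holds-label w false 0F false _ = refl
holds-label w true  0F true  _ = refl
holds-label w x     1F z     _ = refl
holds-label w x     2F z     _ = refl

module _ {n m} (w x y z : Fin m → Fin n) (φ : Fin m → Fin n → Fin 3)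
         (unsat : ∀ i → holds (isZero (φ i (w i))) (isZero (φ i (x i))) (φ i (y i)) (isZero (φ i (z i))) ≡ false)
         (sat : ∀ i j → j ≢ i → holds (isZero (φ i (w j))) (isZero (φ i (x j))) (φ i (y j)) (isZero (φ i (z j))) ≡ true)
         where

  private
    at : (Bool → Bool → Fin 3 → Bool → Bool) → Fin m → Bool
    at κ i = κ (isZero (φ i (w i))) (isZero (φ i (x i))) (φ i (y i)) (isZero (φ i (z i)))

    same-by-contradiction : ∀ {i j : Fin m} → (j ≢ i → true ≡ false) → i ≡ j
    same-by-contradiction {i} {j} absurd with i Fin.≟ j
    ... | yes i≡j = i≡j
    ... | no  i≢j = case absurd (i≢j ∘ sym) of λ ()

    -- Used to show that some of the coordinates determine a constraint: if `j` agrees with `i` in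
    -- them, then it fails under the assignment of `i` too, under which all constraints but `i`
    -- hold.
    clash : ∀ {i j} {w′ x′ y′ z′} → isZero (φ i (w j)) ≡ w′ → isZero (φ i (x j)) ≡ x′ → φ i (y j) ≡ y′ →
            isZero (φ i (z j)) ≡ z′ → holds w′ x′ y′ z′ ≡ false → i ≡ j
    clash {i} {j} refl refl refl refl fails = same-by-contradiction λ j≢i → trans (sym (sat i j j≢i)) fails

  type₁-bound : count (at type₁) ≤ n * n
  type₁-bound with enumerate (at type₁)
  ... | k , f , k≡ , inj , pf = subst (_≤ n * n) k≡ (injectivePair-bound pair)
    where
    pair : InjectivePair (y ∘ f) (z ∘ f)
    pair i j y≡ z≡ with type₁-sound (isZero (φ (f i) (w (f i)))) (isZero (φ (f i) (x (f i)))) (φ (f i) (y (f i))) (isZero (φ (f i) (z (f i)))) (pf i)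
    ... | y1 , z0 = inj i j (clash {w′ = isZero (φ (f i) (w (f j)))} {x′ = isZero (φ (f i) (x (f j)))} refl refl
      (trans (cong (φ (f i)) (sym y≡)) y1) (trans (cong (isZero ∘ φ (f i)) (sym z≡)) z0) refl)

  type₂-bound : count (at type₂) ≤ n * n
  type₂-bound with enumerate (at type₂)
  ... | k , f , k≡ , inj , pf = subst (_≤ n * n) k≡ (injectivePair-bound pair)
    where
    pair : InjectivePair (y ∘ f) (x ∘ f)
    pair i j y≡ x≡ with type₂-sound (isZero (φ (f i) (w (f i)))) (isZero (φ (f i) (x (f i)))) (φ (f i) (y (f i))) (isZero (φ (f i) (z (f i)))) (pf i)
    ... | y2 , x0 = inj i j (clash {w′ = isZero (φ (f i) (w (f j)))} {z′ = isZero (φ (f i) (z (f j)))} refl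
      (trans (cong (isZero ∘ φ (f i)) (sym x≡)) x0) (trans (cong (φ (f i)) (sym y≡)) y2) refl refl)

  type₃-bound : count (at type₃) ≤ n * n + n * n
  type₃-bound with enumerate (at type₃)
  ... | k , f , k≡ , inj , pf = subst (_≤ n * n + n * n) k≡ (separated-edges-bound P Q U V separated)
    where
    -- The nodes are two copies of the pairs of variables, and a constraint joins `(x , y)` to
    -- `(z , y)`. Under the assignment of `i`, exactly one end of edge `i` is labelled `true`,
    -- whereas the ends of a satisfied constraint have equal labels.
    P Q : Fin k → Fin (n * n)
    P i = combine (x (f i)) (y (f i))
    Q i = combine (z (f i)) (y (f i))
    U V : Fin k → Fin (n * n) → Bool
    U i a = edge-label (φ (f i) (proj₂ (Fin.remQuot {n} n a))) (isZero (φ (f i) (proj₁ (Fin.remQuot {n} n a))))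
    V = U
    U-combine : ∀ i u v → U i (combine u v) ≡ edge-label (φ (f i) v) (isZero (φ (f i) u))
    U-combine i u v = cong (λ (u , v) → edge-label (φ (f i) v) (isZero (φ (f i) u))) (Fin.remQuot-combine {n} u v)
    separated : ∀ i j → U i (P j) xor V i (Q j) ≡ (i == j)
    separated i j = trans (cong₂ _xor_ (U-combine i (x (f j)) (y (f j))) (U-combine i (z (f j)) (y (f j)))) (label i j)
      where
      label : ∀ i j → edge-label (φ (f i) (y (f j))) (isZero (φ (f i) (x (f j)))) xor
                      edge-label (φ (f i) (y (f j))) (isZero (φ (f i) (z (f j)))) ≡ (i == j)
      label i j with i Fin.≟ j
      ... | yes refl = type₃-label (isZero (φ (f i) (w (f i)))) (isZero (φ (f i) (x (f i)))) (φ (f i) (y (f i))) _ (pf i)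
      ... | no  i≢j  = holds-label (isZero (φ (f i) (w (f j)))) (isZero (φ (f i) (x (f j)))) (φ (f i) (y (f j))) _
                         (sat (f i) (f j) (i≢j ∘ sym ∘ inj j i))

  module _ (v : Fin n) {k} (f : Fin k → Fin m) (inj : ∀ i j → f i ≡ f j → i ≡ j)
           (type-4 : ∀ i → at type₄ (f i) ≡ true) (w≡v : ∀ i → w (f i) ≡ v) where

    private
      x′ y′ z′ : Fin k → Fin n
      x′ = x ∘ f
      y′ = y ∘ f
      z′ = z ∘ f

      meets₁₂? : ∀ a b → Dec (∃ λ j → x′ j ≡ a × y′ j ≡ b)
      meets₁₂? a b = Fin.any? λ j → (x′ j Fin.≟ a) ×-dec (y′ j Fin.≟ b)

      meets₂₃? : ∀ a b → Dec (∃ λ j → y′ j ≡ a × z′ j ≡ b)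
      meets₂₃? a b = Fin.any? λ j → (y′ j Fin.≟ a) ×-dec (z′ j Fin.≟ b)

      does-true : ∀ {A : Set} (a? : Dec A) → does a? ≡ true → A
      does-true (yes a) _ = a

      zeros : ∀ i → isZero (φ (f i) (w (f i))) ≡ true × isZero (φ (f i) (x′ i)) ≡ true ×
                    φ (f i) (y′ i) ≡ 0F × isZero (φ (f i) (z′ i)) ≡ true
      zeros i = type₄-sound _ _ _ _ (type-4 i)

      w0 : ∀ i j → isZero (φ (f i) (w (f j))) ≡ true
      w0 i j = trans (cong (isZero ∘ φ (f i)) (trans (w≡v j) (sym (w≡v i)))) (proj₁ (zeros i))

      x0 : ∀ i {u} → x′ i ≡ u → isZero (φ (f i) u) ≡ true
      x0 i refl = proj₁ (proj₂ (zeros i))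

      y0 : ∀ i {u} → y′ i ≡ u → φ (f i) u ≡ 0F
      y0 i refl = proj₁ (proj₂ (proj₂ (zeros i)))

      z0 : ∀ i {u} → z′ i ≡ u → isZero (φ (f i) u) ≡ true
      z0 i refl = proj₂ (proj₂ (proj₂ (zeros i)))

      not-0-0 : ∀ y → holds true true y true ≡ false
      not-0-0 0F = refl
      not-0-0 1F = refl
      not-0-0 2F = refl

      holds-y₁ : ∀ y z → holds true true y z ≡ true → y ≡ 1F
      holds-y₁ 0F false ()
      holds-y₁ 0F true  ()
      holds-y₁ 1F z     _ = refl
      holds-y₁ 2F z     ()

      holds-y₂ : ∀ x y → holds true x y true ≡ true → y ≡ 2F
      holds-y₂ true  0F ()
      holds-y₂ false 0F ()
      holds-y₂ x     1F ()
      holds-y₂ x     2F _ = refl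

      fails-0-z : ∀ x → holds true x 0F true ≡ false
      fails-0-z false = refl
      fails-0-z true  = refl

      fails-0-x : ∀ z → holds true true 0F z ≡ false
      fails-0-x false = refl
      fails-0-x true  = refl

      y-forced₁ : ∀ i j → x′ i ≡ x′ j → j ≢ i → φ (f i) (y′ j) ≡ 1F
      y-forced₁ i j x≡ j≢i = holds-y₁ _ _ (subst₂ (λ p q → holds p q (φ (f i) (y′ j)) (isZero (φ (f i) (z′ j))) ≡ true)
        (w0 i j) (x0 i x≡) (sat (f i) (f j) (j≢i ∘ inj j i)))

      y-forced₂ : ∀ i j → z′ i ≡ z′ j → j ≢ i → φ (f i) (y′ j) ≡ 2F
      y-forced₂ i j z≡ j≢i = holds-y₂ _ _ (subst₂ (λ p q → holds p (isZero (φ (f i) (x′ j))) (φ (f i) (y′ j)) q ≡ true)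
        (w0 i j) (z0 i z≡) (sat (f i) (f j) (j≢i ∘ inj j i)))

      -- If neither `j` nor `l` is `i`, then the assignment of `i` would have to give `v` both the
      -- value 1 and the value 2.
      unique-middle : ∀ i v → (∃ λ j → x′ j ≡ x′ i × y′ j ≡ v) → (∃ λ j → y′ j ≡ v × z′ j ≡ z′ i) → v ≡ y′ i
      unique-middle i v (j , xj , yj) (l , yl , zl) with j Fin.≟ i | l Fin.≟ i
      ... | yes refl | _        = sym yj
      ... | no _     | yes refl = sym yl
      ... | no j≢i   | no l≢i   = case trans (sym (y-forced₁ i j (sym xj) j≢i))
        (trans (cong (φ (f i)) (trans yj (sym yl))) (y-forced₂ i l (sym zl) l≢i)) of λ ()

    -- The constraints of the slice share `w`, which is 0 in each of their assignments. If `j`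
    -- shares two more coordinates with `i`, then these are 0 in the assignment of `i` as well, and
    -- the relation fails for every value of the remaining one; this gives injectivity.
    slice-system : IsRuzsaSzemerédi x′ y′ z′ (λ a b → does (meets₁₂? a b)) (λ a b → does (meets₂₃? a b))
    slice-system = record
      { injective₁₂ = λ i j x≡ y≡ → inj i j (clash (w0 i j) (x0 i x≡) (y0 i y≡) refl (fails-0-x _))
      ; injective₂₃ = λ i j y≡ z≡ → inj i j (clash (w0 i j) refl (y0 i y≡) (z0 i z≡) (fails-0-z _))
      ; injective₁₃ = λ i j x≡ z≡ → inj i j (clash (w0 i j) (x0 i x≡) refl (z0 i z≡) (not-0-0 (φ (f i) (y′ j))))
      ; edge₁₂      = λ i → dec-true (meets₁₂? (x′ i) (y′ i)) (i , refl , refl)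
      ; edge₂₃      = λ i → dec-true (meets₂₃? (y′ i) (z′ i)) (i , refl , refl)
      ; induced     = λ i v p q → unique-middle i v (does-true (meets₁₂? (x′ i) v) p) (does-true (meets₂₃? v (z′ i)) q)
      }

  type₄-bound : ∀ e → tower (800 * suc e) ≤ n → count (at type₄) * 2 ^ e ≤ n * (n * n)
  type₄-bound e tower≤n = begin
    count (at type₄) * 2 ^ e
      ≡⟨ cong (_* 2 ^ e) (∑-fibres w (λ i _ → 𝟙 (at type₄ i))) ⟨
    sum (λ v → sum λ i → 𝟙 (w i == v) * 𝟙 (at type₄ i)) * 2 ^ e
      ≡⟨ cong (_* 2 ^ e) (∑∑-cong λ v i → 𝟙-∧ (w i == v) (at type₄ i)) ⟨
    sum (λ v → count (λ i → (w i == v) ∧ at type₄ i)) * 2 ^ e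
      ≡⟨ *-distribʳ-sum (2 ^ e) (λ v → count (λ i → (w i == v) ∧ at type₄ i)) ⟩
    sum (λ v → count (λ i → (w i == v) ∧ at type₄ i) * 2 ^ e)
      ≤⟨ ∑-bound _ (n * n) slice ⟩
    n * (n * n) ∎
    where
    open ≤-Reasoning
    slice : ∀ v → count (λ i → (w i == v) ∧ at type₄ i) * 2 ^ e ≤ n * n
    slice v with enumerate (λ i → (w i == v) ∧ at type₄ i)
    ... | k , f , k≡ , inj , pf = subst (λ k → k * 2 ^ e ≤ n * n) k≡
      (ruzsa-szemerédi (slice-system v f inj (λ i → proj₂ (∧-true {w (f i) == v} (pf i)))
                                             (λ i → ==⇒≡ (proj₁ (∧-true {w (f i) == v} (pf i))))) e tower≤n)

  -- The first three types have at most `4 * (n * n)` constraints, which is at most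
  -- `n ^ 3 / 2 ^ suc e` for such `n`. The fourth type obeys the same bound by `type₄-bound` at
  -- `suc e`, and the two halves add up to `n ^ 3 / 2 ^ e`.
  types-bound : ∀ e → tower (800 * suc (suc e)) ≤ n → m * 2 ^ e ≤ n ^ 3
  types-bound e tower≤n = *-cancelˡ-≤ 2 (begin
    2 * (m * 2 ^ e)
      ≡⟨ x*yz≡y*xz m (2 ^ e) ⟩
    m * 2 ^ suc e
      ≤⟨ *-monoˡ-≤ (2 ^ suc e) m≤ ⟩
    (n * n + (n * n + (n * n + n * n + c₄))) * 2 ^ suc e
      ≡⟨ expand (n * n) c₄ (2 ^ e) ⟩
    n * n * (2 ^ (3 + e)) + c₄ * 2 ^ suc e
      ≤⟨ +-mono-≤ (*-monoʳ-≤ (n * n) (≤-trans (2^[2+e]≤tower (suc e)) tower≤n)) (type₄-bound (suc e) tower≤n) ⟩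
    n * n * n + n * (n * n)
      ≡⟨ cube n ⟩
    2 * n ^ 3 ∎)
    where
    open ≤-Reasoning
    c₄ : ℕ
    c₄ = count (at type₄)
    x*yz≡y*xz : ∀ m t → 2 * (m * t) ≡ m * (2 * t)
    x*yz≡y*xz = solve-∀
    expand : ∀ s c t → (s + (s + (s + s + c))) * (2 * t) ≡ s * (2 * (2 * (2 * t))) + c * (2 * t)
    expand = solve-∀
    cube : ∀ n → n * n * n + n * (n * n) ≡ 2 * (n * (n * (n * 1)))
    cube = solve-∀
    m≤ : m ≤ n * n + (n * n + (n * n + n * n + c₄))
    m≤ = begin
      m                    ≡⟨ trans (∑-const m 1) (*-identityʳ m) ⟨
      sum {m} (λ _ → 1)    ≤⟨ ∑-mono (λ i → types-exhaust _ _ (φ i (y i)) _ (unsat i)) ⟩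
      sum (λ i → 𝟙 (at type₁ i) + (𝟙 (at type₂ i) + (𝟙 (at type₃ i) + 𝟙 (at type₄ i))))
        ≡⟨ trans (∑-distrib-+ _ _) (cong (count (at type₁) +_) (trans (∑-distrib-+ _ _) (cong (count (at type₂) +_) (∑-distrib-+ _ _)))) ⟩
      count (at type₁) + (count (at type₂) + (count (at type₃) + c₄))
        ≤⟨ +-mono-≤ type₁-bound (+-mono-≤ type₂-bound (+-monoˡ-≤ c₄ type₃-bound)) ⟩
      n * n + (n * n + (n * n + n * n + c₄)) ∎

nonRedundant-bound : HasNonRedundant separating n m → ∀ e → tower (800 * suc (suc e)) ≤ n → m * 2 ^ e ≤ n ^ 3
nonRedundant-bound {n} {m} (S , nr) = types-bound (coordinate 0F) (coordinate 1F) (coordinate 2F) (coordinate 3F)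
  (λ i → proj₁ (nr i)) unsat sat
  where
  coordinate : Fin 4 → Fin m → Fin n
  coordinate c i = lookup (lookup S i) c
  ¬T : ∀ {p} → ¬ T p → p ≡ false
  ¬T {false} _  = refl
  ¬T {true}  ¬p = contradiction _ ¬p
  T⇒≡ : ∀ {p} → T p → p ≡ true
  T⇒≡ {true} _ = refl
  unsat : ∀ i → _
  unsat i = trans (sym (separating-map (proj₁ (nr i)) (lookup S i))) (¬T (proj₁ (proj₂ (nr i))))
  sat : ∀ i j → j ≢ i → _
  sat i j j≢i = trans (sym (separating-map (proj₁ (nr i)) (lookup S j))) (T⇒≡ (proj₂ (proj₂ (nr i)) j j≢i))

-- Chains

module _ (k r : ℕ) where

  private
    -- There are `k` variables for each of w, x and y, `k + k` for the sums, and `r` further ones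
    -- that pad the total to an arbitrary `n`.
    Vertex : Set
    Vertex = Fin (k + (k + (k + ((k + k) + r))))

    w-vertex x-vertex y-vertex : Fin k → Vertex
    w-vertex c = c ↑ˡ _
    x-vertex a = k ↑ʳ (a ↑ˡ _)
    y-vertex b = k ↑ʳ (k ↑ʳ (b ↑ˡ _))

    z-vertex : Fin (k + k) → Vertex
    z-vertex s = k ↑ʳ (k ↑ʳ (k ↑ʳ (s ↑ˡ r)))

    add : Fin k → Fin k → Fin (k + k)
    add a b = fromℕ< (+-mono-< (Fin.toℕ<n a) (Fin.toℕ<n b))

    toℕ-add : ∀ a b → toℕ (add a b) ≡ toℕ a + toℕ b
    toℕ-add a b = Fin.toℕ-fromℕ< _

    zero-at : Fin l → Fin l → Fin 3
    zero-at a u = if a == u then 0F else 1F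

    compare-to : Fin k → Fin k → Fin 3
    compare-to b v with Fin.<-cmp v b
    ... | tri< _ _ _ = 1F
    ... | tri≈ _ _ _ = 0F
    ... | tri> _ _ _ = 2F

    assignment : (a b c : Fin k) → Vertex → Fin 3
    assignment a b c v =
      [ zero-at c
      , (λ v → [ zero-at a
      , (λ v → [ compare-to b
      , (λ v → [ zero-at (add a b) , const 1F ]′ (splitAt (k + k) v)) ]′ (splitAt k v)) ]′ (splitAt k v)) ]′ (splitAt k v)

    assignment-w : ∀ a b c u → assignment a b c (w-vertex u) ≡ zero-at c u
    assignment-w a b c u rewrite Fin.splitAt-↑ˡ k u (k + (k + ((k + k) + r))) = refl

    assignment-x : ∀ a b c u → assignment a b c (x-vertex u) ≡ zero-at a u
    assignment-x a b c u rewrite Fin.splitAt-↑ʳ k (k + (k + ((k + k) + r))) (u ↑ˡ (k + ((k + k) + r)))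
                               | Fin.splitAt-↑ˡ k u (k + ((k + k) + r)) = refl

    assignment-y : ∀ a b c u → assignment a b c (y-vertex u) ≡ compare-to b u
    assignment-y a b c u rewrite Fin.splitAt-↑ʳ k (k + (k + ((k + k) + r))) (k ↑ʳ (u ↑ˡ ((k + k) + r)))
                               | Fin.splitAt-↑ʳ k (k + ((k + k) + r)) (u ↑ˡ ((k + k) + r))
                               | Fin.splitAt-↑ˡ k u ((k + k) + r) = refl

    assignment-z : ∀ a b c s → assignment a b c (z-vertex s) ≡ zero-at (add a b) s
    assignment-z a b c s rewrite Fin.splitAt-↑ʳ k (k + (k + ((k + k) + r))) (k ↑ʳ (k ↑ʳ (s ↑ˡ r)))
                               | Fin.splitAt-↑ʳ k (k + ((k + k) + r)) (k ↑ʳ (s ↑ˡ r))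
                               | Fin.splitAt-↑ʳ k ((k + k) + r) (s ↑ˡ r)
                               | Fin.splitAt-↑ˡ (k + k) s r = refl

    triple : Fin (k * k * k) → Fin k × Fin k × Fin k
    triple t = let p , c = Fin.remQuot {k * k} k t ; a , b = Fin.remQuot {k} k p in a , b , c

    combine-triple : ∀ t → let a , b , c = triple t in combine (combine a b) c ≡ t
    combine-triple t = trans (cong (λ p → combine p (proj₂ (Fin.remQuot {k * k} k t))) (Fin.combine-remQuot {k} k _))
                             (Fin.combine-remQuot {k * k} k t)

    constraint : Fin (k * k * k) → Constraint (k + (k + (k + ((k + k) + r)))) 4
    constraint t = let a , b , c = triple t in
      w-vertex c ∷ x-vertex a ∷ y-vertex b ∷ z-vertex (add a b) ∷ []

    value : (a b c a′ b′ c′ : Fin k) → Bool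
    value a b c a′ b′ c′ = holds (c == c′) (a == a′) (compare-to b b′) (add a b == add a′ b′)

    isZero-zero-at : (a u : Fin l) → isZero (zero-at a u) ≡ (a == u)
    isZero-zero-at a u with a == u
    ... | true  = refl
    ... | false = refl

    holds-cong : ∀ {w w′ x x′ y y′ z z′} → w ≡ w′ → x ≡ x′ → y ≡ y′ → z ≡ z′ → holds w x y z ≡ holds w′ x′ y′ z′
    holds-cong refl refl refl refl = refl

    evaluate-constraint : ∀ a b c t → let a′ , b′ , c′ = triple t in
                          separating (Vec.map (assignment a b c) (constraint t)) ≡ value a b c a′ b′ c′
    evaluate-constraint a b c t = let a′ , b′ , c′ = triple t in holds-cong
      (trans (cong isZero (assignment-w a b c c′)) (isZero-zero-at c c′))
      (trans (cong isZero (assignment-x a b c a′)) (isZero-zero-at a a′))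
      (assignment-y a b c b′)
      (trans (cong isZero (assignment-z a b c (add a′ b′))) (isZero-zero-at (add a b) (add a′ b′)))

    ≢⇒==-false : {u v : Fin l} → u ≢ v → (u == v) ≡ false
    ≢⇒==-false {u = u} {v} u≢v with u Fin.≟ v
    ... | yes u≡v = contradiction u≡v u≢v
    ... | no _    = refl

    value-self : ∀ a b c → value a b c a b c ≡ false
    value-self a b c with Fin.<-cmp b b
    ... | tri< b<b _ _ = contradiction b<b (Fin.<-irrefl refl)
    ... | tri> _ _ b<b = contradiction b<b (Fin.<-irrefl refl)
    ... | tri≈ _ _ _ rewrite ==-refl c | ==-refl a | ==-refl (add a b) = refl

    combine-monoʳ-< : ∀ {l l′} (a : Fin l) {b b′ : Fin l′} → b Fin.< b′ → combine a b Fin.< combine a b′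
    combine-monoʳ-< {l} {l′} a {b} {b′} b<b′ = subst₂ _<_ (sym (Fin.toℕ-combine a b)) (sym (Fin.toℕ-combine a b′))
      (+-monoʳ-< (l′ * toℕ a) b<b′)

    -- If `b′` is smaller, the constraint fails only when the sums agree, but then `a` is smaller
    -- than `a′` and the constraint would come later. If `b′` is larger, it fails only when `a` is
    -- `a′`, and again it would come later. If `b′` is `b`, the sums agree exactly when `a` is `a′`;
    -- in that case `c′` differs from `c`, so that w is not 0.
    value-earlier : ∀ a b c a′ b′ c′ → combine (combine a′ b′) c′ Fin.< combine (combine a b) c →
                    value a b c a′ b′ c′ ≡ true
    value-earlier a b c a′ b′ c′ earlier with Fin.<-cmp b′ b
    ... | tri< b′<b _ _ = cong not (≢⇒==-false λ eq → contradiction earlier (later (sums eq)))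
      where
      sums : add a b ≡ add a′ b′ → a Fin.< a′
      sums eq = +-cancelʳ-< (toℕ b) (toℕ a) (toℕ a′) (begin-strict
        toℕ a + toℕ b      ≡⟨ trans (sym (toℕ-add a b)) (trans (cong toℕ eq) (toℕ-add a′ b′)) ⟩
        toℕ a′ + toℕ b′    <⟨ +-monoʳ-< (toℕ a′) b′<b ⟩
        toℕ a′ + toℕ b     ∎)
        where open ≤-Reasoning
      later : a Fin.< a′ → ¬ (combine (combine a′ b′) c′ Fin.< combine (combine a b) c)
      later a<a′ = <-asym (Fin.combine-monoˡ-< c c′ (Fin.combine-monoˡ-< b b′ a<a′))
    ... | tri> _ _ b<b′ = cong not (≢⇒==-false {u = a} {a′} λ { refl →
      <-asym earlier (Fin.combine-monoˡ-< c c′ (combine-monoʳ-< a b<b′)) })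
    ... | tri≈ _ refl _ with a Fin.≟ a′
    ...   | no a≢a′  = cong not (≢⇒==-false λ eq → a≢a′ (Fin.toℕ-injective
      (+-cancelʳ-≡ (toℕ b) (toℕ a) (toℕ a′) (trans (sym (toℕ-add a b)) (trans (cong toℕ eq) (toℕ-add a′ b))))))
    ...   | yes refl = trans (cong (_∧ not (c == c′)) (==-refl (add a b)))
      (cong not (≢⇒==-false {u = c} {c′} λ { refl → <-irrefl refl earlier }))

  chain : HasChain separating (k + (k + (k + ((k + k) + r)))) (k * k * k)
  chain = Vec.tabulate constraint , λ t → let a , b , c = triple t in
    assignment a b c ,
    (λ sat → subst T (trans (cong (separating ∘ Vec.map (assignment a b c)) (lookup∘tabulate constraint t))
                            (trans (evaluate-constraint a b c t) (value-self a b c))) sat) ,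
    (λ s s<t → subst T (sym (trans (cong (separating ∘ Vec.map (assignment a b c)) (lookup∘tabulate constraint s))
                 (trans (evaluate-constraint a b c s) (value-earlier a b c _ _ _
                   (subst₂ Fin._<_ (sym (combine-triple s)) (sym (combine-triple t)) s<t))))) _)

-- The construction takes `5 * q + r` variables with `r < 5`. As `q` is positive, `n ≤ 10 * q`, and
-- the constant is `10 ^ 3`.
chain-bound : ∀ n → 5 ≤ n → ∃ λ m → HasChain separating n m × n ^ 3 ≤ 1000 * m
chain-bound n 5≤n = q * q * q , subst (λ n → HasChain separating n (q * q * q)) (sym size) (chain q r) , (begin
  n ^ 3                         ≤⟨ ^-monoˡ-≤ 3 n≤10q ⟩
  (10 * q) ^ 3                  ≡⟨ cube q ⟩
  1000 * (q * q * q)            ∎)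
  where
  open ≤-Reasoning
  q r : ℕ
  q = n div 5
  r = n % 5
  five : ∀ k r → r + k * 5 ≡ k + (k + (k + ((k + k) + r)))
  five = solve-∀
  size : n ≡ q + (q + (q + ((q + q) + r)))
  size = trans (m≡m%n+[m/n]*n n 5) (five q r)
  0<q : 0 < q
  0<q = n≢0⇒n>0 λ q≡0 → <⇒≱ (m%n<n n 5) (≤-trans 5≤n (≤-reflexive
    (trans (m≡m%n+[m/n]*n n 5) (trans (cong (λ k → r + k * 5) q≡0) (+-identityʳ r)))))
  n≤10q : n ≤ 10 * q
  n≤10q = begin
    n                ≡⟨ m≡m%n+[m/n]*n n 5 ⟩
    r + q * 5        ≤⟨ +-monoˡ-≤ (q * 5) (<⇒≤ (m%n<n n 5)) ⟩
    5 + q * 5        ≤⟨ +-monoˡ-≤ (q * 5) (*-monoˡ-≤ 5 0<q) ⟩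
    q * 5 + q * 5    ≡⟨ ten q ⟩
    10 * q           ∎
    where
    ten : ∀ k → k * 5 + k * 5 ≡ 10 * k
    ten = solve-∀
  cube : ∀ k → 10 * k * (10 * k * (10 * k * 1)) ≡ 1000 * (k * k * k)
  cube = solve-∀

-- Passing to the rational constants

open import Data.Integer using (+_; +≤+)

thousandth : ∀ {a b} → a ≤ 1000 * b → (+ 1 / 1000) ℚ.* (+ a / 1) ℚ.≤ (+ b / 1)
thousandth {a} {b} a≤1000b = ℚ.toℚᵘ-cancel-≤ (begin
  toℚᵘ ((+ 1 / 1000) ℚ.* (+ a / 1))              ≃⟨ ℚ.toℚᵘ-homo-* (+ 1 / 1000) (+ a / 1) ⟩
  toℚᵘ (+ 1 / 1000) ℚᵘ.* toℚᵘ (+ a / 1)          ≃⟨ ℚᵘ.*-congˡ {toℚᵘ (+ 1 / 1000)} (ℚ.toℚᵘ-fromℚᵘ (ℚᵘ.mkℚᵘ (+ a) 0)) ⟩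
  ℚᵘ.mkℚᵘ (+ 1) 999 ℚᵘ.* ℚᵘ.mkℚᵘ (+ a) 0         ≤⟨ ℚᵘ.*≤* (begin-ℤ) ⟩
  ℚᵘ.mkℚᵘ (+ b) 0                                ≃⟨ ℚ.toℚᵘ-fromℚᵘ (ℚᵘ.mkℚᵘ (+ b) 0) ⟨
  toℚᵘ (+ b / 1)                                 ∎)
  where
  open ℚᵘ.≤-Reasoning
  begin-ℤ : + 1 ℤ.* + a ℤ.* + 1 ℤ.≤ + b ℤ.* + 1000
  begin-ℤ = subst₂ ℤ._≤_ (sym (trans (ℤ.*-identityʳ _) (ℤ.*-identityˡ (+ a))))
    (trans (cong +_ (*-comm 1000 b)) (ℤ.pos-* b 1000)) (+≤+ a≤1000b)

^-distribʳ-* : ∀ q x y → (x * y) ^ q ≡ x ^ q * y ^ q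
^-distribʳ-* zero    x y = refl
^-distribʳ-* (suc q) x y = trans (cong (x * y *_) (^-distribʳ-* q x y)) (interchange x y (x ^ q) (y ^ q))

-- For `c = 1 / q`, the inequality `x * 2 ^ e ≤ y` is raised to the power `q`, after which
-- `2 ^ (q * e)` absorbs `2 ^ L`.
≤-/2^ : ∀ {x y e L} (c : ℚ) → ℤ.∣ ↥ c ∣ ≡ 1 → L ≤ ↧ₙ c * e → x * 2 ^ e ≤ y → x ≤ y /2^[ c · L ]
≤-/2^ {x} {y} {e} {L} c ∣↥c∣≡1 L≤ x2^e≤y = begin
  x ^ ↧ₙ c * 2 ^ (ℤ.∣ ↥ c ∣ * L)    ≡⟨ cong (λ p → x ^ ↧ₙ c * 2 ^ p) (trans (cong (_* L) ∣↥c∣≡1) (*-identityˡ L)) ⟩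
  x ^ ↧ₙ c * 2 ^ L                  ≤⟨ *-monoʳ-≤ (x ^ ↧ₙ c) (^-monoʳ-≤ 2 (≤-trans L≤ (≤-reflexive (*-comm (↧ₙ c) e)))) ⟩
  x ^ ↧ₙ c * 2 ^ (e * ↧ₙ c)         ≡⟨ cong (x ^ ↧ₙ c *_) (^-*-assoc 2 e (↧ₙ c)) ⟨
  x ^ ↧ₙ c * (2 ^ e) ^ ↧ₙ c         ≡⟨ ^-distribʳ-* (↧ₙ c) x (2 ^ e) ⟨
  (x * 2 ^ e) ^ ↧ₙ c                ≤⟨ ^-monoˡ-≤ (↧ₙ c) x2^e≤y ⟩
  y ^ ↧ₙ c                          ∎
  where open ≤-Reasoning

-- Opaque, lest the tower be evaluated.
opaque
  h₀ : ℕ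
  h₀ = 2400

  2400≤h₀ : 2400 ≤ h₀
  2400≤h₀ = ≤-refl

log*-exponent : ∀ {n} → tower h₀ < n → ∃ λ e → tower (800 * suc (suc e)) ≤ n × log* n ≤ 3200 * e
log*-exponent {n} tower<n = e , <⇒≤ (<log*⇒tower< below) , above
  where
  open ≤-Reasoning
  q r e : ℕ
  q = pred (log* n) div 800
  r = pred (log* n) % 800
  -- `q` is the largest number with `800 * q < log* n`, and it plays the role of `suc (suc e)` in
  -- the height of the tower. Since `log* n` exceeds 2400, `e` is positive, so in `above` the
  -- additive 2400 is at most `2400 * e`; this yields 3200.
  e = q ∸ 2

  2400<log* : 2400 < log* n
  2400<log* = ≤-<-trans 2400≤h₀ (tower<⇒<log* tower<n)

  division : log* n ≡ suc (r + q * 800)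
  division = trans (sym (suc-pred (log* n) {{>-nonZero (≤-trans z<s 2400<log*)}})) (cong suc (m≡m%n+[m/n]*n (pred (log* n)) 800))

  3≤q : 3 ≤ q
  3≤q = ≮⇒≥ λ q<3 → <⇒≱ 2400<log* (begin
    log* n               ≡⟨ division ⟩
    suc (r + q * 800)    ≤⟨ +-mono-≤ (m%n<n (pred (log* n)) 800) (*-monoˡ-≤ 800 {q} {2} (≤-pred q<3)) ⟩
    800 + 2 * 800        ≡⟨⟩
    2400                 ∎)

  q≡2+e : q ≡ suc (suc e)
  q≡2+e = sym (m+[n∸m]≡n (≤-trans (n≤1+n 2) 3≤q))

  1≤e : 1 ≤ e
  1≤e = ∸-monoˡ-≤ 2 3≤q

  below : 800 * suc (suc e) < log* n
  below = begin
    suc (800 * suc (suc e))    ≡⟨ cong (λ q → suc (800 * q)) q≡2+e ⟨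
    suc (800 * q)              ≡⟨ cong suc (*-comm 800 q) ⟩
    suc (q * 800)              ≤⟨ s≤s (m≤n+m (q * 800) r) ⟩
    suc (r + q * 800)          ≡⟨ division ⟨
    log* n                     ∎

  above : log* n ≤ 3200 * e
  above = begin
    log* n                       ≡⟨ division ⟩
    suc r + q * 800              ≤⟨ +-monoˡ-≤ (q * 800) (m%n<n (pred (log* n)) 800) ⟩
    800 + q * 800                ≡⟨ cong (λ q → 800 + q * 800) {q} {suc (suc e)} q≡2+e ⟩
    800 + suc (suc e) * 800      ≡⟨ expand e ⟩
    2400 + 800 * e               ≤⟨ +-monoˡ-≤ (800 * e) (*-monoʳ-≤ 2400 1≤e) ⟩
    2400 * e + 800 * e           ≡⟨ *-distribʳ-+ e 2400 800 ⟨
    3200 * e                     ∎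
    where
    expand : ∀ e → 800 + suc (suc e) * 800 ≡ 2400 + 800 * e
    expand = solve-∀

5≤tower-h₀ : 5 ≤ tower h₀
5≤tower-h₀ = ≤-trans (≤ᵇ⇒≤ 5 16 _) (tower-mono {3} (≤-trans (≤ᵇ⇒≤ 3 2400 _) 2400≤h₀))

theorem1p1 : Σ Set λ D →
    Σ (D ↔ Fin 3) λ ∣D∣≡3 →
    Σ (Relation D 4) λ R →
    Σ ℚ λ c₁ → Σ ℚ λ c₂ → Σ ℕ λ n₀ →
    c₁ ℚ.> ℚ.0ℚ × c₂ ℚ.> ℚ.0ℚ ×
    (∀ n → n ≥ n₀ →
    c₁ ℚ.* ((+ (n ^ 3)) / 1) ℚ.≤ ((+ (CL ∣D∣≡3 R n)) / 1) ×
    NRD ∣D∣≡3 R n ≤ n ^ 3 /2^[ c₂ · log* n ])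
theorem1p1 = Fin 3 , ↔-id (Fin 3) , separating , + 1 / 1000 , + 1 / 3200 , suc (tower h₀) ,
  ℚ.positive⁻¹ (+ 1 / 1000) , ℚ.positive⁻¹ (+ 1 / 3200) ,
  λ n n≥n₀ → chains n n≥n₀ , nonRedundant n (log*-exponent n≥n₀)
  where
  chains : ∀ n → suc (tower h₀) ≤ n →
           (+ 1 / 1000) ℚ.* (+ (n ^ 3) / 1) ℚ.≤ (+ (CL (↔-id (Fin 3)) separating n) / 1)
  chains n n≥n₀ =
    let m , hasChain , n³≤1000m = chain-bound n (≤-trans 5≤tower-h₀ (<⇒≤ n≥n₀))
    in thousandth {n ^ 3} {CL (↔-id (Fin 3)) separating n} (≤-trans n³≤1000m
         (*-monoʳ-≤ 1000 (proj₂ (proj₂ (maximalChain (↔-id (Fin 3)) separating n)) hasChain)))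
  nonRedundant : ∀ n → (∃ λ e → tower (800 * suc (suc e)) ≤ n × log* n ≤ 3200 * e) →
                 NRD (↔-id (Fin 3)) separating n ≤ n ^ 3 /2^[ + 1 / 3200 · log* n ]
  nonRedundant n (e , tower≤n , log*≤) = ≤-/2^ {NRD (↔-id (Fin 3)) separating n} {n ^ 3} {e} {log* n} (+ 1 / 3200) refl log*≤
    (nonRedundant-bound (proj₁ (proj₂ (maximalNonRedundant (↔-id (Fin 3)) separating n))) e tower≤n)
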